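{- Let $n\ge 0$. The assignment $\partial_i^J\mapsto \partial_{\mathtt a_i^J}$ (and the identification of compositions of $n$ with subsets $J\subset S$ on objects) defines an isomorphism of $\mathbb Z$-linear categories (algebroids) $$\psi\colon \mathrm{LNC}(n)\xrightarrow{\ \sim\ }\mathcal{AD}(\mathcal S_n)$$ from the labeled nilCoxeter algebroid to the atomic subcategory $\mathcal{AD}(\mathcal S_n)$ of the nilCoxeter algebroid of double cosets $\mathcal D(\mathcal S_n)$.
   Context: $W=\mathcal S_n$, $S=\{s_1,\dots,s_{n-1}\}$, length $\ell$. For $I\subset S$, $W_I$ is the parabolic subgroup, $w_I$ its longest element, $\ell(I)=\ell(w_I)$. An $(I,J)$-coset is an element $p\in W_I\backslash W/W_J$ (with $(I,J)$ part of the data), with Bruhat-maximal element $\overline p$. Let $*$ be the $0$-Hecke (star) product on $W$ ($s*w=sw$ if $\ell(sw)>\ell(w)$, else $s*w=w$). For an $(I,J)$-coset $p$ and a $(J,K)$-coset $q$, $p*q=W_I(\overline p*\overline q)W_K$; it is reduced if $\overline p*\overline q=(\overline pw_J^{ -1})\overline q$ with $\ell(\overline p*\overline q)=\ell(\overline p)-\ell(J)+\ell(\overline q)$. $\mathcal D=\mathcal D(W,S)$ is the $\mathbb Z$-linear category whose objects are the subsets of $S$, with $\mathrm{Hom}(J,I)$ the free $\mathbb Z$-module with basis $\{\partial_p\}$ over $(I,J)$-cosets $p$, and composition $\partial_p\circ\partial_q=\partial_{p*q}$ if $p*q$ is reduced, $\partial_p\circ\partial_q=0$ otherwise. Atomic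 cosets: for $J\subset S$ write $S\setminus J=\{s_{d_1},\dots,s_{d_l}\}$, $d_1<\dots<d_l$. For $s=s_{d_i}$, $M=J\cup\{s\}$, $t=w_Msw_M$, let $\mathtt a_i^J$ be the $(M\setminus\{t\},J)$-coset containing $w_M$. These are the atomic cosets. $\mathcal{AD}(\mathcal S_n)$ is the (non-full) $\mathbb Z$-linear subcategory of $\mathcal D$ with all objects, generated by $\partial_p$ for $p$ atomic. $\mathrm{LNC}(n)$ is the $\mathbb Z$-linear category presented as follows. Objects are compositions $(n_1,\dots,n_k)$ of $n$ (positive parts, $\sum n_c=n$), identified with the subset $J\subset S$ such that $W_J=\mathcal S_{n_1}\times\cdots\times\mathcal S_{n_k}$. Generating morphisms are $\partial_i^J$ for $1\le i\le k-1$, from $J\leftrightarrow(n_1,\dots,n_i,n_{i+1},\dots,n_k)$ to $(n_1,\dots,n_{i+1},n_i,\dots,n_k)$. The relations, for every $J$ (omitted superscripts being the unique ones making compositions well defined), are $\partial_i\partial_{i+1}\partial_i^J=\partial_{i+1}\partial_i\partial_{i+1}^J$ for $1\le i\le k-2$; $\partial_i\partial_j^J=\partial_j\partial_i^J$ for $|i-j|>1$; and $\partial_i\partial_i^J=0$ for $1\le i\le k-1$. -}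

module Defs where

open import Algebra.Bundles using (AbelianGroup)
open import Algebra.Morphism.Structures using (IsGroupIsomorphism)
open import Data.Bool.Base using (true; false; if_then_else_; _∧_; not)
open import Data.Fin.Base using (Fin; zero; suc; inject₁; punchIn; toℕ)
import Data.Fin.Properties as Fin
open import Data.Fin.Permutation as Perm
  using (Permutation′; _⟨$⟩ʳ_; _∘ₚ_; transpose; lift₀; remove; insert; _≈_)
open import Data.Fin.Subset using (Subset; _∈_; _∪_; ⁅_⁆; ⊤)
open import Data.Fin.Subset.Properties using (_∈?_)
open import Data.List.Base
  using (List; []; _∷_; _++_; foldr; length; map; filter; reverse;
         allFin; lookup; concatMap)
open import Data.Nat.ListAction using (sum)
open import Data.List.Properties using (unfold-reverse)
open import Data.List.Membership.Propositional as List using ()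
open import Data.List.Membership.Propositional.Properties
  using (∈-filter⁺; ∈-concatMap⁺; ∈-map⁺; ∈-allFin)
open import Data.List.Relation.Unary.All as All using (All; []; _∷_)
import Data.List.Relation.Unary.All.Properties as All
open import Data.List.Relation.Unary.Any as Any using (Any; here; there; any?)
import Data.List.Relation.Unary.Any.Properties as Any
open import Data.Nat.Base
  using (ℕ; zero; suc; pred; _+_; _∸_; _≤_; _<_; _<ᵇ_; ∣_-_∣; z≤n; s≤s)
import Data.Nat.Properties as ℕ
open import Data.Product.Base using (Σ; ∃; ∃₂; Σ-syntax; _×_; _,_; proj₁; proj₂)
open import Data.Vec.Base as Vec using ([]; _∷_)
open import Function.Base using (_∘_)
open import Function.Bundles using (_⇔_)
open import Function.Definitions using (Bijective)
open import Level using (0ℓ)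
open import Relation.Binary.PropositionalEquality
  using (_≡_; refl; sym; trans; cong)
open import Relation.Nullary using (Dec; yes; no; does; contradiction; ¬?)
open import Relation.Nullary.Decidable using (map′; _×-dec_)
open import Relation.Unary using (Decidable)

open import Data.List.Extrema ℕ.≤-totalOrder
  using (argmax; argmax-all; f[xs]≤f[argmax])

------------------------------------------------------------------------
-- The symmetric group as a Coxeter group

W : ℕ → Set
W n = Permutation′ n

-- S n indexes the simple reflections; the index i stands for s_{i+1}.

S : ℕ → Set
S n = Fin (pred n)

module _ {n : ℕ} where

  infixl 8 _·_
  infix  9 _⁻¹

  _·_ : W n → W n → W n
  w · v = v ∘ₚ w

  ε : W n
  ε = Perm.id

  _⁻¹ : W n → W n
  _⁻¹ = Perm.flip

  _≈?_ : (w v : W n) → Dec (w ≈ v)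
  w ≈? v = Fin.all? (λ x → (w ⟨$⟩ʳ x) Fin.≟ (v ⟨$⟩ʳ x))

simple : ∀ {n} → S n → W n
simple {suc n} i = transpose (inject₁ i) (suc i)

product : ∀ {n} → List (S n) → W n
product = foldr (λ i w → simple i · w) ε

-- The simple reflections are involutions, so the subgroup they generate
-- consists of the products of words.

infix 4 _∈W_

_∈W_ : ∀ {n} → W n → Subset (pred n) → Set
w ∈W I = ∃ λ u → All (_∈ I) u × product u ≈ w

simple-involutive : ∀ {n} (i : S n) → simple {n} i · simple i ≈ ε
simple-involutive {suc n} i x =
  trans (cong (transpose (inject₁ i) (suc i) ⟨$⟩ʳ_) (flip-transpose x))
        (Perm.inverseʳ (transpose (inject₁ i) (suc i)))
  where
  flip-transpose : transpose (inject₁ i) (suc i) ≈ transpose (suc i) (inject₁ i)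
  flip-transpose y with y Fin.≟ inject₁ i in p | y Fin.≟ suc i in q
  ... | yes y≡i | yes y≡i′ = trans (sym y≡i′) y≡i
  ... | yes _   | no _     rewrite p = refl
  ... | no _    | yes _    rewrite q = refl
  ... | no _    | no _     rewrite p | q = refl

product-++ : ∀ {n} (u v : List (S n)) → product {n} (u ++ v) ≈ product u · product v
product-++     []      v x = refl
product-++ {n} (i ∷ u) v x = cong (simple {n} i ⟨$⟩ʳ_) (product-++ u v x)

product-reverse : ∀ {n} (u : List (S n)) → product {n} (reverse u) · product u ≈ ε
product-reverse     []      x = refl
product-reverse {n} (i ∷ u) x rewrite unfold-reverse i u =
  trans (product-++ (reverse u) (i ∷ []) _)
    (trans (cong (product {n} (reverse u) ⟨$⟩ʳ_) (simple-involutive {n} i _))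
           (product-reverse u x))

∈W-resp : ∀ {n} {I : Subset (pred n)} (w v : W n) → w ≈ v → w ∈W I → v ∈W I
∈W-resp w v w≈v (u , u⊆I , eq) = u , u⊆I , λ x → trans (eq x) (w≈v x)

∈W-ε : ∀ {n} {I : Subset (pred n)} → ε {n} ∈W I
∈W-ε = [] , [] , λ _ → refl

∈W-· : ∀ {n} {I : Subset (pred n)} (w v : W n) → w ∈W I → v ∈W I → w · v ∈W I
∈W-· w v (u , u⊆I , p) (u′ , u′⊆I , q) =
  u ++ u′ , All.++⁺ u⊆I u′⊆I ,
  λ x → trans (product-++ u u′ x) (trans (p _) (cong (w ⟨$⟩ʳ_) (q x)))

∈W-⁻¹ : ∀ {n} {I : Subset (pred n)} (w : W n) → w ∈W I → w ⁻¹ ∈W I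
∈W-⁻¹ {n} w (u , u⊆I , p) =
  reverse u , All.tabulate (All.lookup u⊆I ∘ Any.reverse⁻) ,
  λ x → trans (cong (product {n} (reverse u) ⟨$⟩ʳ_)
                (sym (trans (p _) (Perm.inverseʳ w))))
              (product-reverse {n} u _)

-- W_I consists of the permutations preserving the following labelling.

label : ∀ {m} → Subset m → Fin (suc m) → ℕ
label I           zero    = 0
label (true  ∷ I) (suc x) = label I x
label (false ∷ I) (suc x) = suc (label I x)

label-step : ∀ {m} {I : Subset m} {i} → i ∈ I → label I (suc i) ≡ label I (inject₁ i)
label-step {I = true  ∷ I} {zero}  _            = refl
label-step {I = true  ∷ I} {suc i} (Vec.there p) = label-step p
label-step {I = false ∷ I} {suc i} (Vec.there p) = cong suc (label-step p)

simple-label : ∀ {m} {I : Subset m} {i} → i ∈ I →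
               ∀ x → label I (simple {suc m} i ⟨$⟩ʳ x) ≡ label I x
simple-label {i = i} i∈I x with x Fin.≟ inject₁ i
... | yes refl = label-step i∈I
... | no _ with x Fin.≟ suc i
...   | yes refl = sym (label-step i∈I)
...   | no _     = refl

product-label : ∀ {m} {I : Subset m} {u} → All (_∈ I) u →
                ∀ x → label I (product {suc m} u ⟨$⟩ʳ x) ≡ label I x
product-label                 []                        x = refl
product-label {m} {u = _ ∷ u} (i∈I ∷ u⊆I) x =
  trans (simple-label i∈I (product {suc m} u ⟨$⟩ʳ x)) (product-label u⊆I x)

product-lift : ∀ {m} (u : List (Fin m)) →
               product {suc (suc m)} (map suc u) ≈ lift₀ (product {suc m} u)
product-lift     []      zero    = refl
product-lift     []      (suc x) = refl
product-lift {m} (i ∷ u) x =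
  trans (cong (simple {suc (suc m)} (suc i) ⟨$⟩ʳ_) (product-lift u x))
    (trans (Perm.lift₀-transpose (inject₁ i) (suc i) (lift₀ (product {suc m} u) ⟨$⟩ʳ x))
           (Perm.lift₀-comp (product {suc m} u) (simple i) x))

∈W-lift : ∀ {m b} {I : Subset m} (w : W (suc m)) → w ∈W I → lift₀ w ∈W (b ∷ I)
∈W-lift w (u , u⊆I , p) =
  map suc u , All.map⁺ (All.map Vec.there u⊆I) ,
  λ x → trans (product-lift u x) (Perm.lift₀-cong (product u) w p x)

toZero : ∀ {m} (I : Subset m) j → label I j ≡ 0 →
         ∃ λ (w : W (suc m)) → w ∈W I × w ⟨$⟩ʳ j ≡ zero
toZero         I          zero    _  = ε , ∈W-ε , refl
toZero {suc m} (true ∷ I) (suc j) eq with toZero I j eq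
... | w , w∈I , wj≡0 =
  s₁ · lift₀ w ,
  ∈W-· s₁ (lift₀ w) (zero ∷ [] , Vec.here ∷ [] , λ _ → refl) (∈W-lift w w∈I) ,
  cong (λ y → s₁ ⟨$⟩ʳ suc y) wj≡0
  where
  s₁ : W (suc (suc m))
  s₁ = simple zero

label⇒∈W : ∀ {m} (I : Subset m) (w : W (suc m)) →
           (∀ x → label I (w ⟨$⟩ʳ x) ≡ label I x) → w ∈W I
label⇒∈W [] w _ = [] , [] , λ x → unique x (w ⟨$⟩ʳ x)
  where
  unique : (x y : Fin 1) → x ≡ y
  unique zero zero = refl
label⇒∈W {suc m} (b ∷ I) w pres with toZero (b ∷ I) (w ⟨$⟩ʳ zero) (pres zero)
... | u , u∈I@(us , us⊆I , us≈u) , uw0≡0 =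
  ∈W-resp (u ⁻¹ · v) w (λ _ → Perm.inverseˡ u)
    (∈W-· (u ⁻¹) v (∈W-⁻¹ u u∈I)
      (∈W-resp (lift₀ v′) v (Perm.lift₀-remove v uw0≡0)
               (∈W-lift v′ (label⇒∈W I v′ v′-pres))))
  where
  v : W (suc (suc m))
  v = u · w

  v′ : W (suc m)
  v′ = remove zero v

  v-pres : ∀ x → label (b ∷ I) (v ⟨$⟩ʳ x) ≡ label (b ∷ I) x
  v-pres x = trans (cong (label (b ∷ I)) (sym (us≈u (w ⟨$⟩ʳ x))))
                   (trans (product-label us⊆I (w ⟨$⟩ʳ x)) (pres x))

  unlabel : ∀ b x y → label (b ∷ I) (suc x) ≡ label (b ∷ I) (suc y) →
            label I x ≡ label I y
  unlabel true  _ _ eq = eq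
  unlabel false _ _ eq = ℕ.suc-injective eq

  v′-pres : ∀ x → label I (v′ ⟨$⟩ʳ x) ≡ label I x
  v′-pres x = unlabel b (v′ ⟨$⟩ʳ x) x
    (trans (cong (label (b ∷ I)) (Perm.lift₀-remove v uw0≡0 (suc x)))
           (v-pres (suc x)))

_∈W?_ : ∀ {n} (w : W n) (I : Subset (pred n)) → Dec (w ∈W I)
_∈W?_ {zero}  w I = yes ([] , [] , λ ())
_∈W?_ {suc n} w I =
  map′ (label⇒∈W I w)
       (λ (u , u⊆I , eq) x →
          trans (cong (label I) (sym (eq x))) (product-label u⊆I x))
       (Fin.all? (λ x → label I (w ⟨$⟩ʳ x) ℕ.≟ label I x))

label-⊤ : ∀ {m} (x : Fin (suc m)) → label ⊤ x ≡ 0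
label-⊤         zero    = refl
label-⊤ {suc m} (suc x) = label-⊤ x

word : ∀ {n} (w : W n) → ∃ λ u → product u ≈ w
word {zero}  w = [] , λ ()
word {suc n} w
  with u , _ , eq ← label⇒∈W ⊤ w (λ x → trans (label-⊤ (w ⟨$⟩ʳ x)) (sym (label-⊤ x)))
  = u , eq

------------------------------------------------------------------------
-- Length

IsReducedWord : ∀ {n} → W n → List (S n) → Set
IsReducedWord w u = product u ≈ w × (∀ v → product v ≈ w → length u ≤ length v)

HasWord : ∀ {n} → W n → ℕ → Set
HasWord w k = ∃ λ u → length u ≡ k × product u ≈ w

hasWord? : ∀ {n} (w : W n) → Decidable (HasWord w)
hasWord?     w zero =
  map′ (λ eq → [] , refl , eq) (λ { ([] , _ , eq) → eq }) (ε ≈? w)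
hasWord? {n} w (suc k) =
  map′ (λ (i , u , len , eq) → i ∷ u , cong suc len , λ x →
          trans (cong (simple {n} i ⟨$⟩ʳ_) (eq x)) (simple-involutive {n} i _))
       (λ { (i ∷ u , len , eq) → i , u , ℕ.suc-injective len , λ x →
          trans (sym (simple-involutive {n} i _)) (cong (simple {n} i ⟨$⟩ʳ_) (eq x)) })
       (Fin.any? (λ i → hasWord? (simple {n} i · w) k))

least : ∀ {P : ℕ → Set} → Decidable P → ∀ {k} → P k →
        ∃ λ m → P m × (∀ j → P j → m ≤ j)
least P? {k} Pk with P? 0
... | yes P0 = 0 , P0 , λ _ _ → z≤n
least P? {zero}  Pk | no ¬P0 = contradiction Pk ¬P0
least P? {suc k} Pk | no ¬P0 with least (P? ∘ suc) Pk
... | m , Pm , min = suc m , Pm , λ where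
  zero    P0 → contradiction P0 ¬P0
  (suc j) Pj → s≤s (min j Pj)

opaque
  reduced-word : ∀ {n} (w : W n) → ∃ (IsReducedWord w)
  reduced-word w with word w
  ... | u , eq with least (hasWord? w) (u , refl , eq)
  ...   | m , (v , refl , v≈w) , min = v , v≈w , λ v′ v′≈w → min _ (v′ , refl , v′≈w)

reducedWord : ∀ {n} → W n → List (S n)
reducedWord w = proj₁ (reduced-word w)

ℓ : ∀ {n} → W n → ℕ
ℓ w = length (reducedWord w)

------------------------------------------------------------------------
-- Longest elements of finite sets of permutations

ℓ-mono-≈ : ∀ {n} (w v : W n) → w ≈ v → ℓ w ≤ ℓ v
ℓ-mono-≈ w v w≈v =
  proj₂ (proj₂ (reduced-word w)) (reducedWord v)
    (λ x → trans (proj₁ (proj₂ (reduced-word v)) x) (sym (w≈v x)))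

permutations : ∀ n → List (W n)
permutations zero    = ε ∷ []
permutations (suc n) =
  concatMap (λ j → map (insert zero j) (permutations n)) (allFin (suc n))

insert-cong : ∀ {n} (j : Fin (suc n)) (w v : W n) → w ≈ v →
              insert zero j w ≈ insert zero j v
insert-cong j w v w≈v zero    = refl
insert-cong j w v w≈v (suc x) =
  trans (Perm.insert-punchIn zero j w x)
    (trans (cong (punchIn j) (w≈v x))
           (sym (Perm.insert-punchIn zero j v x)))

permutations-complete : ∀ {n} (w : W n) →
                        ∃ λ v → v List.∈ permutations n × v ≈ w
permutations-complete {zero}  w = ε , here refl , λ ()
permutations-complete {suc n} w with permutations-complete (remove zero w)
... | v , v∈ , v≈ =
  insert zero j v ,
  ∈-concatMap⁺ (λ j → map (insert zero j) (permutations n))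
    (Any.map (λ { refl → ∈-map⁺ (insert zero j) v∈ }) (∈-allFin j)) ,
  λ x → trans (insert-cong j v (remove zero w) v≈ x) (Perm.insert-remove zero w x)
  where
  j : Fin (suc n)
  j = w ⟨$⟩ʳ zero

longest-in : ∀ {n} {P : W n → Set} → Decidable P →
             (∀ w v → w ≈ v → P w → P v) → ∃ P →
             ∃ λ m → P m × (∀ z → P z → ℓ z ≤ ℓ m)
longest-in {n} {P} P? resp (w , Pw) =
  m , argmax-all ℓ Pw (All.all-filter P? (permutations n)) , longest
  where
  m : W n
  m = argmax ℓ w (filter P? (permutations n))

  longest : ∀ z → P z → ℓ z ≤ ℓ m
  longest z Pz with permutations-complete z
  ... | v , v∈ , v≈z =
    ℕ.≤-trans (ℓ-mono-≈ z v (λ x → sym (v≈z x)))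
      (All.lookup (f[xs]≤f[argmax] {f = ℓ} w (filter P? (permutations n)))
        (∈-filter⁺ P? v∈ (resp z v (λ x → sym (v≈z x)) Pz)))

IsLongest : ∀ {n} → Subset (pred n) → W n → Set
IsLongest {n} I w = w ∈W I × ((v : W n) → v ∈W I → ℓ v ≤ ℓ w)

opaque
  longest-element : ∀ {n} (I : Subset (pred n)) → ∃ (IsLongest {n} I)
  longest-element I =
    longest-in {P = _∈W I} (_∈W? I) ∈W-resp (ε , ∈W-ε)

-- The longest element w_I of W_I; ℓ(I) is ℓ (w₀ I).

w₀ : ∀ {n} → Subset (pred n) → W n
w₀ I = proj₁ (longest-element I)

------------------------------------------------------------------------
-- Bruhat order

-- Generated by w < t w for t a reflection, that is, a conjugate of a simple
-- reflection, with ℓ w < ℓ (t w).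

infix 4 _≤ᴮ_

data _≤ᴮ_ {n : ℕ} : W n → W n → Set where
  reflexive : ∀ {w v} → w ≈ v → w ≤ᴮ v
  reflect   : ∀ {w z} v i → let t = v · simple i · v ⁻¹ in
              ℓ w < ℓ (t · w) → t · w ≤ᴮ z → w ≤ᴮ z

≤ᴮ⇒ℓ≤ : ∀ {n} {w v : W n} → w ≤ᴮ v → ℓ w ≤ ℓ v
≤ᴮ⇒ℓ≤ (reflexive {w} {v} w≈v) = ℓ-mono-≈ w v w≈v
≤ᴮ⇒ℓ≤ (reflect _ _ lt le)       = ℕ.≤-trans (ℕ.<⇒≤ lt) (≤ᴮ⇒ℓ≤ le)

------------------------------------------------------------------------
-- Double cosets

-- An element of W_I \ W / W_J, given by a representative; equality of
-- cosets is _≈ᶜ_.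

record Coset (n : ℕ) (I J : Subset (pred n)) : Set where
  constructor ⟪_⟫
  field rep : W n

open Coset public

infix 4 _∈ᶜ_ _≈ᶜ_

_∈ᶜ_ : ∀ {n} {I J : Subset (pred n)} → W n → Coset n I J → Set
_∈ᶜ_ {I = I} {J} w p = ∃₂ λ a b → a ∈W I × b ∈W J × w ≈ a · rep p · b

_≈ᶜ_ : ∀ {n} {I J : Subset (pred n)} → Coset n I J → Coset n I J → Set
p ≈ᶜ q = rep p ∈ᶜ q

IsBruhatMaximal : ∀ {n} {I J : Subset (pred n)} → Coset n I J → W n → Set
IsBruhatMaximal {n} p m = m ∈ᶜ p × ((z : W n) → z ∈ᶜ p → m ≤ᴮ z → z ≈ m)

∈ᶜ-resp : ∀ {n} {I J : Subset (pred n)} (p : Coset n I J) w v →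
          w ≈ v → w ∈ᶜ p → v ∈ᶜ p
∈ᶜ-resp p w v w≈v (a , b , a∈ , b∈ , eq) =
  a , b , a∈ , b∈ , λ x → trans (sym (w≈v x)) (eq x)

_∈ᶜ?_ : ∀ {n} {I J : Subset (pred n)} (w : W n) (p : Coset n I J) → Dec (w ∈ᶜ p)
_∈ᶜ?_ {n} {I} {J} w p =
  map′ to from (any? (λ a → (a ∈W? I) ×-dec (rest a ∈W? J)) (permutations n))
  where
  rest : W n → W n
  rest a = (a · rep p) ⁻¹ · w

  to : Any (λ a → a ∈W I × rest a ∈W J) (permutations n) → w ∈ᶜ p
  to found with Any.satisfied found
  ... | a , a∈ , b∈ = a , rest a , a∈ , b∈ , λ _ → sym (Perm.inverseʳ (a · rep p))

  from : w ∈ᶜ p → Any (λ a → a ∈W I × rest a ∈W J) (permutations n)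
  from (a , b , a∈ , b∈ , eq) with permutations-complete a
  ... | a′ , a′∈ , a′≈a = Any.map (λ { refl →
      ∈W-resp a a′ (λ x → sym (a′≈a x)) a∈ , ∈W-resp b (rest a′) b≈rest b∈ }) a′∈
    where
    b≈rest : b ≈ rest a′
    b≈rest x = trans (sym (Perm.inverseˡ (a′ · rep p)))
                     (cong ((a′ · rep p) ⁻¹ ⟨$⟩ʳ_) (trans (a′≈a _) (sym (eq x))))

rep∈ᶜ : ∀ {n} {I J : Subset (pred n)} (p : Coset n I J) → rep p ∈ᶜ p
rep∈ᶜ p = ε , ε , ∈W-ε , ∈W-ε , λ _ → refl

opaque
  bruhat-maximal : ∀ {n} {I J : Subset (pred n)} (p : Coset n I J) →
                   ∃ (IsBruhatMaximal {n} p)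
  bruhat-maximal p with longest-in {P = _∈ᶜ p} (_∈ᶜ? p) (∈ᶜ-resp p) (rep p , rep∈ᶜ p)
  ... | m , m∈p , longest = m , m∈p , maximal
    where
    maximal : ∀ z → z ∈ᶜ p → m ≤ᴮ z → z ≈ m
    maximal z z∈p (reflexive m≈z)     = λ x → sym (m≈z x)
    maximal z z∈p (reflect _ _ lt le) =
      contradiction (longest z z∈p) (ℕ.<⇒≱ (ℕ.<-≤-trans lt (≤ᴮ⇒ℓ≤ le)))

-- The maximal element p̄ of the coset p. It is unique up to _≈_, since the
-- Bruhat order on a double coset has a greatest element.

max : ∀ {n} {I J : Subset (pred n)} → Coset n I J → W n
max p = proj₁ (bruhat-maximal p)

------------------------------------------------------------------------
-- The 0-Hecke product

infixr 8 _⋆ₛ_ _⋆_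

_⋆ₛ_ : ∀ {n} → S n → W n → W n
i ⋆ₛ w = if ℓ w <ᵇ ℓ (simple i · w) then simple i · w else w

-- A reduced expression s₁⋯s_k of w is also an expression s₁ ⋆ ⋯ ⋆ s_k.

_⋆_ : ∀ {n} → W n → W n → W n
w ⋆ v = foldr _⋆ₛ_ v (reducedWord w)

module _ {n : ℕ} {I J K : Subset (pred n)} where

  infixr 8 _⋆ᶜ_

  _⋆ᶜ_ : Coset n I J → Coset n J K → Coset n I K
  p ⋆ᶜ q = ⟪ max p ⋆ max q ⟫

  -- The length condition is ℓ (p̄ ⋆ q̄) = ℓ p̄ − ℓ J + ℓ q̄, stated without
  -- subtraction.

  Reduced : Coset n I J → Coset n J K → Set
  Reduced p q = max p ⋆ max q ≈ max p · w₀ {n} J ⁻¹ · max q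
              × ℓ (max p ⋆ max q) + ℓ (w₀ {n} J) ≡ ℓ (max p) + ℓ (max q)

  reduced? : ∀ p q → Dec (Reduced p q)
  reduced? p q =
    ((max p ⋆ max q) ≈? (max p · w₀ {n} J ⁻¹ · max q)) ×-dec
    (ℓ (max p ⋆ max q) + ℓ (w₀ {n} J) ℕ.≟ ℓ (max p) + ℓ (max q))

------------------------------------------------------------------------
-- ℤ-linear categories

-- ℤ-modules are abelian groups, and ℤ-linear maps are homomorphisms of
-- abelian groups.

record RawLinearCategory : Set₁ where
  infixr 9 _∙_
  field
    Obj : Set
    Hom : Obj → Obj → AbelianGroup 0ℓ 0ℓ

  infix 4 _≋_

  ∣Hom∣ : Obj → Obj → Set
  ∣Hom∣ A B = AbelianGroup.Carrier (Hom A B)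

  _≋_ : ∀ {A B} → ∣Hom∣ A B → ∣Hom∣ A B → Set
  _≋_ {A} {B} = AbelianGroup._≈_ (Hom A B)

  _⊕_ : ∀ {A B} → ∣Hom∣ A B → ∣Hom∣ A B → ∣Hom∣ A B
  _⊕_ {A} {B} = AbelianGroup._∙_ (Hom A B)

  field
    one : ∀ {A} → ∣Hom∣ A A
    _∙_ : ∀ {A B C} → ∣Hom∣ B C → ∣Hom∣ A B → ∣Hom∣ A C

record IsLinearCategory (𝒞 : RawLinearCategory) : Set where
  open RawLinearCategory 𝒞
  field
    ∙-cong    : ∀ {A B C} {f f′ : ∣Hom∣ B C} {g g′ : ∣Hom∣ A B} →
                f ≋ f′ → g ≋ g′ → (f ∙ g) ≋ (f′ ∙ g′)
    assoc     : ∀ {A B C D} (f : ∣Hom∣ C D) (g : ∣Hom∣ B C) (h : ∣Hom∣ A B) →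
                ((f ∙ g) ∙ h) ≋ (f ∙ (g ∙ h))
    identityˡ : ∀ {A B} (f : ∣Hom∣ A B) → (one ∙ f) ≋ f
    identityʳ : ∀ {A B} (f : ∣Hom∣ A B) → (f ∙ one) ≋ f
    distribˡ  : ∀ {A B C} (f : ∣Hom∣ B C) (g h : ∣Hom∣ A B) →
                (f ∙ (g ⊕ h)) ≋ ((f ∙ g) ⊕ (f ∙ h))
    distribʳ  : ∀ {A B C} (f g : ∣Hom∣ B C) (h : ∣Hom∣ A B) →
                ((f ⊕ g) ∙ h) ≋ ((f ∙ h) ⊕ (g ∙ h))

record LinearIsomorphism (𝒞 𝒟 : RawLinearCategory) : Set where
  private
    module C = RawLinearCategory 𝒞
    module D = RawLinearCategory 𝒟
  field
    source-isLinear : IsLinearCategory 𝒞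
    target-isLinear : IsLinearCategory 𝒟
    F₀              : C.Obj → D.Obj
    F₁              : ∀ {A B} → C.∣Hom∣ A B → D.∣Hom∣ (F₀ A) (F₀ B)
    F₀-bijective    : Bijective _≡_ _≡_ F₀
    F₁-isomorphism  : ∀ {A B} → IsGroupIsomorphism
                        (AbelianGroup.rawGroup (C.Hom A B))
                        (AbelianGroup.rawGroup (D.Hom (F₀ A) (F₀ B)))
                        F₁
    F₁-one          : ∀ {A} → F₁ (C.one {A}) D.≋ D.one
    F₁-∙            : ∀ {A B C} (f : C.∣Hom∣ B C) (g : C.∣Hom∣ A B) →
                      F₁ (f C.∙ g) D.≋ (F₁ f D.∙ F₁ g)

------------------------------------------------------------------------
-- Subcategories given by generators

module _ (𝒞 : RawLinearCategory) where
  open RawLinearCategory 𝒞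

  data Generated (G : ∀ {A B} → ∣Hom∣ A B → Set) : ∀ {A B} → ∣Hom∣ A B → Set where
    generator  : ∀ {A B} {f : ∣Hom∣ A B} → G f → Generated G f
    one-closed : ∀ {A} → Generated G (one {A})
    ∙-closed   : ∀ {A B C} {f : ∣Hom∣ B C} {g : ∣Hom∣ A B} →
                 Generated G f → Generated G g → Generated G (f ∙ g)
    0-closed   : ∀ {A B} → Generated G (AbelianGroup.ε (Hom A B))
    ⊕-closed   : ∀ {A B} {f g : ∣Hom∣ A B} →
                 Generated G f → Generated G g → Generated G (f ⊕ g)
    neg-closed : ∀ {A B} {f : ∣Hom∣ A B} →
                 Generated G f → Generated G (AbelianGroup._⁻¹ (Hom A B) f)
    ≋-closed   : ∀ {A B} {f g : ∣Hom∣ A B} → f ≋ g → Generated G f → Generated G g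

  subcategory : (∀ {A B} → ∣Hom∣ A B → Set) → RawLinearCategory
  subcategory G = record
    { Obj = Obj
    ; Hom = SubHom
    ; one = one , one-closed
    ; _∙_ = λ (f , f∈) (g , g∈) → f ∙ g , ∙-closed f∈ g∈
    }
    where
    SubHom : Obj → Obj → AbelianGroup 0ℓ 0ℓ
    SubHom A B = record
      { Carrier = Σ (∣Hom∣ A B) (Generated G)
      ; _≈_     = λ f g → proj₁ f ≋ proj₁ g
      ; _∙_     = λ (f , f∈) (g , g∈) → f ⊕ g , ⊕-closed f∈ g∈
      ; ε       = H.ε , 0-closed
      ; _⁻¹     = λ (f , f∈) → f H.⁻¹ , neg-closed f∈
      ; isAbelianGroup = record
        { isGroup = record
          { isMonoid = record
            { isSemigroup = record
              { isMagma = record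
                { isEquivalence = record { refl = H.refl ; sym = H.sym ; trans = H.trans }
                ; ∙-cong = H.∙-cong }
              ; assoc = λ f g h → H.assoc _ _ _ }
            ; identity = (λ f → H.identityˡ _) , (λ f → H.identityʳ _) }
          ; inverse = (λ f → H.inverseˡ _) , (λ f → H.inverseʳ _)
          ; ⁻¹-cong = H.⁻¹-cong }
        ; comm = λ f g → H.comm _ _ }
      }
      where
      module H = AbelianGroup (Hom A B)

------------------------------------------------------------------------
-- The category of double cosets

module _ {n : ℕ} where

  infixl 6 _⊞_
  infix  8 ⊟_
  infix  4 _≈ᴰ_

  -- The free ℤ-module with basis ∂ p, for p an (I , J)-coset, that is, the
  -- free abelian group on the setoid of (I , J)-cosets.

  data Homᴰ (J I : Subset (pred n)) : Set where
    ∂   : Coset n I J → Homᴰ J I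
    𝟘   : Homᴰ J I
    _⊞_ : Homᴰ J I → Homᴰ J I → Homᴰ J I
    ⊟_  : Homᴰ J I → Homᴰ J I

  data _≈ᴰ_ {J I : Subset (pred n)} : Homᴰ J I → Homᴰ J I → Set where
    ∂-cong    : ∀ {p q} → p ≈ᶜ q → ∂ p ≈ᴰ ∂ q
    ≈-refl    : ∀ {f} → f ≈ᴰ f
    ≈-sym     : ∀ {f g} → f ≈ᴰ g → g ≈ᴰ f
    ≈-trans   : ∀ {f g h} → f ≈ᴰ g → g ≈ᴰ h → f ≈ᴰ h
    ⊞-cong    : ∀ {f f′ g g′} → f ≈ᴰ f′ → g ≈ᴰ g′ → f ⊞ g ≈ᴰ f′ ⊞ g′
    ⊟-cong    : ∀ {f g} → f ≈ᴰ g → ⊟ f ≈ᴰ ⊟ g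
    ⊞-assoc   : ∀ f g h → (f ⊞ g) ⊞ h ≈ᴰ f ⊞ (g ⊞ h)
    ⊞-comm    : ∀ f g → f ⊞ g ≈ᴰ g ⊞ f
    ⊞-identity : ∀ f → 𝟘 ⊞ f ≈ᴰ f
    ⊞-inverse : ∀ f → ⊟ f ⊞ f ≈ᴰ 𝟘

  infixr 9 _∘ᴰ_

  _∘ᴰ_ : ∀ {I J K} → Homᴰ J I → Homᴰ K J → Homᴰ K I
  ∂ p      ∘ᴰ ∂ q     = if does (reduced? p q) then ∂ (p ⋆ᶜ q) else 𝟘
  ∂ p      ∘ᴰ 𝟘       = 𝟘
  ∂ p      ∘ᴰ (g ⊞ h) = (∂ p ∘ᴰ g) ⊞ (∂ p ∘ᴰ h)
  ∂ p      ∘ᴰ (⊟ g)   = ⊟ (∂ p ∘ᴰ g)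
  𝟘        ∘ᴰ h       = 𝟘
  (f ⊞ g)  ∘ᴰ h       = (f ∘ᴰ h) ⊞ (g ∘ᴰ h)
  (⊟ f)    ∘ᴰ h       = ⊟ (f ∘ᴰ h)

𝒟 : ℕ → RawLinearCategory
𝒟 n = record
  { Obj = Subset (pred n)
  ; Hom = λ J I → record
    { Carrier = Homᴰ J I
    ; _≈_ = _≈ᴰ_
    ; _∙_ = _⊞_
    ; ε   = 𝟘
    ; _⁻¹ = ⊟_
    ; isAbelianGroup = record
      { isGroup = record
        { isMonoid = record
          { isSemigroup = record
            { isMagma = record
              { isEquivalence = record { refl = ≈-refl ; sym = ≈-sym ; trans = ≈-trans }
              ; ∙-cong = ⊞-cong }
            ; assoc = ⊞-assoc }
          ; identity = ⊞-identity , λ f → ≈-trans (⊞-comm f 𝟘) (⊞-identity f) }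
        ; inverse = ⊞-inverse , λ f → ≈-trans (⊞-comm f (⊟ f)) (⊞-inverse f)
        ; ⁻¹-cong = ⊟-cong }
      ; comm = ⊞-comm }
    }
  ; one = ∂ {n} ⟪ ε ⟫ -- the coset W_I
  ; _∙_ = _∘ᴰ_
  }

------------------------------------------------------------------------
-- Atomic cosets

module _ {n : ℕ} (J : Subset (pred n)) where

  -- The elements s_{d_1}, …, s_{d_l} of S ∖ J, with d_1 < ⋯ < d_l.

  gaps : List (S n)
  gaps = filter (λ s → ¬? (s ∈? J)) (allFin (pred n))

  module _ (i : Fin (length gaps)) where

    -- M = J ∪ {s} and t = w_M s w_M, where s = s_{d_i}.

    atomicM : Subset (pred n)
    atomicM = J ∪ ⁅ lookup gaps i ⁆

    atomicT : W n
    atomicT = w₀ atomicM · simple (lookup gaps i) · w₀ atomicM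

    -- M ∖ {t}

    atomicTarget : Subset (pred n)
    atomicTarget =
      Vec.tabulate (λ r → Vec.lookup atomicM r ∧ not (does (simple r ≈? atomicT)))

    atomicCoset : Coset n atomicTarget J
    atomicCoset = ⟪ w₀ atomicM ⟫

  -- IsAtomic i p says that p is the atomic coset with source J and
  -- (0-based) index i.

  data IsAtomic : ℕ → ∀ {I} → Coset n I J → Set where
    atomic : ∀ i → IsAtomic (toℕ i) (atomicCoset i)

AtomicGenerator : ∀ {n} {J I : Subset (pred n)} → Homᴰ {n} J I → Set
AtomicGenerator {n} {J} {I} f = ∃₂ λ i (p : Coset n I J) → IsAtomic J i p × f ≡ ∂ p

𝒜𝒟 : ℕ → RawLinearCategory
𝒜𝒟 n = subcategory (𝒟 n) (AtomicGenerator {n})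

------------------------------------------------------------------------
-- The labeled nilCoxeter category

record Composition (n : ℕ) : Set where
  field
    parts    : List ℕ
    positive : All (0 <_) parts
    sum≡n    : sum parts ≡ n

open Composition public

-- SwapAt i xs ys: exchanging the entries of xs at the (0-based) positions
-- i and i + 1 gives ys.

data SwapAt : ℕ → List ℕ → List ℕ → Set where
  here  : ∀ {a b xs} → SwapAt 0 (a ∷ b ∷ xs) (b ∷ a ∷ xs)
  there : ∀ {i a xs ys} → SwapAt i xs ys → SwapAt (suc i) (a ∷ xs) (a ∷ ys)

record Swap {n : ℕ} (i : ℕ) (c d : Composition n) : Set where
  constructor swap
  field swapAt : SwapAt i (parts c) (parts d)

open Swap public

module _ {n : ℕ} where

  infixr 9 _∘ᴸ_
  infix  4 _≈ᴸ_

  -- Morphisms are formal expressions modulo the congruence _≈ᴸ_. The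
  -- superscript of a generator is its source, and its target is
  -- determined by the source and the index.

  data Homᴸ : Composition n → Composition n → Set where
    ∂    : ∀ {c d} i → Swap i c d → Homᴸ c d
    idᴸ  : ∀ {c} → Homᴸ c c
    _∘ᴸ_ : ∀ {b c d} → Homᴸ c d → Homᴸ b c → Homᴸ b d
    𝟘    : ∀ {c d} → Homᴸ c d
    _⊞_  : ∀ {c d} → Homᴸ c d → Homᴸ c d → Homᴸ c d
    ⊟_   : ∀ {c d} → Homᴸ c d → Homᴸ c d

  data _≈ᴸ_ : ∀ {c d} → Homᴸ c d → Homᴸ c d → Set where
    braid : ∀ {i} {c d₁ d₂ e₁ e₂ f : Composition n}
            (σ₁ : Swap i c d₁) (σ₂ : Swap (suc i) d₁ d₂) (σ₃ : Swap i d₂ f)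
            (τ₁ : Swap (suc i) c e₁) (τ₂ : Swap i e₁ e₂) (τ₃ : Swap (suc i) e₂ f) →
            ∂ i σ₃ ∘ᴸ ∂ (suc i) σ₂ ∘ᴸ ∂ i σ₁ ≈ᴸ
            ∂ (suc i) τ₃ ∘ᴸ ∂ i τ₂ ∘ᴸ ∂ (suc i) τ₁
    distant : ∀ {i j} {c d e f : Composition n} → 1 < ∣ i - j ∣ →
            (σ₁ : Swap j c d) (σ₂ : Swap i d f) (τ₁ : Swap i c e) (τ₂ : Swap j e f) →
            ∂ i σ₂ ∘ᴸ ∂ j σ₁ ≈ᴸ ∂ j τ₂ ∘ᴸ ∂ i τ₁
    square : ∀ {i} {c d : Composition n} (σ : Swap i c d) (τ : Swap i d c) → ∂ i τ ∘ᴸ ∂ i σ ≈ᴸ 𝟘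

    ≈-refl    : ∀ {c d} {f : Homᴸ c d} → f ≈ᴸ f
    ≈-sym     : ∀ {c d} {f g : Homᴸ c d} → f ≈ᴸ g → g ≈ᴸ f
    ≈-trans   : ∀ {c d} {f g h : Homᴸ c d} → f ≈ᴸ g → g ≈ᴸ h → f ≈ᴸ h

    ⊞-cong    : ∀ {c d} {f f′ g g′ : Homᴸ c d} → f ≈ᴸ f′ → g ≈ᴸ g′ → f ⊞ g ≈ᴸ f′ ⊞ g′
    ⊟-cong    : ∀ {c d} {f g : Homᴸ c d} → f ≈ᴸ g → ⊟ f ≈ᴸ ⊟ g
    ⊞-assoc   : ∀ {c d} (f g h : Homᴸ c d) → (f ⊞ g) ⊞ h ≈ᴸ f ⊞ (g ⊞ h)
    ⊞-comm    : ∀ {c d} (f g : Homᴸ c d) → f ⊞ g ≈ᴸ g ⊞ f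
    ⊞-identity : ∀ {c d} (f : Homᴸ c d) → 𝟘 ⊞ f ≈ᴸ f
    ⊞-inverse : ∀ {c d} (f : Homᴸ c d) → ⊟ f ⊞ f ≈ᴸ 𝟘

    ∘-cong    : ∀ {b c d} {f f′ : Homᴸ c d} {g g′ : Homᴸ b c} →
                f ≈ᴸ f′ → g ≈ᴸ g′ → f ∘ᴸ g ≈ᴸ f′ ∘ᴸ g′
    ∘-assoc   : ∀ {a b c d} (f : Homᴸ c d) (g : Homᴸ b c) (h : Homᴸ a b) →
                (f ∘ᴸ g) ∘ᴸ h ≈ᴸ f ∘ᴸ (g ∘ᴸ h)
    ∘-identityˡ : ∀ {c d} (f : Homᴸ c d) → idᴸ ∘ᴸ f ≈ᴸ f
    ∘-identityʳ : ∀ {c d} (f : Homᴸ c d) → f ∘ᴸ idᴸ ≈ᴸ f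
    ∘-distribˡ : ∀ {b c d} (f : Homᴸ c d) (g h : Homᴸ b c) →
                f ∘ᴸ (g ⊞ h) ≈ᴸ (f ∘ᴸ g) ⊞ (f ∘ᴸ h)
    ∘-distribʳ : ∀ {b c d} (f g : Homᴸ c d) (h : Homᴸ b c) →
                (f ⊞ g) ∘ᴸ h ≈ᴸ (f ∘ᴸ h) ⊞ (g ∘ᴸ h)

LNC : ℕ → RawLinearCategory
LNC n = record
  { Obj = Composition n
  ; Hom = λ c d → record
    { Carrier = Homᴸ c d
    ; _≈_ = _≈ᴸ_
    ; _∙_ = _⊞_
    ; ε   = 𝟘
    ; _⁻¹ = ⊟_
    ; isAbelianGroup = record
      { isGroup = record
        { isMonoid = record
          { isSemigroup = record
            { isMagma = record
              { isEquivalence = record { refl = ≈-refl ; sym = ≈-sym ; trans = ≈-trans }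
              ; ∙-cong = ⊞-cong }
            ; assoc = ⊞-assoc }
          ; identity = ⊞-identity , λ f → ≈-trans (⊞-comm f 𝟘) (⊞-identity f) }
        ; inverse = ⊞-inverse , λ f → ≈-trans (⊞-comm f (⊟ f)) (⊞-inverse f)
        ; ⁻¹-cong = ⊟-cong }
      ; comm = ⊞-comm }
    }
  ; one = idᴸ
  ; _∙_ = _∘ᴸ_
  }

-- blockOf (n₁ ∷ ⋯ ∷ n_k) x is the (0-based) index of the block containing x
-- when {0, …, n - 1} is cut into consecutive blocks of sizes n₁, …, n_k.

blockOf : List ℕ → ℕ → ℕ
blockOf []       x = 0
blockOf (m ∷ ms) x = if x <ᵇ m then 0 else suc (blockOf ms (x ∸ m))

-- The subgroup 𝒮_{n₁} × ⋯ × 𝒮_{n_k} of 𝒮_n.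

_∈Young_ : ∀ {n} → W n → Composition n → Set
w ∈Young c = ∀ x → blockOf (parts c) (toℕ (w ⟨$⟩ʳ x)) ≡ blockOf (parts c) (toℕ x)

-- c corresponds to J if W_J = 𝒮_{n₁} × ⋯ × 𝒮_{n_k}.

_↔ˢ_ : ∀ {n} → Composition n → Subset (pred n) → Set
c ↔ˢ J = ∀ w → w ∈W J ⇔ w ∈Young c

{-# OPTIONS --safe #-}
-- For 𝒟, the exchange condition shows that ℓ (w v) = ℓ w + ℓ v exactly when
-- no pair is inverted by v and restored by w, and that a double coset has a
-- unique element with full descent sets. Hence p ⋆ q is reduced exactly when
-- ℓ (p̄ w_J⁻¹ q̄) = ℓ p̄ - ℓ J + ℓ q̄, and then p̄ w_J⁻¹ q̄ is its maximal element, so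
-- that associativity reduces to subadditivity of ℓ.
--
-- The atomic coset a_i is the coset of the permutation exchanging blocks i
-- and i + 1. If b permutes the blocks by σ, the composite of ∂ a_i with the
-- basis element of b is the basis element of the product when
-- σ⁻¹ i < σ⁻¹ (i + 1), and vanishes otherwise; this gives the nilCoxeter
-- relations. Conversely, in LNC every path reduces to 0 or to a normal form
-- (insert the blocks one after another), and distinct normal forms permute
-- the blocks differently, so they go to distinct basis elements. Sending each
-- of these basis elements to its normal form, and the others to 0, defines a
-- left inverse of ψ.
module Submission where

open import Defs
import Algebra.Properties.AbelianGroup as AbelianGroupProperties
open import Data.Bool.Base using (true; false; if_then_else_; T; _∧_; not)
open import Data.Empty using (⊥; ⊥-elim)
open import Data.Fin.Base using (Fin; zero; suc; inject₁; toℕ; fromℕ<) renaming (_<_ to _≺_)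
open import Data.Fin.Permutation as Perm using (_⟨$⟩ʳ_; _⟨$⟩ˡ_; _≈_; transpose)
import Data.Fin.Properties as Fin
open import Data.Fin.Subset using (Subset; _∈_; _∉_; ⁅_⁆; _⊆_)
open import Data.Fin.Subset.Properties
  using (_∈?_; ⊆-antisym; x∈p∪q⁻; p⊆p∪q; q⊆p∪q; x∈⁅x⁆; x∈⁅y⁆⇒x≡y)
open import Data.List.Base
  using (List; []; _∷_; length; foldr; reverse; _++_; filter; map; allFin; lookup)
open import Data.List.Membership.Propositional.Properties
  using (∈-filter⁺; ∈-filter⁻; ∈-allFin; ∈-lookup)
import Data.List.Properties as List
open import Data.List.Relation.Unary.All as All using (All; []; _∷_)
open import Data.List.Relation.Unary.Any as Any using (Any; here; there)
open import Data.List.Relation.Unary.Any.Properties using (lookup-index)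
open import Data.Nat.Base
  using (ℕ; zero; suc; pred; _+_; _∸_; _≤_; _<_; _<ᵇ_; ∣_-_∣; z≤n; s≤s)
open import Data.Nat.ListAction using (sum)
import Data.Nat.Properties as ℕ
open import Data.Nat.Solver using (module +-*-Solver)
open import Data.Product.Base using (∃; ∃₂; Σ-syntax; _×_; _,_; proj₁; proj₂)
open import Data.Sum.Base using (_⊎_; inj₁; inj₂)
open import Data.Unit.Base using (tt)
import Data.Vec.Base as Vec
open import Data.Vec.Base using ([]; _∷_)
import Data.Vec.Properties as Vec
open import Function.Base using (_∘_)
open import Function.Bundles using (mk⇔)
open import Function.Definitions using (Bijective)
open import Relation.Binary.Definitions using (tri<; tri≈; tri>)
open import Relation.Binary.PropositionalEquality
  using (_≡_; _≢_; refl; sym; trans; cong; cong₂; subst; subst₂)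
open import Relation.Nullary using (¬_; Dec; yes; no; contradiction; ¬?; does)
open import Relation.Nullary.Decidable using (dec-true; dec-false)

-- Length and inversions

-- Length is available only as a minimum over words, so all its properties are drawn from
-- `exchange`. Since simple reflections multiply on the left, ascents and descents are read off the
-- positions `w ⟨$⟩ˡ lo i` and `w ⟨$⟩ˡ hi i`. Parabolic subgroups enter through the labelling of
-- points by blocks. Descent conditions then become monotonicity on blocks, and the uniqueness
-- statements rest on one fact: two sorted sequences that are rearrangements of each other within
-- the blocks agree (`sorted`). The subcategory has no presentation of its own. A bound from above
-- on LNC (normal forms span) is therefore matched with a bound from below in 𝒟, where the Hom
-- groups are free. Two obstacles shape the later parts. Insertion of a block changes n, so paths
-- and normal forms live on bare lists of parts, and validity is restored only on interpretation.
-- The target M ∖ {t} of an atomic coset equals the subset of the exchanged composition only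
-- propositionally, so cosets and morphisms have to be transported along that equality.

lo hi : ∀ {n} → S n → Fin n
lo {suc n} i = inject₁ i
hi {suc n} i = suc i

toℕ-hi : ∀ {n} (i : S n) → toℕ (hi {n} i) ≡ suc (toℕ (lo {n} i))
toℕ-hi {suc n} i = cong suc (sym (Fin.toℕ-inject₁ i))

lo≺hi : ∀ {n} (i : S n) → lo {n} i ≺ hi {n} i
lo≺hi {n} i = ℕ.≤-reflexive (sym (toℕ-hi {n} i))

adjacent : ∀ {n} {x y : Fin n} → toℕ y ≡ suc (toℕ x) → ∃ λ i → lo {n} i ≡ x × hi {n} i ≡ y
adjacent {suc n} {x} {suc y} eq =
  y , Fin.toℕ-injective (trans (Fin.toℕ-inject₁ y) (ℕ.suc-injective eq)) , refl

injective : ∀ {n} (w : W n) {x y} → w ⟨$⟩ʳ x ≡ w ⟨$⟩ʳ y → x ≡ y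
injective w eq = trans (sym (Perm.inverseˡ w)) (trans (cong (w ⟨$⟩ˡ_) eq) (Perm.inverseˡ w))

from-≡ : ∀ {n} (w : W n) {x y} → w ⟨$⟩ʳ x ≡ y → w ⟨$⟩ˡ y ≡ x
from-≡ w eq = trans (cong (w ⟨$⟩ˡ_) (sym eq)) (Perm.inverseˡ w)

⁻¹-cong : ∀ {n} (w v : W n) → w ≈ v → w ⁻¹ ≈ v ⁻¹
⁻¹-cong w v w≈v x = from-≡ w (trans (w≈v _) (Perm.inverseʳ v))

transpose-left : ∀ {n} (x y : Fin n) → transpose x y ⟨$⟩ʳ x ≡ y
transpose-left x y with x Fin.≟ x
... | yes _   = refl
... | no x≢x = contradiction refl x≢x

transpose-right : ∀ {n} (x y : Fin n) → transpose x y ⟨$⟩ʳ y ≡ x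
transpose-right x y with y Fin.≟ x
... | yes y≡x = y≡x
... | no _ with y Fin.≟ y
...   | yes _   = refl
...   | no y≢y = contradiction refl y≢y

transpose-other : ∀ {n} (x y : Fin n) {z} → z ≢ x → z ≢ y → transpose x y ⟨$⟩ʳ z ≡ z
transpose-other x y {z} z≢x z≢y with z Fin.≟ x
... | yes z≡x = contradiction z≡x z≢x
... | no _ with z Fin.≟ y
...   | yes z≡y = contradiction z≡y z≢y
...   | no _    = refl

data Position {n} (x y : Fin n) : Fin n → Set where
  at-left  : Position x y x
  at-right : Position x y y
  elsewhere : ∀ {z} → z ≢ x → z ≢ y → Position x y z

position : ∀ {n} (x y z : Fin n) → Position x y z
position x y z with z Fin.≟ x
... | yes refl = at-left
... | no z≢x with z Fin.≟ y
...   | yes refl = at-right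
...   | no z≢y   = elsewhere z≢x z≢y

transpose-comm : ∀ {n} (x y : Fin n) → transpose x y ≈ transpose y x
transpose-comm x y z with position x y z
... | at-left  = trans (transpose-left x y) (sym (transpose-right y x))
... | at-right = trans (transpose-right x y) (sym (transpose-left y x))
... | elsewhere z≢x z≢y = trans (transpose-other x y z≢x z≢y) (sym (transpose-other y x z≢y z≢x))

transpose-involutive : ∀ {n} (x y : Fin n) → transpose x y · transpose x y ≈ ε
transpose-involutive x y z = 
  trans (transpose-comm x y (transpose x y ⟨$⟩ʳ z)) (Perm.inverseʳ (transpose y x) {z})

·-transpose : ∀ {n} (w : W n) x y →
              w · transpose x y ≈ transpose (w ⟨$⟩ʳ x) (w ⟨$⟩ʳ y) · w
·-transpose w x y z with position x y z
... | at-left  = trans (cong (w ⟨$⟩ʳ_) (transpose-left x y)) (sym (transpose-left (w ⟨$⟩ʳ x) (w ⟨$⟩ʳ y)))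
... | at-right = trans (cong (w ⟨$⟩ʳ_) (transpose-right x y)) (sym (transpose-right (w ⟨$⟩ʳ x) (w ⟨$⟩ʳ y)))
... | elsewhere z≢x z≢y = trans (cong (w ⟨$⟩ʳ_) (transpose-other x y z≢x z≢y))
  (sym (transpose-other (w ⟨$⟩ʳ x) (w ⟨$⟩ʳ y) (z≢x ∘ injective w) (z≢y ∘ injective w)))

simple-transpose : ∀ {n} (i : S n) → simple {n} i ≈ transpose (lo i) (hi i)
simple-transpose {suc n} i x = refl

simple-lo : ∀ {n} (i : S n) → simple {n} i ⟨$⟩ʳ lo i ≡ hi i
simple-lo {suc n} i = transpose-left (inject₁ i) (suc i)

simple-hi : ∀ {n} (i : S n) → simple {n} i ⟨$⟩ʳ hi i ≡ lo i
simple-hi {suc n} i = transpose-right (inject₁ i) (suc i)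

simple-other : ∀ {n} (i : S n) {x} → x ≢ lo i → x ≢ hi i → simple {n} i ⟨$⟩ʳ x ≡ x
simple-other {suc n} i = transpose-other (inject₁ i) (suc i)

-- `lo i` and `hi i` are neighbours, so every third point lies on the same side of both, and
-- exchanging them can only affect their own comparison.
simple-mono : ∀ {n} (i : S n) {x y} → x ≺ y →
              (x ≡ lo i × y ≡ hi i) ⊎ simple {n} i ⟨$⟩ʳ x ≺ simple {n} i ⟨$⟩ʳ y
simple-mono {n} i {x} {y} x≺y with x Fin.≟ lo i | x Fin.≟ hi i | y Fin.≟ lo i | y Fin.≟ hi i
... | yes p    | _        | _        | yes q    = inj₁ (p , q)
... | yes refl | _        | yes refl | no _     = contradiction x≺y (Fin.<-irrefl {n} refl)
... | yes refl | _        | no q     | no r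
  rewrite simple-lo {n} i | simple-other {n} i q r | toℕ-hi {n} i =
  inj₂ (ℕ.≤∧≢⇒< x≺y (λ eq → r (Fin.toℕ-injective (trans (sym eq) (sym (toℕ-hi {n} i))))))
... | no _     | yes refl | yes refl | _        = contradiction (lo≺hi {n} i) (Fin.<-asym {n} x≺y)
... | no _     | yes refl | no _     | yes refl = contradiction x≺y (Fin.<-irrefl {n} refl)
... | no _     | yes refl | no q     | no r
  rewrite simple-hi {n} i | simple-other {n} i q r = inj₂ (Fin.<-trans {n} (lo≺hi {n} i) x≺y)
... | no p     | no q     | yes refl | _
  rewrite simple-lo {n} i | simple-other {n} i p q = inj₂ (Fin.<-trans {n} x≺y (lo≺hi {n} i))
... | no p     | no q     | no _     | yes refl
  rewrite simple-hi {n} i | simple-other {n} i p q = inj₂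
    (ℕ.≤∧≢⇒< (ℕ.≤-pred (subst (suc (toℕ x) ≤_) (toℕ-hi {n} i) x≺y)) (p ∘ Fin.toℕ-injective))
... | no p     | no q     | no r     | no s
  rewrite simple-other {n} i p q | simple-other {n} i r s = inj₂ x≺y

≺-by-contradiction : ∀ {n} {x y : Fin n} → x ≢ y → ¬ (y ≺ x) → x ≺ y
≺-by-contradiction {x = x} {y} x≢y y⊀x with Fin.<-cmp x y
... | tri< x≺y _ _ = x≺y
... | tri≈ _ x≡y _ = contradiction x≡y x≢y
... | tri> _ _ y≺x = contradiction y≺x y⊀x

-- The tail of a word acts before its head. The letter to delete is one that turns the images of `x`
-- and `y` out of order: by `simple-mono` it exchanges exactly these two images, so omitting it
-- amounts to exchanging `x` and `y` beforehand. The result is a subword, hence stays in every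
-- parabolic subgroup; `sorted` relies on this.
exchange : ∀ {n} (u : List (S n)) {x y} → x ≺ y → product {n} u ⟨$⟩ʳ y ≺ product {n} u ⟨$⟩ʳ x →
           ∃ λ u′ → suc (length u′) ≡ length u
                  × product {n} u′ ≈ product u · transpose x y
                  × (∀ {I : Subset (pred n)} → All (_∈ I) u → All (_∈ I) u′)
exchange {n} [] x≺y y≺x = contradiction y≺x (Fin.<-asym {n} x≺y)
exchange {n} (i ∷ u) {x} {y} x≺y inv with Fin.<-cmp (product {n} u ⟨$⟩ʳ x) (product {n} u ⟨$⟩ʳ y)
... | tri≈ _ eq _ = contradiction x≺y (Fin.<-irrefl {n} (injective (product {n} u) eq))
... | tri> _ _ inv′ with exchange u x≺y inv′
...   | u′ , len , eq , sub =
  i ∷ u′ , cong suc len , (λ z → cong (simple {n} i ⟨$⟩ʳ_) (eq z)) , λ { (i∈ ∷ u∈) → i∈ ∷ sub u∈ }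
exchange {n} (i ∷ u) {x} {y} x≺y inv | tri< a≺b _ _ with simple-mono i a≺b
... | inj₂ lt = contradiction inv (Fin.<-asym {n} lt)
... | inj₁ (ux≡lo , uy≡hi) = u , refl , (λ z → sym (deleted z)) , λ { (_ ∷ u∈) → u∈ }
  where
  deleted : simple i · product u · transpose x y ≈ product {n} u
  deleted z with position x y z
  ... | at-left  = trans (cong (product {n} (i ∷ u) ⟨$⟩ʳ_) (transpose-left x y))
                  (trans (cong (simple {n} i ⟨$⟩ʳ_) uy≡hi) (trans (simple-hi {n} i) (sym ux≡lo)))
  ... | at-right = trans (cong (product {n} (i ∷ u) ⟨$⟩ʳ_) (transpose-right x y))
                  (trans (cong (simple {n} i ⟨$⟩ʳ_) ux≡lo) (trans (simple-lo {n} i) (sym uy≡hi)))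
  ... | elsewhere z≢x z≢y = trans (cong (product {n} (i ∷ u) ⟨$⟩ʳ_) (transpose-other x y z≢x z≢y))
                  (simple-other {n} i
                    (λ eq → z≢x (injective (product {n} u) (trans eq (sym ux≡lo))))
                    (λ eq → z≢y (injective (product {n} u) (trans eq (sym uy≡hi)))))

reducedWord-product : ∀ {n} (w : W n) → product (reducedWord w) ≈ w
reducedWord-product w = proj₁ (proj₂ (reduced-word w))

ℓ≤length : ∀ {n} (w : W n) u → product u ≈ w → ℓ w ≤ length u
ℓ≤length w = proj₂ (proj₂ (reduced-word w))

ℓ-cong : ∀ {n} (w v : W n) → w ≈ v → ℓ w ≡ ℓ v
ℓ-cong w v w≈v = ℕ.≤-antisym (ℓ-mono-≈ w v w≈v) (ℓ-mono-≈ v w (λ x → sym (w≈v x)))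

ℓ-· : ∀ {n} (w v : W n) → ℓ (w · v) ≤ ℓ w + ℓ v
ℓ-· {n} w v = subst (ℓ (w · v) ≤_) (List.length-++ (reducedWord w) {reducedWord v})
  (ℓ≤length (w · v) (reducedWord w ++ reducedWord v) λ x →
  trans (product-++ (reducedWord w) (reducedWord v) x)
    (trans (reducedWord-product w _) (cong (w ⟨$⟩ʳ_) (reducedWord-product v x))))

product-reverse-⁻¹ : ∀ {n} (u : List (S n)) → product {n} (reverse u) ≈ product u ⁻¹
product-reverse-⁻¹ {n} u x =
  trans (cong (product {n} (reverse u) ⟨$⟩ʳ_) (sym (Perm.inverseʳ (product {n} u))))
        (product-reverse u _)

ℓ-⁻¹ : ∀ {n} (w : W n) → ℓ (w ⁻¹) ≡ ℓ w
ℓ-⁻¹ {n} w = ℕ.≤-antisym (bound w)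
  (subst (_≤ ℓ (w ⁻¹)) (ℓ-cong (w ⁻¹ ⁻¹) w (λ _ → refl)) (bound (w ⁻¹)))
  where
  bound : ∀ (w : W n) → ℓ (w ⁻¹) ≤ ℓ w
  bound w = subst (ℓ (w ⁻¹) ≤_) (List.length-reverse (reducedWord w))
    (ℓ≤length (w ⁻¹) (reverse (reducedWord w)) λ x →
      trans (product-reverse-⁻¹ (reducedWord w) x)
            (⁻¹-cong (product (reducedWord w)) w (reducedWord-product w) x))

ℓ-transpose-< : ∀ {n} (w : W n) {x y} → x ≺ y → w ⟨$⟩ʳ y ≺ w ⟨$⟩ʳ x → ℓ (w · transpose x y) < ℓ w
ℓ-transpose-< w {x} {y} x≺y inv
  with u , len , eq , _ ← exchange (reducedWord w) x≺y
         (subst₂ _≺_ (sym (reducedWord-product w y)) (sym (reducedWord-product w x)) inv)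
  = ℕ.≤-trans (s≤s (ℓ≤length (w · transpose x y) u λ z → trans (eq z) (reducedWord-product w _)))
              (ℕ.≤-reflexive len)

module _ {n : ℕ} (i : S n) (w : W n) where

  simple-· : simple i · w ≈ w · transpose (w ⟨$⟩ˡ lo i) (w ⟨$⟩ˡ hi i)
  simple-· x = trans (simple-transpose i _) (sym (trans (·-transpose w _ _ x)
    (cong₂ (λ a b → transpose a b ⟨$⟩ʳ (w ⟨$⟩ʳ x)) (Perm.inverseʳ w) (Perm.inverseʳ w))))

  simple-⁻¹-lo : (simple i · w) ⟨$⟩ˡ lo i ≡ w ⟨$⟩ˡ hi i
  simple-⁻¹-lo = from-≡ (simple i · w)
    (trans (cong (simple i ⟨$⟩ʳ_) (Perm.inverseʳ w)) (simple-hi {n} i))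

  simple-⁻¹-hi : (simple i · w) ⟨$⟩ˡ hi i ≡ w ⟨$⟩ˡ lo i
  simple-⁻¹-hi = from-≡ (simple i · w)
    (trans (cong (simple i ⟨$⟩ʳ_) (Perm.inverseʳ w)) (simple-lo {n} i))

  simple-cancel : simple i · (simple i · w) ≈ w
  simple-cancel x = simple-involutive {n} i _

  ℓ-simple-≤ : ℓ (simple i · w) ≤ suc (ℓ w)
  ℓ-simple-≤ = ℓ≤length (simple i · w) (i ∷ reducedWord w)
    (λ x → cong (simple i ⟨$⟩ʳ_) (reducedWord-product w x))

ascent⊎descent : ∀ {n} (i : S n) (w : W n) →
                 w ⟨$⟩ˡ lo i ≺ w ⟨$⟩ˡ hi i ⊎ w ⟨$⟩ˡ hi i ≺ w ⟨$⟩ˡ lo i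
ascent⊎descent {n} i w with Fin.<-cmp (w ⟨$⟩ˡ lo i) (w ⟨$⟩ˡ hi i)
... | tri< lt _ _ = inj₁ lt
... | tri> _ _ gt = inj₂ gt
... | tri≈ _ eq _ = contradiction (lo≺hi {n} i) (Fin.<-irrefl {n} (injective (w ⁻¹) eq))

ℓ-descent : ∀ {n} (i : S n) (w : W n) → w ⟨$⟩ˡ hi i ≺ w ⟨$⟩ˡ lo i → suc (ℓ (simple i · w)) ≡ ℓ w
ℓ-descent {n} i w gt = ℕ.≤-antisym shorter
  (subst (_≤ suc (ℓ (simple i · w)))
    (ℓ-cong (simple i · (simple i · w)) w (simple-cancel i w)) (ℓ-simple-≤ i (simple i · w)))
  where
  t≈ : simple i · w ≈ w · transpose (w ⟨$⟩ˡ hi i) (w ⟨$⟩ˡ lo i)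
  t≈ x = trans (simple-· i w x) (cong (w ⟨$⟩ʳ_) (transpose-comm (w ⟨$⟩ˡ lo i) (w ⟨$⟩ˡ hi i) x))

  shorter : ℓ (simple i · w) < ℓ w
  shorter = subst (_< ℓ w) (sym (ℓ-cong (simple i · w) (w · transpose (w ⟨$⟩ˡ hi i) (w ⟨$⟩ˡ lo i)) t≈))
    (ℓ-transpose-< w gt (subst₂ _≺_ (sym (Perm.inverseʳ w)) (sym (Perm.inverseʳ w)) (lo≺hi {n} i)))

ℓ-ascent : ∀ {n} (i : S n) (w : W n) → w ⟨$⟩ˡ lo i ≺ w ⟨$⟩ˡ hi i → ℓ (simple i · w) ≡ suc (ℓ w)
ℓ-ascent {n} i w lt = trans
  (sym (ℓ-descent i (simple i · w)
    (subst₂ _≺_ (sym (simple-⁻¹-hi i w)) (sym (simple-⁻¹-lo i w)) lt)))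
  (cong suc (ℓ-cong (simple i · (simple i · w)) w (simple-cancel i w)))

NoCancellation : ∀ {n} → W n → W n → Set
NoCancellation w v = ∀ {x y} → x ≺ y → v ⟨$⟩ʳ y ≺ v ⟨$⟩ʳ x →
                     w ⟨$⟩ʳ (v ⟨$⟩ʳ y) ≺ w ⟨$⟩ʳ (v ⟨$⟩ʳ x)

ℓ≡0⇒≈ε : ∀ {n} (w : W n) → ℓ w ≡ 0 → w ≈ ε
ℓ≡0⇒≈ε {n} w len = from-word (reducedWord w) (reducedWord-product w) len
  where
  from-word : ∀ (u : List (S n)) → product u ≈ w → length u ≡ 0 → w ≈ ε
  from-word [] eq _ x = sym (eq x)

descent : ∀ {n} (w : W n) {k} → ℓ w ≡ suc k → ∃ λ (i : S n) → w ⟨$⟩ˡ hi i ≺ w ⟨$⟩ˡ lo i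
descent {n} w {k} len = from-word (reducedWord w) (reducedWord-product w) len
  where
  from-word : ∀ (u : List (S n)) → product u ≈ w → length u ≡ suc k →
              ∃ λ (i : S n) → w ⟨$⟩ˡ hi i ≺ w ⟨$⟩ˡ lo i
  from-word (i ∷ u) eq len′ with ascent⊎descent i w
  ... | inj₂ desc = i , desc
  ... | inj₁ asc  = contradiction (ℕ.≤-trans (ℕ.≤-reflexive (sym (ℓ-ascent i w asc)))
    (ℓ≤length (simple i · w) u λ x →
      trans (sym (simple-involutive {n} i _)) (cong (simple {n} i ⟨$⟩ʳ_) (eq x))))
    (ℕ.<⇒≱ (s≤s (ℕ.≤-trans (ℕ.n≤1+n _) (ℕ.≤-reflexive (trans len′ (sym len))))))

private
  -- A left descent `i` of `w` is split off. The only pair that `simple i` could restore has images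
  -- `lo i` and `hi i` under `w`, and the descent rules it out, so the hypothesis passes to
  -- `simple i · w`. A descent of `simple i · w · v` at `i` would be a pair inverted by `v` and
  -- restored by `w`.
  ℓ-additive′ : ∀ {n} (k : ℕ) (w v : W n) → ℓ w ≡ k → NoCancellation w v → ℓ (w · v) ≡ k + ℓ v
  ℓ-additive′ zero w v len nc = ℓ-cong (w · v) v (λ x → ℓ≡0⇒≈ε w len _)
  ℓ-additive′ {n} (suc k) w v len nc with descent w len
  ... | i , desc =
    trans (ℓ-cong (w · v) (simple i · (w′ · v)) (λ x → sym (simple-cancel i w _)))
      (trans (ℓ-ascent i (w′ · v) (≺-by-contradiction
                (λ eq → contradiction (lo≺hi {n} i) (Fin.<-irrefl {n} (injective ((w′ · v) ⁻¹) eq))) asc))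
             (cong suc (ℓ-additive′ k w′ v (ℕ.suc-injective (trans (ℓ-descent i w desc) len)) nc′)))
    where
    w′ : W n
    w′ = simple i · w
    nc′ : NoCancellation w′ v
    nc′ {x} {y} x≺y inv with simple-mono i (nc x≺y inv)
    ... | inj₂ lt = lt
    ... | inj₁ (wy≡lo , wx≡hi) = contradiction desc (Fin.<-asym {n}
            (subst₂ _≺_ (sym (from-≡ w wy≡lo)) (sym (from-≡ w wx≡hi)) inv))
    asc : ¬ (((w′ · v) ⟨$⟩ˡ hi i) ≺ ((w′ · v) ⟨$⟩ˡ lo i))
    asc gt = contradiction (lo≺hi {n} i) (Fin.<-asym {n}
      (subst₂ _≺_ (trans (cong (w ⟨$⟩ʳ_) v-lo) (trans (cong (w ⟨$⟩ʳ_) (simple-⁻¹-lo i w)) (Perm.inverseʳ w)))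
                  (trans (cong (w ⟨$⟩ʳ_) v-hi) (trans (cong (w ⟨$⟩ʳ_) (simple-⁻¹-hi i w)) (Perm.inverseʳ w)))
        (nc gt (subst₂ _≺_ (sym (trans v-lo (simple-⁻¹-lo i w))) (sym (trans v-hi (simple-⁻¹-hi i w))) desc))))
      where
      v-lo : v ⟨$⟩ʳ ((w′ · v) ⟨$⟩ˡ lo i) ≡ w′ ⟨$⟩ˡ lo i
      v-lo = Perm.inverseʳ v
      v-hi : v ⟨$⟩ʳ ((w′ · v) ⟨$⟩ˡ hi i) ≡ w′ ⟨$⟩ˡ hi i
      v-hi = Perm.inverseʳ v

ℓ-additive : ∀ {n} (w v : W n) → NoCancellation w v → ℓ (w · v) ≡ ℓ w + ℓ v
ℓ-additive w v nc = ℓ-additive′ (ℓ w) w v refl nc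

-- If `v` inverts a pair and `w` restores it, inserting the corresponding transposition twice
-- between the factors leaves the product unchanged and shortens both of them.
ℓ-additive⁻¹ : ∀ {n} (w v : W n) → ℓ (w · v) ≡ ℓ w + ℓ v → NoCancellation w v
ℓ-additive⁻¹ {n} w v add {x} {y} x≺y inv = ≺-by-contradiction
  (λ eq → contradiction x≺y (Fin.<-irrefl {n} (sym (injective v (injective w eq))))) λ lt →
  contradiction add (ℕ.<⇒≢ (ℕ.≤-<-trans
    (subst (_≤ ℓ w′ + ℓ v′) (ℓ-cong (w′ · v′) (w · v) unchanged) (ℓ-· w′ v′))
    (ℕ.+-mono-< (ℓ-transpose-< w inv lt) (ℓ-transpose-< v x≺y inv))))
  where
  w′ v′ : W n
  w′ = w · transpose (v ⟨$⟩ʳ y) (v ⟨$⟩ʳ x)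
  v′ = v · transpose x y
  unchanged : w′ · v′ ≈ w · v
  unchanged z = cong (w ⟨$⟩ʳ_) (trans
    (cong (transpose (v ⟨$⟩ʳ y) (v ⟨$⟩ʳ x) ⟨$⟩ʳ_) (trans (·-transpose v x y z)
      (transpose-comm (v ⟨$⟩ʳ x) (v ⟨$⟩ʳ y) (v ⟨$⟩ʳ z))))
    (transpose-involutive (v ⟨$⟩ʳ y) (v ⟨$⟩ʳ x) (v ⟨$⟩ʳ z)))

-- Descents and maximal elements

-- The 0-based index of the block of W_J containing a point, that is, the number of gaps below it;
-- this form of `label` also makes sense for n = 0.
lab : ∀ {n} → Subset (pred n) → Fin n → ℕ
lab {suc n} J x = label J x

label-mono : ∀ {m} (J : Subset m) {x y} → toℕ x ≤ toℕ y → label J x ≤ label J y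
label-mono J {zero} _ = z≤n
label-mono (true  ∷ J) {suc x} {suc y} (s≤s le) = label-mono J le
label-mono (false ∷ J) {suc x} {suc y} (s≤s le) = s≤s (label-mono J le)

label-gap : ∀ {m} (J : Subset m) i → i ∉ J → label J (suc i) ≡ suc (label J (inject₁ i))
label-gap (true  ∷ J) zero    i∉ = contradiction Vec.here i∉
label-gap (false ∷ J) zero    i∉ = refl
label-gap (true  ∷ J) (suc i) i∉ = label-gap J i (i∉ ∘ Vec.there)
label-gap (false ∷ J) (suc i) i∉ = cong suc (label-gap J i (i∉ ∘ Vec.there))

module _ {n : ℕ} (J : Subset (pred n)) where

  lab-gap : ∀ {i} → i ∉ J → lab {n} J (hi i) ≡ suc (lab J (lo {n} i))
  lab-gap = gap n J _
    where
    gap : ∀ n (J : Subset (pred n)) i → i ∉ J → lab {n} J (hi i) ≡ suc (lab J (lo {n} i))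
    gap (suc n) J i = label-gap J i

  lab-step : ∀ {i} → i ∈ J → lab {n} J (lo i) ≡ lab J (hi {n} i)
  lab-step = step n J
    where
    step : ∀ n (J : Subset (pred n)) {i} → i ∈ J → lab {n} J (lo i) ≡ lab J (hi {n} i)
    step (suc n) J i∈J = sym (label-step i∈J)

  lab-mono : ∀ {x y : Fin n} → toℕ x ≤ toℕ y → lab J x ≤ lab J y
  lab-mono = mono n J
    where
    mono : ∀ n (J : Subset (pred n)) {x y : Fin n} → toℕ x ≤ toℕ y → lab J x ≤ lab J y
    mono (suc n) J = label-mono J

  lab⇒∈W : (w : W n) → (∀ x → lab J (w ⟨$⟩ʳ x) ≡ lab J x) → w ∈W J
  lab⇒∈W = ⇒∈W n J
    where
    ⇒∈W : ∀ n (J : Subset (pred n)) (w : W n) → (∀ x → lab J (w ⟨$⟩ʳ x) ≡ lab J x) → w ∈W J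
    ⇒∈W zero    J w _    = [] , [] , λ ()
    ⇒∈W (suc n) J w pres = label⇒∈W J w pres

  ∈W⇒lab : (w : W n) → w ∈W J → ∀ x → lab J (w ⟨$⟩ʳ x) ≡ lab J x
  ∈W⇒lab = ∈W⇒ n J
    where
    ∈W⇒ : ∀ n (J : Subset (pred n)) (w : W n) → w ∈W J → ∀ x → lab J (w ⟨$⟩ʳ x) ≡ lab J x
    ∈W⇒ (suc n) J w (u , u∈ , eq) x = trans (cong (label J) (sym (eq x))) (product-label u∈ x)

  lab-≡⇒∈ : ∀ {i} → lab {n} J (lo i) ≡ lab J (hi {n} i) → i ∈ J
  lab-≡⇒∈ {i} eq with i ∈? J
  ... | yes i∈J = i∈J
  ... | no i∉J  = contradiction (trans eq (lab-gap i∉J)) (ℕ.<⇒≢ ℕ.≤-refl)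

  lab-<⇒≺ : ∀ {x y : Fin n} → lab J x < lab J y → x ≺ y
  lab-<⇒≺ lt = ℕ.≰⇒> (λ le → ℕ.<⇒≱ lt (lab-mono le))

  simple∈W : ∀ {i} → i ∈ J → simple {n} i ∈W J
  simple∈W {i} i∈J = i ∷ [] , i∈J ∷ [] , λ _ → refl

  -- Labels are monotone, so every point between two points of equal label has that label too, and
  -- the two are joined by a chain of neighbours in J.
  block-induction : (R : Fin n → Fin n → Set) → (∀ {x y z} → R x y → R y z → R x z) →
                    (∀ {i} → i ∈ J → R (lo i) (hi i)) →
                    ∀ {x y} → x ≺ y → lab J x ≡ lab J y → R x y
  block-induction R R-trans step {x} {y} x≺y eq = upTo (toℕ y) y ℕ.≤-refl x≺y eq
    where
    predecessor : ∀ {n} {x : Fin n} (y : Fin n) → x ≺ y → ∃ λ i → hi {n} i ≡ y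
    predecessor (suc j) _ = j , refl
    upTo : ∀ k (y : Fin n) → toℕ y ≤ k → x ≺ y → lab J x ≡ lab J y → R x y
    upTo zero    y y≤k x≺y eq = contradiction (ℕ.≤-trans x≺y y≤k) λ ()
    upTo (suc k) y y≤k x≺y eq with predecessor {n} y x≺y
    ... | i , refl with ℕ.m≤n⇒m<n∨m≡n (ℕ.≤-pred (subst (toℕ x <_) (toℕ-hi {n} i) x≺y))
    ...   | inj₂ x≡lo with Fin.toℕ-injective x≡lo
    ...     | refl = step (lab-≡⇒∈ eq)
    upTo (suc k) y y≤k x≺y eq | i , refl | inj₁ x≺lo =
      R-trans (upTo k (lo {n} i) (ℕ.≤-pred (subst (_≤ suc k) (toℕ-hi {n} i) y≤k)) x≺lo x~lo)
              (step (lab-≡⇒∈ (trans (sym x~lo) eq)))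
      where
      x~lo : lab J x ≡ lab J (lo {n} i)
      x~lo = ℕ.≤-antisym (lab-mono (ℕ.<⇒≤ x≺lo))
        (subst (lab J (lo {n} i) ≤_) (sym eq) (lab-mono (ℕ.<⇒≤ (lo≺hi {n} i))))

  -- Being increasing on the blocks of J characterises the minimal element of `w` W_J, being
  -- decreasing the maximal one. Applied to `w ⁻¹`, the notions concern W_J `w`.
  Increasing Decreasing : W n → Set
  Increasing w = ∀ {x y} → x ≺ y → lab J x ≡ lab J y → w ⟨$⟩ʳ x ≺ w ⟨$⟩ʳ y
  Decreasing w = ∀ {x y} → x ≺ y → lab J x ≡ lab J y → w ⟨$⟩ʳ y ≺ w ⟨$⟩ʳ x

  Monotone : {A : Set} → (A → A → Set) → (Fin n → A) → Set
  Monotone R f = ∀ {x y} → x ≺ y → lab J x ≡ lab J y → R (f x) (f y)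

  -- The word of the rearrangement b is shortened until it is empty, by
  -- dropping its first letter or by the exchange condition.

  sorted : {A : Set} {R : A → A → Set} → (∀ {a b} → R a b → R b a → a ≡ b) →
           ∀ {f g : Fin n → A} → Monotone R f → Monotone R g →
           ∀ (b : W n) → b ∈W J → (∀ x → f x ≡ g (b ⟨$⟩ʳ x)) → ∀ x → f x ≡ g x
  sorted {R = R} R-antisym {f} {g} f-mono g-mono b (u , u∈ , u≈b) f≡gb =
    go (length u) u ℕ.≤-refl u∈ (λ x → trans (f≡gb x) (cong g (sym (u≈b x))))
    where
    go : ∀ k u → length u ≤ k → All (_∈ J) u → (∀ x → f x ≡ g (product {n} u ⟨$⟩ʳ x)) → ∀ x → f x ≡ g x
    go k [] _ _ eq = eq
    go (suc k) (i ∷ u) (s≤s len) (i∈J ∷ u∈) eq with ascent⊎descent i (product {n} (i ∷ u))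
    -- Monotonicity of `f` at the inverted positions and of `g` at `lo i`, `hi i` give opposite
    -- comparisons, so `g` agrees at `lo i` and `hi i` and does not see the first letter.
    ... | inj₂ desc = go k u len u∈ (λ x → trans (eq x) (g-simple _))
      where
      c : W n
      c = product (i ∷ u)
      c⁻¹-lab : ∀ x → lab J (c ⟨$⟩ˡ x) ≡ lab J x
      c⁻¹-lab = ∈W⇒lab (c ⁻¹) (∈W-⁻¹ c (i ∷ u , i∈J ∷ u∈ , λ _ → refl))
      f≡g : ∀ x → f (c ⟨$⟩ˡ x) ≡ g x
      f≡g x = trans (eq _) (cong g (Perm.inverseʳ c))
      g-lo≡hi : g (lo {n} i) ≡ g (hi {n} i)
      g-lo≡hi = R-antisym (g-mono (lo≺hi {n} i) (lab-step i∈J))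
        (subst₂ R (f≡g _) (f≡g _)
          (f-mono desc (trans (c⁻¹-lab _) (trans (sym (lab-step i∈J)) (sym (c⁻¹-lab _))))))
      g-simple : ∀ z → g (simple {n} i ⟨$⟩ʳ z) ≡ g z
      g-simple z with position (lo {n} i) (hi {n} i) z
      ... | at-left  = trans (cong g (simple-lo {n} i)) (sym g-lo≡hi)
      ... | at-right = trans (cong g (simple-hi {n} i)) g-lo≡hi
      ... | elsewhere z≢lo z≢hi = cong g (simple-other {n} i z≢lo z≢hi)
    -- An ascent of the product at its first letter shows that the word is not reduced: the tail
    -- inverts the two positions, and exchange yields a word for the same product with two letters
    -- fewer.
    ... | inj₁ asc with exchange u asc inv
      where
      c : W n
      c = product (i ∷ u)
      u-lo : product {n} u ⟨$⟩ʳ (c ⟨$⟩ˡ lo i) ≡ hi i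
      u-lo = trans (sym (simple-involutive {n} i _))
        (trans (cong (simple {n} i ⟨$⟩ʳ_) (Perm.inverseʳ c)) (simple-lo {n} i))
      u-hi : product {n} u ⟨$⟩ʳ (c ⟨$⟩ˡ hi i) ≡ lo i
      u-hi = trans (sym (simple-involutive {n} i _))
        (trans (cong (simple {n} i ⟨$⟩ʳ_) (Perm.inverseʳ c)) (simple-hi {n} i))
      inv : product {n} u ⟨$⟩ʳ (c ⟨$⟩ˡ hi i) ≺ product {n} u ⟨$⟩ʳ (c ⟨$⟩ˡ lo i)
      inv = subst₂ _≺_ (sym u-hi) (sym u-lo) (lo≺hi {n} i)
    ... | u′ , len′ , u′≈ , sub = go k u′ (ℕ.≤-trans (ℕ.n≤1+n _) (ℕ.≤-trans (ℕ.≤-reflexive len′) len))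
            (sub u∈) (λ x → trans (eq x) (cong g (sym (trans (u′≈ x) (sym (back x))))))
      where
      c : W n
      c = product (i ∷ u)
      back : c ≈ product u · transpose (c ⟨$⟩ˡ lo i) (c ⟨$⟩ˡ hi i)
      back x = trans (cong (simple {n} i ⟨$⟩ʳ_)
          (trans (sym (simple-involutive {n} i (product {n} u ⟨$⟩ʳ x))) (simple-· i c x)))
        (simple-involutive {n} i _)

  -- Here `w` and the identity are sorted sequences and `w` is the rearrangement; antisymmetry of
  -- the strict order is vacuous.
  increasing⇒ε : (w : W n) → w ∈W J → Increasing w → w ≈ ε
  increasing⇒ε w w∈ inc = sorted {R = _≺_} (λ lt gt → contradiction gt (Fin.<-asym {n} lt))
    {w ⟨$⟩ʳ_} {λ x → x} (λ {x} {y} → inc {x} {y}) (λ lt _ → lt) w w∈ (λ _ → refl)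

ℓ-right-ascent : ∀ {n} (w : W n) (i : S n) → w ⟨$⟩ʳ lo i ≺ w ⟨$⟩ʳ hi i → ℓ w < ℓ (w · simple i)
ℓ-right-ascent {n} w i asc = subst (_< ℓ (w · simple i))
  (ℓ-cong (w · simple i · transpose (lo i) (hi i)) w λ x → cong (w ⟨$⟩ʳ_)
    (trans (simple-transpose i _) (transpose-involutive (lo {n} i) (hi i) x)))
  (ℓ-transpose-< (w · simple i) (lo≺hi {n} i)
    (subst₂ _≺_ (cong (w ⟨$⟩ʳ_) (sym (simple-hi {n} i))) (cong (w ⟨$⟩ʳ_) (sym (simple-lo {n} i))) asc))

module _ {n : ℕ} (J : Subset (pred n)) where

  right-descents⇒decreasing : (w : W n) → (∀ {i} → i ∈ J → ¬ ℓ w < ℓ (w · simple {n} i)) → Decreasing J w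
  right-descents⇒decreasing w desc =
    block-induction J (λ x y → w ⟨$⟩ʳ y ≺ w ⟨$⟩ʳ x) (λ p q → Fin.<-trans {n} q p) λ {i} i∈J →
      ≺-by-contradiction
        (λ eq → contradiction (lo≺hi {n} i) (Fin.<-irrefl {n} (sym (injective w eq))))
        (desc i∈J ∘ ℓ-right-ascent w i)

  left-descents⇒decreasing : (w : W n) → (∀ {i} → i ∈ J → ¬ ℓ w < ℓ (simple {n} i · w)) → Decreasing J (w ⁻¹)
  left-descents⇒decreasing w desc =
    block-induction J (λ x y → w ⟨$⟩ˡ y ≺ w ⟨$⟩ˡ x) (λ p q → Fin.<-trans {n} q p) λ {i} i∈J →
      ≺-by-contradiction
        (λ eq → contradiction (lo≺hi {n} i) (Fin.<-irrefl {n} (sym (injective (w ⁻¹) eq))))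
        (λ asc → desc i∈J (ℕ.≤-reflexive (sym (ℓ-ascent i w asc))))

  w₀∈W : w₀ {n} J ∈W J
  w₀∈W = proj₁ (proj₂ (longest-element {n} J))

  w₀-decreasing : Decreasing J (w₀ {n} J)
  w₀-decreasing = right-descents⇒decreasing (w₀ J) λ {i} i∈J → ℕ.≤⇒≯
    (proj₂ (proj₂ (longest-element {n} J)) (w₀ J · simple i)
      (∈W-· (w₀ J) (simple i) w₀∈W (simple∈W J i∈J)))

  w₀-lab : ∀ x → lab J (w₀ {n} J ⟨$⟩ʳ x) ≡ lab J x
  w₀-lab = ∈W⇒lab J (w₀ J) w₀∈W

  w₀-involutive : w₀ {n} J · w₀ J ≈ ε
  w₀-involutive = increasing⇒ε J (w₀ J · w₀ J) (∈W-· (w₀ J) (w₀ J) w₀∈W w₀∈W)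
    λ {x} {y} x≺y eq → w₀-decreasing (w₀-decreasing x≺y eq)
      (trans (w₀-lab y) (trans (sym eq) (sym (w₀-lab x))))

  w₀⁻¹≈w₀ : w₀ {n} J ⁻¹ ≈ w₀ J
  w₀⁻¹≈w₀ x = from-≡ (w₀ J) (w₀-involutive x)

module _ {n : ℕ} {I J : Subset (pred n)} where

  ∈ᶜ-trans : (p q : Coset n I J) (w : W n) → w ∈ᶜ p → p ≈ᶜ q → w ∈ᶜ q
  ∈ᶜ-trans p q w (a , b , a∈ , b∈ , eq) (a′ , b′ , a′∈ , b′∈ , eq′) =
    a · a′ , b′ · b , ∈W-· a a′ a∈ a′∈ , ∈W-· b′ b b′∈ b∈ ,
    λ x → trans (eq x) (cong (a ⟨$⟩ʳ_) (eq′ _))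

  ≈ᶜ-refl : (p : Coset n I J) → p ≈ᶜ p
  ≈ᶜ-refl = rep∈ᶜ

  ≈ᶜ-sym : (p q : Coset n I J) → p ≈ᶜ q → q ≈ᶜ p
  ≈ᶜ-sym p q (a , b , a∈ , b∈ , eq) = a ⁻¹ , b ⁻¹ , ∈W-⁻¹ a a∈ , ∈W-⁻¹ b b∈ , λ x →
    sym (trans (cong (a ⟨$⟩ˡ_) (eq _)) (trans (Perm.inverseˡ a) (cong (rep q ⟨$⟩ʳ_) (Perm.inverseʳ b))))

  ≈⇒≈ᶜ : (p q : Coset n I J) → rep p ≈ rep q → p ≈ᶜ q
  ≈⇒≈ᶜ p q eq = ε , ε , ∈W-ε , ∈W-ε , eq

  Full : W n → Set
  Full m = Decreasing J m × Decreasing I (m ⁻¹)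

  ∈W-·ˡ : (p : Coset n I J) (a w : W n) → a ∈W I → w ∈ᶜ p → a · w ∈ᶜ p
  ∈W-·ˡ p a w a∈ (a′ , b , a′∈ , b∈ , eq) =
    a · a′ , b , ∈W-· a a′ a∈ a′∈ , b∈ , λ x → cong (a ⟨$⟩ʳ_) (eq x)

  ∈W-·ʳ : (p : Coset n I J) (w b : W n) → w ∈ᶜ p → b ∈W J → w · b ∈ᶜ p
  ∈W-·ʳ p w b (a , b′ , a∈ , b′∈ , eq) b∈ =
    a , b′ · b , a∈ , ∈W-· b′ b b′∈ b∈ , λ x → eq (b ⟨$⟩ʳ x)

  max∈ : (p : Coset n I J) → max p ∈ᶜ p
  max∈ p = proj₁ (proj₂ (bruhat-maximal p))

  -- An ascent in J or I would lead to a larger element of the same coset. Bruhat order is generated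
  -- by reflections on the left, so right multiplication by `simple i` is rewritten as the
  -- reflection conjugated by `m`; on the left the conjugating element is `ε`.
  max-full : (p : Coset n I J) → Full (max p)
  max-full p =
    right-descents⇒decreasing J m (λ {i} i∈J lt →
      let t·m≈ : m · simple i · m ⁻¹ · m ≈ m · simple i
          t·m≈ x = cong (λ z → m ⟨$⟩ʳ (simple i ⟨$⟩ʳ z)) (Perm.inverseˡ m)
          lt′ = subst (ℓ m <_) (sym (ℓ-cong (m · simple i · m ⁻¹ · m) (m · simple i) t·m≈)) lt in
      contradiction
        (ℓ-cong (m · simple i · m ⁻¹ · m) m (maximal (m · simple i · m ⁻¹ · m)
          (∈ᶜ-resp p (m · simple i) (m · simple i · m ⁻¹ · m) (λ x → sym (t·m≈ x))
            (∈W-·ʳ p m (simple i) (max∈ p) (simple∈W J i∈J)))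
          (reflect m i lt′ (reflexive {w = m · simple i · m ⁻¹ · m} λ _ → refl))))
        (ℕ.>⇒≢ lt′)) ,
    left-descents⇒decreasing I m (λ {i} i∈I lt → contradiction
        (ℓ-cong (simple i · m) m (maximal (simple i · m)
          (∈W-·ˡ p (simple i) m (simple∈W I i∈I) (max∈ p))
          (reflect ε i lt (reflexive {w = simple i · m} λ _ → refl))))
        (ℕ.>⇒≢ lt))
    where
    m : W n
    m = max p
    maximal : (z : W n) → z ∈ᶜ p → m ≤ᴮ z → z ≈ m
    maximal = proj₂ (proj₂ (bruhat-maximal p))

  -- The I-labels of the values of `m` and `m′` are rearrangements of each other within J-blocks and
  -- weakly decrease there, so they coincide by `sorted`. Thus `m′ · m ⁻¹` lies in W_I, and being a
  -- composite of two order reversals on I-blocks it is increasing, hence trivial.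
  full-unique : (p : Coset n I J) (m m′ : W n) → Full m → Full m′ → m ∈ᶜ p → m′ ∈ᶜ p → m ≈ m′
  full-unique p m m′ (m-J , m-I) (m′-J , m′-I) m∈ m′∈
    with a , b , a∈ , b∈ , eq ← ∈ᶜ-trans p ⟪ m ⟫ m′ m′∈ (≈ᶜ-sym ⟪ m ⟫ p m∈)
    = λ x → sym (trans (cong (m′ ⟨$⟩ʳ_) (sym (Perm.inverseˡ m)))
              (increasing⇒ε I (m′ · m ⁻¹) c∈ (λ {x} {y} → c-inc {x} {y}) (m ⟨$⟩ʳ x)))
    where
    labels : ∀ x → lab I (m′ ⟨$⟩ʳ x) ≡ lab I (m ⟨$⟩ʳ x)
    labels = sorted J {R = λ k l → l ≤ k} (λ p q → ℕ.≤-antisym q p)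
      (λ lt le → lab-mono I (ℕ.<⇒≤ (m′-J lt le))) (λ lt le → lab-mono I (ℕ.<⇒≤ (m-J lt le)))
      b b∈ (λ x → trans (cong (lab I) (eq x)) (∈W⇒lab I a a∈ (m ⟨$⟩ʳ (b ⟨$⟩ʳ x))))
    c∈ : m′ · m ⁻¹ ∈W I
    c∈ = lab⇒∈W I (m′ · m ⁻¹) (λ x → trans (labels _) (cong (lab I) (Perm.inverseʳ m)))
    c-inc : Increasing I (m′ · m ⁻¹)
    c-inc {x} {y} x≺y le = ≺-by-contradiction
      (λ p → contradiction x≺y (Fin.<-irrefl {n} (injective (m′ · m ⁻¹) p)))
      (λ gt → contradiction (m-I x≺y le) (Fin.<-asym {n} (subst₂ _≺_ (Perm.inverseˡ m′) (Perm.inverseˡ m′)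
        (m′-I gt (trans (∈W⇒lab I (m′ · m ⁻¹) c∈ y) (trans (sym le) (sym (∈W⇒lab I (m′ · m ⁻¹) c∈ x))))))))

  max-unique : (p : Coset n I J) (m : W n) → Full m → m ∈ᶜ p → max p ≈ m
  max-unique p m m-full m∈ = full-unique p (max p) m (max-full p) m-full (max∈ p) m∈

  max-cong : (p q : Coset n I J) → p ≈ᶜ q → max p ≈ max q
  max-cong p q p≈q = full-unique q (max p) (max q) (max-full p) (max-full q)
    (∈ᶜ-trans p q (max p) (max∈ p) p≈q) (max∈ q)

  max-≈ᶜ : (p : Coset n I J) → ⟪ max p ⟫ ≈ᶜ p
  max-≈ᶜ p = max∈ p

-- The star product

⋆ₛ-ascent : ∀ {n} (i : S n) (w : W n) → ℓ w < ℓ (simple i · w) → i ⋆ₛ w ≈ simple i · w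
⋆ₛ-ascent i w lt x with ℓ w <ᵇ ℓ (simple i · w) in eq
... | true  = refl
... | false = contradiction (ℕ.<⇒<ᵇ lt) (subst (λ b → ¬ T b) (sym eq) λ ())

⋆ₛ-descent : ∀ {n} (i : S n) (w : W n) → ¬ ℓ w < ℓ (simple i · w) → i ⋆ₛ w ≈ w
⋆ₛ-descent i w ≮ x with ℓ w <ᵇ ℓ (simple i · w) in eq
... | true  = contradiction (ℕ.<ᵇ⇒< _ _ (subst T (sym eq) tt)) ≮
... | false = refl

⋆ₛ-ascent′ : ∀ {n} (i : S n) (w v : W n) → w ≈ v → ℓ v < ℓ (simple i · v) → i ⋆ₛ w ≈ simple i · v
⋆ₛ-ascent′ {n} i w v w≈v lt x = trans (⋆ₛ-ascent i w
  (subst₂ _<_ (ℓ-cong v w (λ x → sym (w≈v x)))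
    (ℓ-cong (simple i · v) (simple i · w) (λ x → cong (simple {n} i ⟨$⟩ʳ_) (sym (w≈v x)))) lt) x)
  (cong (simple {n} i ⟨$⟩ʳ_) (w≈v x))

⋆ₛ-descent′ : ∀ {n} (i : S n) (w v : W n) → w ≈ v → ¬ ℓ v < ℓ (simple i · v) → i ⋆ₛ w ≈ v
⋆ₛ-descent′ {n} i w v w≈v ≮ x = trans (⋆ₛ-descent i w (≮ ∘ subst₂ _<_ (ℓ-cong w v w≈v)
    (ℓ-cong (simple i · w) (simple i · v) (λ x → cong (simple {n} i ⟨$⟩ʳ_) (w≈v x)))) x) (w≈v x)

module _ {n : ℕ} (J : Subset (pred n)) where

  -- The two cases of Deodhar's lemma: for y minimal in y W_J and s simple,
  -- either s y is minimal in s y W_J, or s y lies in y W_J.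

  simple-increasing : ∀ i (y : W n) → Increasing J y → y ⟨$⟩ˡ hi i ≺ y ⟨$⟩ˡ lo i →
                      Increasing J (simple i · y)
  simple-increasing i y inc desc x≺x′ eq with simple-mono i (inc x≺x′ eq)
  ... | inj₂ lt = lt
  ... | inj₁ (yx≡lo , yx′≡hi) = contradiction x≺x′ (Fin.<-asym {n}
          (subst₂ _≺_ (from-≡ y yx′≡hi) (from-≡ y yx≡lo) desc))

  increasing-neighbours : ∀ i (y : W n) → Increasing J y → y ⟨$⟩ˡ lo i ≺ y ⟨$⟩ˡ hi i →
                          lab J (y ⟨$⟩ˡ lo i) ≡ lab J (y ⟨$⟩ˡ hi i) →
                          ∃ λ j → j ∈ J × simple i · y ≈ y · simple {n} j
  increasing-neighbours i y inc asc eq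
    with ℕ.m≤n⇒m<n∨m≡n asc
  ... | inj₂ q≡1+p with j , refl′ , refl″ ← adjacent {n} (sym q≡1+p) =
    j , lab-≡⇒∈ {n} J (trans (cong (lab J) refl′) (trans eq (cong (lab J) (sym refl″)))) ,
    λ x → trans (simple-· i y x) (cong (y ⟨$⟩ʳ_) (trans
      (cong₂ (λ a b → transpose a b ⟨$⟩ʳ x) (sym refl′) (sym refl″)) (sym (simple-transpose {n} j x))))
  -- If the two positions were not neighbours, the point `r` just after the first would lie in the
  -- same block and be sent strictly between `lo i` and `hi i`.
  ... | inj₁ gap = contradiction (ℕ.<-≤-trans lo<r (ℕ.≤-pred (subst (toℕ (y ⟨$⟩ʳ r) <_) (toℕ-hi {n} i) r<hi)))
                                 (ℕ.<-irrefl refl)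
    where
    r-bound : suc (toℕ (y ⟨$⟩ˡ lo i)) < n
    r-bound = ℕ.<-trans gap (Fin.toℕ<n (y ⟨$⟩ˡ hi i))
    r : Fin n
    r = fromℕ< r-bound
    toℕ-r : toℕ r ≡ suc (toℕ (y ⟨$⟩ˡ lo i))
    toℕ-r = Fin.toℕ-fromℕ< r-bound
    p≺r : y ⟨$⟩ˡ lo i ≺ r
    p≺r = ℕ.≤-reflexive (sym toℕ-r)
    r≺q : r ≺ y ⟨$⟩ˡ hi i
    r≺q = subst (_< toℕ (y ⟨$⟩ˡ hi i)) (sym toℕ-r) gap
    r-lab : lab J (y ⟨$⟩ˡ lo i) ≡ lab J r
    r-lab = ℕ.≤-antisym (lab-mono J (ℕ.<⇒≤ p≺r)) (subst (lab J r ≤_) (sym eq) (lab-mono J (ℕ.<⇒≤ r≺q)))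
    lo<r : lo i ≺ y ⟨$⟩ʳ r
    lo<r = subst (_≺ y ⟨$⟩ʳ r) (Perm.inverseʳ y) (inc p≺r r-lab)
    r<hi : y ⟨$⟩ʳ r ≺ hi i
    r<hi = subst (y ⟨$⟩ʳ r ≺_) (Perm.inverseʳ y) (inc r≺q (trans (sym r-lab) eq))

  left-descent : (z : W n) → Decreasing J (z ⁻¹) → ∀ {i} → i ∈ J → ℓ (simple i · z) < ℓ z
  left-descent z dec i∈J = ℕ.≤-reflexive (ℓ-descent _ z (dec (lo≺hi {n} _) (lab-step {n} J i∈J)))

  -- By Deodhar's dichotomy the first letter of a reduced word of `y · a` either shortens `y`, and
  -- then genuinely multiplies, or passes through `y` to become a letter of J that shortens `a`. In
  -- the latter case it is absorbed, because `z` already has every left descent in J. So the whole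
  -- factor `a` disappears.
  ⋆-word : (z : W n) → Decreasing J (z ⁻¹) → ∀ u (y a : W n) → Increasing J y → a ∈W J →
           product u ≈ y · a → length u ≡ ℓ (y · a) → ℓ (y · z) ≡ ℓ y + ℓ z →
           foldr _⋆ₛ_ z u ≈ y · z
  ⋆-word z dec [] y a inc a∈ u≈ len add x = sym (increasing⇒ε J y
    (∈W-resp (a ⁻¹) y (λ x → trans (u≈ (a ⟨$⟩ˡ x)) (cong (y ⟨$⟩ʳ_) (Perm.inverseʳ a))) (∈W-⁻¹ a a∈))
    inc (z ⟨$⟩ʳ x))
  ⋆-word z dec (i ∷ u) y a inc a∈ u≈ len add = by-cases (ascent⊎descent i y)
    where
    u≈′ : product u ≈ simple i · (y · a)
    u≈′ x = trans (sym (simple-involutive {n} i _)) (cong (simple {n} i ⟨$⟩ʳ_) (u≈ x))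
    ya-desc : (y · a) ⟨$⟩ˡ hi i ≺ (y · a) ⟨$⟩ˡ lo i
    ya-desc with ascent⊎descent i (y · a)
    ... | inj₂ desc = desc
    ... | inj₁ asc  = contradiction (ℓ≤length (simple i · (y · a)) u u≈′)
      (ℕ.<⇒≱ (subst (length u <_) (sym (ℓ-ascent i (y · a) asc)) (s≤s (ℕ.≤-trans (ℕ.n≤1+n _) (ℕ.≤-reflexive len)))))
    len′ : length u ≡ ℓ (simple i · (y · a))
    len′ = ℕ.suc-injective (trans len (sym (ℓ-descent i (y · a) ya-desc)))

    by-cases : y ⟨$⟩ˡ lo i ≺ y ⟨$⟩ˡ hi i ⊎ y ⟨$⟩ˡ hi i ≺ y ⟨$⟩ˡ lo i → foldr _⋆ₛ_ z (i ∷ u) ≈ y · z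
    by-cases (inj₂ desc) x = trans
      (⋆ₛ-ascent′ i (foldr _⋆ₛ_ z u) (y′ · z)
        (⋆-word z dec u y′ a (simple-increasing i y inc desc) a∈ u≈′ len′ add′)
        (ℕ.≤-reflexive (trans (cong suc add′) (trans y-len (ℓ-cong (y · z) (simple i · (y′ · z))
          (λ x → sym (simple-cancel i y _))))))
        x)
      (simple-cancel i y _)
      where
      y′ : W n
      y′ = simple i · y
      y-len : suc (ℓ y′ + ℓ z) ≡ ℓ (y · z)
      y-len = trans (cong (_+ ℓ z) (ℓ-descent i y desc)) (sym add)
      add′ : ℓ (y′ · z) ≡ ℓ y′ + ℓ z
      add′ = ℕ.≤-antisym (ℓ-· y′ z) (ℕ.≤-pred (ℕ.≤-trans (ℕ.≤-reflexive y-len)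
        (subst (_≤ suc (ℓ (y′ · z))) (ℓ-cong (simple i · (y′ · z)) (y · z) (λ x → simple-cancel i y _))
          (ℓ-simple-≤ i (y′ · z)))))
    -- `i` is an ascent of `y` but a descent of `y · a`; since `a` preserves labels, the two
    -- positions must lie in one block.
    by-cases (inj₁ asc) = via (increasing-neighbours i y inc asc
        (ℕ.≤-antisym (lab-mono J (ℕ.<⇒≤ asc)) (ℕ.≮⇒≥ λ lt → Fin.<-asym {n} ya-desc (lab-<⇒≺ J
          (subst₂ _<_ (sym (a⁻¹-lab _)) (sym (a⁻¹-lab _)) lt)))))
      where
      a⁻¹-lab : ∀ x → lab J (a ⟨$⟩ˡ x) ≡ lab J x
      a⁻¹-lab = ∈W⇒lab J (a ⁻¹) (∈W-⁻¹ a a∈)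
      via : (∃ λ j → j ∈ J × simple i · y ≈ y · simple {n} j) → foldr _⋆ₛ_ z (i ∷ u) ≈ y · z
      via (j , j∈J , sy≈ys) = ⋆ₛ-descent′ i (foldr _⋆ₛ_ z u) (y · z)
        (⋆-word z dec u y (simple j · a) inc (∈W-· (simple j) a (simple∈W J j∈J) a∈)
          (λ x → trans (u≈′ x) (sy≈ys _))
          (trans len′ (ℓ-cong (simple i · (y · a)) (y · (simple j · a)) (λ x → sy≈ys _))) add)
        (ℕ.<⇒≯ (subst₂ _<_ (sym (ℓ-cong (simple i · (y · z)) (y · (simple j · z)) (λ x → sy≈ys _)))
          (sym add)
          (ℕ.≤-<-trans (ℓ-· y (simple j · z)) (ℕ.+-monoʳ-< (ℓ y) (left-descent z dec j∈J)))))

  ·w₀-increasing : (m : W n) → Decreasing J m → Increasing J (m · w₀ J ⁻¹)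
  ·w₀-increasing m dec {x} {y} x≺y eq = dec (subst₂ _≺_ (sym (w₀⁻¹≈w₀ J y)) (sym (w₀⁻¹≈w₀ J x)) (w₀-decreasing J x≺y eq))
    (trans (lab⁻¹ y) (trans (sym eq) (sym (lab⁻¹ x))))
    where
    lab⁻¹ : ∀ x → lab J (w₀ {n} J ⟨$⟩ˡ x) ≡ lab J x
    lab⁻¹ = ∈W⇒lab J (w₀ J ⁻¹) (∈W-⁻¹ (w₀ J) (w₀∈W J))

  ∈W-inversion : (a : W n) → a ∈W J → ∀ {x y} → x ≺ y → a ⟨$⟩ʳ y ≺ a ⟨$⟩ʳ x → lab J x ≡ lab J y
  ∈W-inversion a a∈ {x} {y} x≺y inv = ℕ.≤-antisym (lab-mono J (ℕ.<⇒≤ x≺y))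
    (subst₂ _≤_ (∈W⇒lab J a a∈ y) (∈W⇒lab J a a∈ x) (lab-mono J (ℕ.<⇒≤ inv)))

  -- `w₀ J` inverts pairs only inside a block, and there `m` is decreasing, so `m · w₀ J ⁻¹`
  -- restores none of them.
  ℓ-·w₀ : (m : W n) → Decreasing J m → ℓ (m · w₀ J ⁻¹) + ℓ (w₀ {n} J) ≡ ℓ m
  ℓ-·w₀ m dec = trans
    (sym (ℓ-additive (m · w₀ J ⁻¹) (w₀ J) λ {x} {y} x≺y inv →
      subst₂ _≺_ (sym (cancel y)) (sym (cancel x)) (dec x≺y (∈W-inversion (w₀ J) (w₀∈W J) x≺y inv))))
    (ℓ-cong (m · w₀ J ⁻¹ · w₀ J) m cancel)
    where
    cancel : m · w₀ J ⁻¹ · w₀ J ≈ m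
    cancel x = cong (m ⟨$⟩ʳ_) (Perm.inverseˡ (w₀ J))

  ℓ-w₀· : (m : W n) → Decreasing J (m ⁻¹) → ℓ (w₀ J ⁻¹ · m) + ℓ (w₀ {n} J) ≡ ℓ m
  ℓ-w₀· m dec = trans (cong (_+ ℓ (w₀ {n} J)) (trans
      (sym (ℓ-⁻¹ (w₀ J ⁻¹ · m)))
      (ℓ-cong ((w₀ J ⁻¹ · m) ⁻¹) (m ⁻¹ · w₀ J ⁻¹) (λ x → cong (m ⟨$⟩ˡ_) (sym (w₀⁻¹≈w₀ J x))))))
    (trans (ℓ-·w₀ (m ⁻¹) dec) (ℓ-⁻¹ m))

  -- The factorisation of `m` into its minimal representative and `w₀ J` is fed to `⋆-word`. The
  -- first half of `Reduced` thereby follows from a length condition that does not mention the star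
  -- product.
  ⋆-additive : (m z : W n) → Decreasing J m → Decreasing J (z ⁻¹) →
               ℓ (m · w₀ J ⁻¹ · z) + ℓ (w₀ {n} J) ≡ ℓ m + ℓ z → m ⋆ z ≈ m · w₀ J ⁻¹ · z
  ⋆-additive m z m-dec z-dec add = ⋆-word z z-dec (reducedWord m) (m · w₀ J ⁻¹) (w₀ J)
    (·w₀-increasing m m-dec) (w₀∈W J) (λ x → trans (reducedWord-product m x) (sym (cancel x)))
    (ℓ-cong m (m · w₀ J ⁻¹ · w₀ J) (λ x → sym (cancel x)))
    (ℕ.+-cancelʳ-≡ (ℓ (w₀ {n} J)) _ _ (trans add (trans (cong (_+ ℓ z) (sym (ℓ-·w₀ m m-dec)))
      (trans (ℕ.+-assoc (ℓ (m · w₀ J ⁻¹)) (ℓ (w₀ {n} J)) (ℓ z))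
        (trans (cong (ℓ (m · w₀ J ⁻¹) +_) (ℕ.+-comm (ℓ (w₀ {n} J)) (ℓ z)))
          (sym (ℕ.+-assoc (ℓ (m · w₀ J ⁻¹)) (ℓ z) (ℓ (w₀ {n} J)))))))))
    where
    cancel : m · w₀ J ⁻¹ · w₀ J ≈ m
    cancel x = cong (m ⟨$⟩ʳ_) (Perm.inverseˡ (w₀ J))

-- Composition of double cosets

module _ {n : ℕ} where

  module _ {I J K : Subset (pred n)} where

    infixl 7 _⊙_

    _⊙_ : Coset n I J → Coset n J K → W n
    p ⊙ q = max p · w₀ J ⁻¹ · max q

    Additive : Coset n I J → Coset n J K → Set
    Additive p q = ℓ (p ⊙ q) + ℓ (w₀ {n} J) ≡ ℓ (max p) + ℓ (max q)

    additive? : ∀ p q → Dec (Additive p q)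
    additive? p q = ℓ (p ⊙ q) + ℓ (w₀ {n} J) ℕ.≟ ℓ (max p) + ℓ (max q)

    ⊙-additive : ∀ p q → Additive p q → max p ⋆ max q ≈ p ⊙ q
    ⊙-additive p q = ⋆-additive J (max p) (max q) (proj₁ (max-full p)) (proj₂ (max-full q))

    additive⇒reduced : ∀ p q → Additive p q → Reduced p q
    additive⇒reduced p q add = ⊙-additive p q add ,
      trans (cong (_+ ℓ (w₀ {n} J)) (ℓ-cong (max p ⋆ max q) (p ⊙ q) (⊙-additive p q add))) add

    reduced⇒additive : ∀ p q → Reduced p q → Additive p q
    reduced⇒additive p q (⋆≈⊙ , len) =
      trans (cong (_+ ℓ (w₀ {n} J)) (sym (ℓ-cong (max p ⋆ max q) (p ⊙ q) ⋆≈⊙))) len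

    ⊙-cong : ∀ p p′ q q′ → p ≈ᶜ p′ → q ≈ᶜ q′ → p ⊙ q ≈ p′ ⊙ q′
    ⊙-cong p p′ q q′ p≈ q≈ x = trans (max-cong p p′ p≈ _)
      (cong (λ z → max p′ ⟨$⟩ʳ (w₀ {n} J ⟨$⟩ˡ z)) (max-cong q q′ q≈ x))

    additive-cong : ∀ p p′ q q′ → p ≈ᶜ p′ → q ≈ᶜ q′ → Additive p q → Additive p′ q′
    additive-cong p p′ q q′ p≈ q≈ add = trans
      (cong (_+ ℓ (w₀ {n} J)) (sym (ℓ-cong (p ⊙ q) (p′ ⊙ q′) (⊙-cong p p′ q q′ p≈ q≈))))
      (trans add (cong₂ _+_ (ℓ-cong (max p) (max p′) (max-cong p p′ p≈))
                            (ℓ-cong (max q) (max q′) (max-cong q q′ q≈))))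

    ∂∘∂-additive : ∀ p q → Additive p q → ∂ p ∘ᴰ ∂ q ≈ᴰ ∂ ⟪ p ⊙ q ⟫
    ∂∘∂-additive p q add rewrite dec-true (reduced? p q) (additive⇒reduced p q add) =
      ∂-cong (≈⇒≈ᶜ (p ⋆ᶜ q) ⟪ p ⊙ q ⟫ (⊙-additive p q add))

    ∂∘∂-zero : ∀ p q → ¬ Additive p q → ∂ p ∘ᴰ ∂ q ≈ᴰ 𝟘
    ∂∘∂-zero p q ¬add rewrite dec-false (reduced? p q) (¬add ∘ reduced⇒additive p q) = ≈-refl

    ∂∘∂-cong : ∀ {p p′ q q′} → p ≈ᶜ p′ → q ≈ᶜ q′ → ∂ p ∘ᴰ ∂ q ≈ᴰ ∂ p′ ∘ᴰ ∂ q′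
    ∂∘∂-cong {p} {p′} {q} {q′} p≈ q≈ with additive? p q
    ... | yes add = ≈-trans (∂∘∂-additive p q add) (≈-trans
      (∂-cong (≈⇒≈ᶜ ⟪ p ⊙ q ⟫ ⟪ p′ ⊙ q′ ⟫ (⊙-cong p p′ q q′ p≈ q≈)))
      (≈-sym (∂∘∂-additive p′ q′ (additive-cong p p′ q q′ p≈ q≈ add))))
    ... | no ¬add = ≈-trans (∂∘∂-zero p q ¬add) (≈-sym (∂∘∂-zero p′ q′
      (¬add ∘ additive-cong p′ p q′ q (≈ᶜ-sym p p′ p≈) (≈ᶜ-sym q q′ q≈))))

    -- Additivity makes both bracketings `y · max q` and `max p · z` free of cancellation: the first
    -- keeps the right descents of `max q`, the second the left descents of `max p`.
    max-⊙ : ∀ p q → Additive p q → max {n} {I} {K} ⟪ p ⊙ q ⟫ ≈ p ⊙ q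
    max-⊙ p q add = max-unique ⟪ p ⊙ q ⟫ (p ⊙ q) full (rep∈ᶜ ⟪ p ⊙ q ⟫)
      where
      y z : W n
      y = max p · w₀ J ⁻¹
      z = w₀ J ⁻¹ · max q
      add-y : ℓ (y · max q) ≡ ℓ y + ℓ (max q)
      add-y = ℕ.+-cancelʳ-≡ (ℓ (w₀ {n} J)) _ _ (trans add
        (trans (cong (_+ ℓ (max q)) (sym (ℓ-·w₀ J (max p) (proj₁ (max-full p)))))
          (solve 3 (λ a b c → a :+ b :+ c := a :+ c :+ b) refl (ℓ y) (ℓ (w₀ {n} J)) (ℓ (max q)))))
        where open +-*-Solver
      add-z : ℓ (z ⁻¹ · max p ⁻¹) ≡ ℓ (z ⁻¹) + ℓ (max p ⁻¹)
      add-z = trans (ℓ-cong (z ⁻¹ · max p ⁻¹) ((p ⊙ q) ⁻¹) (λ _ → refl))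
        (trans (ℓ-⁻¹ (p ⊙ q)) (trans (ℕ.+-cancelʳ-≡ (ℓ (w₀ {n} J)) _ _ (trans add
        (trans (cong (ℓ (max p) +_) (sym (ℓ-w₀· J (max q) (proj₂ (max-full q)))))
          (solve 3 (λ a b c → a :+ (b :+ c) := b :+ a :+ c) refl (ℓ (max p)) (ℓ z) (ℓ (w₀ {n} J))))))
        (cong₂ _+_ (sym (ℓ-⁻¹ z)) (sym (ℓ-⁻¹ (max p))))))
        where open +-*-Solver
      full : Full {I = I} {J = K} (p ⊙ q)
      full = (λ x≺y eq → ℓ-additive⁻¹ y (max q) add-y x≺y (proj₁ (max-full q) x≺y eq)) ,
             (λ x≺y eq → ℓ-additive⁻¹ (z ⁻¹) (max p ⁻¹) add-z x≺y (proj₂ (max-full p) x≺y eq))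

  -- Bilinearity of composition and the axioms of a linear category

  module _ {J I : Subset (pred n)} where

    open AbelianGroupProperties (RawLinearCategory.Hom (𝒟 n) J I) using (ε⁻¹≈ε; ⁻¹-∙-comm)

    𝟘⊞𝟘 : _≈ᴰ_ {n} {J} {I} 𝟘 (𝟘 ⊞ 𝟘)
    𝟘⊞𝟘 = ≈-sym (⊞-identity 𝟘)

    ⊟𝟘 : _≈ᴰ_ {n} {J} {I} 𝟘 (⊟ 𝟘)
    ⊟𝟘 = ≈-sym ε⁻¹≈ε

    ⊟-⊞ : (f g : Homᴰ {n} J I) → ⊟ (f ⊞ g) ≈ᴰ (⊟ f) ⊞ (⊟ g)
    ⊟-⊞ f g = ≈-sym (⁻¹-∙-comm f g)

    ⊞-interchange : (f g h k : Homᴰ {n} J I) → (f ⊞ g) ⊞ (h ⊞ k) ≈ᴰ (f ⊞ h) ⊞ (g ⊞ k)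
    ⊞-interchange f g h k = ≈-trans (⊞-assoc f g (h ⊞ k)) (≈-trans
      (⊞-cong ≈-refl (≈-trans (≈-sym (⊞-assoc g h k)) (≈-trans (⊞-cong (⊞-comm g h) ≈-refl) (⊞-assoc h g k))))
      (≈-sym (⊞-assoc f h (g ⊞ k))))

  module _ {I J K : Subset (pred n)} where

    ∘ᴰ-zeroʳ : (f : Homᴰ J I) → f ∘ᴰ 𝟘 {n} {K} ≈ᴰ 𝟘
    ∘ᴰ-zeroʳ (∂ p)   = ≈-refl
    ∘ᴰ-zeroʳ 𝟘       = ≈-refl
    ∘ᴰ-zeroʳ (f ⊞ g) = ≈-trans (⊞-cong (∘ᴰ-zeroʳ f) (∘ᴰ-zeroʳ g)) (≈-sym 𝟘⊞𝟘)
    ∘ᴰ-zeroʳ (⊟ f)   = ≈-trans (⊟-cong (∘ᴰ-zeroʳ f)) (≈-sym ⊟𝟘)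

    ∘ᴰ-distribˡ : (f : Homᴰ J I) (g h : Homᴰ K J) → f ∘ᴰ (g ⊞ h) ≈ᴰ (f ∘ᴰ g) ⊞ (f ∘ᴰ h)
    ∘ᴰ-distribˡ (∂ p)    g h = ≈-refl
    ∘ᴰ-distribˡ 𝟘        g h = 𝟘⊞𝟘
    ∘ᴰ-distribˡ (f ⊞ f′) g h = ≈-trans (⊞-cong (∘ᴰ-distribˡ f g h) (∘ᴰ-distribˡ f′ g h))
      (⊞-interchange (f ∘ᴰ g) (f ∘ᴰ h) (f′ ∘ᴰ g) (f′ ∘ᴰ h))
    ∘ᴰ-distribˡ (⊟ f)    g h = ≈-trans (⊟-cong (∘ᴰ-distribˡ f g h)) (⊟-⊞ (f ∘ᴰ g) (f ∘ᴰ h))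

    ∘ᴰ-⊟ʳ : (f : Homᴰ J I) (g : Homᴰ K J) → f ∘ᴰ (⊟ g) ≈ᴰ ⊟ (f ∘ᴰ g)
    ∘ᴰ-⊟ʳ (∂ p)    g = ≈-refl
    ∘ᴰ-⊟ʳ 𝟘        g = ⊟𝟘
    ∘ᴰ-⊟ʳ (f ⊞ f′) g = ≈-trans (⊞-cong (∘ᴰ-⊟ʳ f g) (∘ᴰ-⊟ʳ f′ g)) (≈-sym (⊟-⊞ (f ∘ᴰ g) (f′ ∘ᴰ g)))
    ∘ᴰ-⊟ʳ (⊟ f)    g = ⊟-cong (∘ᴰ-⊟ʳ f g)

    ∂∘ᴰ-cong : {p q : Coset n I J} → p ≈ᶜ q → (h : Homᴰ K J) → ∂ p ∘ᴰ h ≈ᴰ ∂ q ∘ᴰ h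
    ∂∘ᴰ-cong p≈q (∂ r)   = ∂∘∂-cong p≈q (≈ᶜ-refl r)
    ∂∘ᴰ-cong p≈q 𝟘       = ≈-refl
    ∂∘ᴰ-cong p≈q (g ⊞ h) = ⊞-cong (∂∘ᴰ-cong p≈q g) (∂∘ᴰ-cong p≈q h)
    ∂∘ᴰ-cong p≈q (⊟ h)   = ⊟-cong (∂∘ᴰ-cong p≈q h)

    ∘ᴰ-congˡ : {f g : Homᴰ J I} {h : Homᴰ K J} → f ≈ᴰ g → f ∘ᴰ h ≈ᴰ g ∘ᴰ h
    ∘ᴰ-congˡ {h = h} (∂-cong p≈q) = ∂∘ᴰ-cong p≈q h
    ∘ᴰ-congˡ ≈-refl              = ≈-refl
    ∘ᴰ-congˡ (≈-sym e)           = ≈-sym (∘ᴰ-congˡ e)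
    ∘ᴰ-congˡ (≈-trans e e′)      = ≈-trans (∘ᴰ-congˡ e) (∘ᴰ-congˡ e′)
    ∘ᴰ-congˡ (⊞-cong e e′)       = ⊞-cong (∘ᴰ-congˡ e) (∘ᴰ-congˡ e′)
    ∘ᴰ-congˡ (⊟-cong e)          = ⊟-cong (∘ᴰ-congˡ e)
    ∘ᴰ-congˡ (⊞-assoc f g h)     = ⊞-assoc _ _ _
    ∘ᴰ-congˡ (⊞-comm f g)        = ⊞-comm _ _
    ∘ᴰ-congˡ (⊞-identity f)      = ⊞-identity _
    ∘ᴰ-congˡ (⊞-inverse f)       = ⊞-inverse _

    ∘ᴰ-congʳ : (f : Homᴰ J I) {g h : Homᴰ K J} → g ≈ᴰ h → f ∘ᴰ g ≈ᴰ f ∘ᴰ h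
    ∘ᴰ-congʳ (∂ p)    (∂-cong q≈r)    = ∂∘∂-cong (≈ᶜ-refl p) q≈r
    ∘ᴰ-congʳ (∂ p)    ≈-refl          = ≈-refl
    ∘ᴰ-congʳ (∂ p)    (≈-sym e)       = ≈-sym (∘ᴰ-congʳ (∂ p) e)
    ∘ᴰ-congʳ (∂ p)    (≈-trans e e′)  = ≈-trans (∘ᴰ-congʳ (∂ p) e) (∘ᴰ-congʳ (∂ p) e′)
    ∘ᴰ-congʳ (∂ p)    (⊞-cong e e′)   = ⊞-cong (∘ᴰ-congʳ (∂ p) e) (∘ᴰ-congʳ (∂ p) e′)
    ∘ᴰ-congʳ (∂ p)    (⊟-cong e)      = ⊟-cong (∘ᴰ-congʳ (∂ p) e)
    ∘ᴰ-congʳ (∂ p)    (⊞-assoc f g h) = ⊞-assoc _ _ _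
    ∘ᴰ-congʳ (∂ p)    (⊞-comm f g)    = ⊞-comm _ _
    ∘ᴰ-congʳ (∂ p)    (⊞-identity f)  = ⊞-identity _
    ∘ᴰ-congʳ (∂ p)    (⊞-inverse f)   = ⊞-inverse _
    ∘ᴰ-congʳ 𝟘        e               = ≈-refl
    ∘ᴰ-congʳ (f ⊞ f′) e               = ⊞-cong (∘ᴰ-congʳ f e) (∘ᴰ-congʳ f′ e)
    ∘ᴰ-congʳ (⊟ f)    e               = ⊟-cong (∘ᴰ-congʳ f e)

  module _ {I J K L : Subset (pred n)}
           (p : Coset n I J) (q : Coset n J K) (r : Coset n K L) where
    open +-*-Solver

    private
      pqr : W n
      pqr = max p · w₀ J ⁻¹ · max q · w₀ K ⁻¹ · max r
      j k a b c : ℕ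
      j = ℓ (w₀ {n} J)
      k = ℓ (w₀ {n} K)
      a = ℓ (max p)
      b = ℓ (max q)
      c = ℓ (max r)

    -- A condition independent of bracketing; each of the two iterated composites is nonzero exactly
    -- when it holds.
    Additive₃ : Set
    Additive₃ = ℓ pqr + (j + k) ≡ a + b + c

    private
      left-≈ : Additive p q → ⟪_⟫ {I = I} {K} (p ⊙ q) ⊙ r ≈ pqr
      left-≈ add x = max-⊙ p q add _

      right-≈ : Additive q r → p ⊙ ⟪_⟫ {I = J} {L} (q ⊙ r) ≈ pqr
      right-≈ add x = cong (λ z → max p ⟨$⟩ʳ (w₀ {n} J ⟨$⟩ˡ z)) (max-⊙ q r add x)

      left : Additive p q → Additive ⟪ p ⊙ q ⟫ r → Additive₃
      left add add′ = ℕ.+-cancelʳ-≡ (ℓ (p ⊙ q)) _ _ (trans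
        (solve 4 (λ x j k y → x :+ (j :+ k) :+ y := (x :+ k) :+ (y :+ j)) refl (ℓ pqr) j k (ℓ (p ⊙ q)))
        (trans (cong₂ _+_ (trans (cong (_+ k) (sym (ℓ-cong (⟪ p ⊙ q ⟫ ⊙ r) pqr (left-≈ add))))
                    (trans add′ (cong (_+ c) (ℓ-cong (max ⟪ p ⊙ q ⟫) (p ⊙ q) (max-⊙ p q add))))) add)
          (solve 4 (λ y c a b → y :+ c :+ (a :+ b) := a :+ b :+ c :+ y) refl (ℓ (p ⊙ q)) c a b)))

      right : Additive q r → Additive p ⟪ q ⊙ r ⟫ → Additive₃
      right add add′ = ℕ.+-cancelʳ-≡ (ℓ (q ⊙ r)) _ _ (trans
        (solve 4 (λ x j k y → x :+ (j :+ k) :+ y := (x :+ j) :+ (y :+ k)) refl (ℓ pqr) j k (ℓ (q ⊙ r)))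
        (trans (cong₂ _+_ (trans (cong (_+ j) (sym (ℓ-cong (p ⊙ ⟪ q ⊙ r ⟫) pqr (right-≈ add))))
                    (trans add′ (cong (a +_) (ℓ-cong (max ⟪ q ⊙ r ⟫) (q ⊙ r) (max-⊙ q r add))))) add)
          (solve 4 (λ y a b c → a :+ y :+ (b :+ c) := a :+ b :+ c :+ y) refl (ℓ (q ⊙ r)) a b c)))

      y z : W n
      y = max p · w₀ J ⁻¹
      z = w₀ K ⁻¹ · max r
      y-len : ℓ y + j ≡ a
      y-len = ℓ-·w₀ J (max p) (proj₁ (max-full p))
      z-len : ℓ z + k ≡ c
      z-len = ℓ-w₀· K (max r) (proj₂ (max-full r))

      -- One inequality always holds by subadditivity. If it were strict, `z` could not make up the
      -- loss, since multiplying by it adds at most `ℓ z`.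
      left⁻¹ : Additive₃ → Additive p q
      left⁻¹ add = ℕ.≤-antisym
        (ℕ.≤-trans (ℕ.+-monoˡ-≤ j (ℓ-· y (max q))) (ℕ.≤-reflexive (trans
          (solve 3 (λ y b j → y :+ b :+ j := y :+ j :+ b) refl (ℓ y) b j) (cong (_+ b) y-len))))
        (ℕ.+-cancelʳ-≤ c _ _ (ℕ.≤-trans (ℕ.≤-reflexive (sym add))
          (ℕ.≤-trans (ℕ.+-monoˡ-≤ (j + k) (ℓ-· (p ⊙ q) z)) (ℕ.≤-reflexive (trans
            (solve 4 (λ x z j k → x :+ z :+ (j :+ k) := x :+ j :+ (z :+ k)) refl (ℓ (p ⊙ q)) (ℓ z) j k)
            (cong (ℓ (p ⊙ q) + j +_) z-len))))))

      right⁻¹ : Additive₃ → Additive q r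
      right⁻¹ add = ℕ.≤-antisym
        (ℕ.≤-trans (ℕ.+-monoˡ-≤ k (ℓ-· (max q) z)) (ℕ.≤-reflexive (trans
          (ℕ.+-assoc b (ℓ z) k) (cong (b +_) z-len))))
        (ℕ.+-cancelˡ-≤ a _ _ (ℕ.≤-trans (ℕ.≤-reflexive (trans (sym (ℕ.+-assoc a b c)) (sym add)))
          (ℕ.≤-trans (ℕ.+-monoˡ-≤ (j + k) (ℓ-· y (q ⊙ r))) (ℕ.≤-reflexive (trans
            (solve 4 (λ y x j k → y :+ x :+ (j :+ k) := y :+ j :+ (x :+ k)) refl (ℓ y) (ℓ (q ⊙ r)) j k)
            (cong (_+ (ℓ (q ⊙ r) + k)) y-len))))))

      left′ : Additive₃ → Additive ⟪ p ⊙ q ⟫ r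
      left′ add = trans (cong (_+ k) (ℓ-cong (⟪ p ⊙ q ⟫ ⊙ r) pqr (left-≈ pq)))
        (trans (ℕ.+-cancelʳ-≡ j _ _ (trans
          (solve 3 (λ x j k → x :+ k :+ j := x :+ (j :+ k)) refl (ℓ pqr) j k)
          (trans add (trans (cong (_+ c) (sym pq))
            (solve 3 (λ x j c → x :+ j :+ c := x :+ c :+ j) refl (ℓ (p ⊙ q)) j c)))))
          (cong (_+ c) (sym (ℓ-cong (max ⟪ p ⊙ q ⟫) (p ⊙ q) (max-⊙ p q pq)))))
        where
        pq : Additive p q
        pq = left⁻¹ add

      right′ : Additive₃ → Additive p ⟪ q ⊙ r ⟫
      right′ add = trans (cong (_+ j) (ℓ-cong (p ⊙ ⟪ q ⊙ r ⟫) pqr (right-≈ qr)))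
        (trans (ℕ.+-cancelʳ-≡ k _ _ (trans
          (ℕ.+-assoc (ℓ pqr) j k)
          (trans add (trans (ℕ.+-assoc a b c) (trans (cong (a +_) (sym qr)) (sym (ℕ.+-assoc a (ℓ (q ⊙ r)) k)))))))
          (cong (a +_) (sym (ℓ-cong (max ⟪ q ⊙ r ⟫) (q ⊙ r) (max-⊙ q r qr)))))
        where
        qr : Additive q r
        qr = right⁻¹ add

    ∂-assoc : (∂ p ∘ᴰ ∂ q) ∘ᴰ ∂ r ≈ᴰ ∂ p ∘ᴰ (∂ q ∘ᴰ ∂ r)
    ∂-assoc with ℓ pqr + (j + k) ℕ.≟ a + b + c
    ... | yes add = ≈-trans (∘ᴰ-congˡ (∂∘∂-additive p q (left⁻¹ add)))
      (≈-trans (∂∘∂-additive ⟪ p ⊙ q ⟫ r (left′ add))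
      (≈-trans (∂-cong (≈⇒≈ᶜ ⟪ ⟪ p ⊙ q ⟫ ⊙ r ⟫ ⟪ p ⊙ ⟪ q ⊙ r ⟫ ⟫
        (λ x → trans (left-≈ (left⁻¹ add) x) (sym (right-≈ (right⁻¹ add) x)))))
      (≈-trans (≈-sym (∂∘∂-additive p ⟪ q ⊙ r ⟫ (right′ add)))
      (∘ᴰ-congʳ (∂ p) (≈-sym (∂∘∂-additive q r (right⁻¹ add)))))))
    ... | no ¬add = ≈-trans left-zero (≈-sym right-zero)
      where
      left-zero : (∂ p ∘ᴰ ∂ q) ∘ᴰ ∂ r ≈ᴰ 𝟘
      left-zero with additive? p q
      ... | yes pq = ≈-trans (∘ᴰ-congˡ (∂∘∂-additive p q pq)) (∂∘∂-zero ⟪ p ⊙ q ⟫ r (¬add ∘ left pq))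
      ... | no ¬pq = ∘ᴰ-congˡ (∂∘∂-zero p q ¬pq)
      right-zero : ∂ p ∘ᴰ (∂ q ∘ᴰ ∂ r) ≈ᴰ 𝟘
      right-zero with additive? q r
      ... | yes qr = ≈-trans (∘ᴰ-congʳ (∂ p) (∂∘∂-additive q r qr)) (∂∘∂-zero p ⟪ q ⊙ r ⟫ (¬add ∘ right qr))
      ... | no ¬qr = ∘ᴰ-congʳ (∂ p) (∂∘∂-zero q r ¬qr)

  ∘ᴰ-assoc : ∀ {I J K L : Subset (pred n)} (f : Homᴰ J I) (g : Homᴰ K J) (h : Homᴰ L K) →
            (f ∘ᴰ g) ∘ᴰ h ≈ᴰ f ∘ᴰ (g ∘ᴰ h)
  ∘ᴰ-assoc 𝟘        g        h        = ≈-refl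
  ∘ᴰ-assoc (f ⊞ f′) g        h        = ⊞-cong (∘ᴰ-assoc f g h) (∘ᴰ-assoc f′ g h)
  ∘ᴰ-assoc (⊟ f)    g        h        = ⊟-cong (∘ᴰ-assoc f g h)
  ∘ᴰ-assoc (∂ p)    𝟘        h        = ≈-refl
  ∘ᴰ-assoc (∂ p)    (g ⊞ g′) h        = ⊞-cong (∘ᴰ-assoc (∂ p) g h) (∘ᴰ-assoc (∂ p) g′ h)
  ∘ᴰ-assoc (∂ p)    (⊟ g)    h        = ⊟-cong (∘ᴰ-assoc (∂ p) g h)
  ∘ᴰ-assoc (∂ p)    (∂ q)    𝟘        = ∘ᴰ-zeroʳ (∂ p ∘ᴰ ∂ q)
  ∘ᴰ-assoc (∂ p)    (∂ q)    (h ⊞ h′) = ≈-trans (∘ᴰ-distribˡ (∂ p ∘ᴰ ∂ q) h h′)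
    (⊞-cong (∘ᴰ-assoc (∂ p) (∂ q) h) (∘ᴰ-assoc (∂ p) (∂ q) h′))
  ∘ᴰ-assoc (∂ p)    (∂ q)    (⊟ h)    = ≈-trans (∘ᴰ-⊟ʳ (∂ p ∘ᴰ ∂ q) h) (⊟-cong (∘ᴰ-assoc (∂ p) (∂ q) h))
  ∘ᴰ-assoc (∂ p)    (∂ q)    (∂ r)    = ∂-assoc p q r

  max-one : ∀ (I : Subset (pred n)) → max {n} {I} {I} ⟪ ε ⟫ ≈ w₀ I
  max-one I = max-unique {n} {I} {I} ⟪ ε ⟫ (w₀ I)
    (w₀-decreasing I , λ {x} {y} x≺y eq →
      subst₂ _≺_ (sym (w₀⁻¹≈w₀ {n} I y)) (sym (w₀⁻¹≈w₀ {n} I x)) (w₀-decreasing I x≺y eq))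
    (w₀ I , ε , w₀∈W I , ∈W-ε , λ _ → refl)

  module _ {I J : Subset (pred n)} (p : Coset n I J) where

    one-⊙ : ⟪_⟫ {n} {I} {I} ε ⊙ p ≈ max p
    one-⊙ x = trans (max-one I _) (Perm.inverseʳ (w₀ {n} I))

    ⊙-one : p ⊙ ⟪_⟫ {n} {J} {J} ε ≈ max p
    ⊙-one x = cong (max p ⟨$⟩ʳ_) (trans (cong (w₀ {n} J ⟨$⟩ˡ_) (max-one J x)) (Perm.inverseˡ (w₀ {n} J)))

    ∂-identityˡ : ∂ ⟪ ε ⟫ ∘ᴰ ∂ p ≈ᴰ ∂ p
    ∂-identityˡ = ≈-trans
      (∂∘∂-additive ⟪ ε ⟫ p (trans (cong (_+ ℓ (w₀ {n} I)) (ℓ-cong (⟪ ε ⟫ ⊙ p) (max p) one-⊙))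
        (trans (ℕ.+-comm (ℓ (max p)) (ℓ (w₀ {n} I)))
               (cong (_+ ℓ (max p)) (sym (ℓ-cong (max ⟪ ε ⟫) (w₀ I) (max-one I)))))))
      (∂-cong (∈ᶜ-resp p (max p) (⟪ ε ⟫ ⊙ p) (λ x → sym (one-⊙ x)) (max-≈ᶜ p)))

    ∂-identityʳ : ∂ p ∘ᴰ ∂ ⟪ ε ⟫ ≈ᴰ ∂ p
    ∂-identityʳ = ≈-trans
      (∂∘∂-additive p ⟪ ε ⟫ (cong₂ _+_ (ℓ-cong (p ⊙ ⟪ ε ⟫) (max p) ⊙-one)
                                       (sym (ℓ-cong (max ⟪ ε ⟫) (w₀ J) (max-one J)))))
      (∂-cong (∈ᶜ-resp p (max p) (p ⊙ ⟪ ε ⟫) (λ x → sym (⊙-one x)) (max-≈ᶜ p)))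

  ∘ᴰ-identityˡ : ∀ {I J : Subset (pred n)} (f : Homᴰ J I) → ∂ ⟪ ε ⟫ ∘ᴰ f ≈ᴰ f
  ∘ᴰ-identityˡ (∂ p)   = ∂-identityˡ p
  ∘ᴰ-identityˡ 𝟘       = ≈-refl
  ∘ᴰ-identityˡ (f ⊞ g) = ⊞-cong (∘ᴰ-identityˡ f) (∘ᴰ-identityˡ g)
  ∘ᴰ-identityˡ (⊟ f)   = ⊟-cong (∘ᴰ-identityˡ f)

  ∘ᴰ-identityʳ : ∀ {I J : Subset (pred n)} (f : Homᴰ J I) → f ∘ᴰ ∂ ⟪ ε ⟫ ≈ᴰ f
  ∘ᴰ-identityʳ (∂ p)   = ∂-identityʳ p
  ∘ᴰ-identityʳ 𝟘       = ≈-refl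
  ∘ᴰ-identityʳ (f ⊞ g) = ⊞-cong (∘ᴰ-identityʳ f) (∘ᴰ-identityʳ g)
  ∘ᴰ-identityʳ (⊟ f)   = ⊟-cong (∘ᴰ-identityʳ f)

𝒟-isLinear : ∀ n → IsLinearCategory (𝒟 n)
𝒟-isLinear n = record
  { ∙-cong    = λ {_} {_} {_} {f} {f′} {g} f≈f′ g≈g′ → ≈-trans (∘ᴰ-congˡ {n} {h = g} f≈f′) (∘ᴰ-congʳ {n} f′ g≈g′)
  ; assoc     = ∘ᴰ-assoc {n}
  ; identityˡ = ∘ᴰ-identityˡ {n}
  ; identityʳ = ∘ᴰ-identityʳ {n}
  ; distribˡ  = ∘ᴰ-distribˡ {n}
  ; distribʳ  = λ f g h → ≈-refl
  }

subcategory-isLinear : (𝒞 : RawLinearCategory) (let open RawLinearCategory 𝒞) →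
                       (G : ∀ {A B} → ∣Hom∣ A B → Set) →
                       IsLinearCategory 𝒞 → IsLinearCategory (subcategory 𝒞 G)
subcategory-isLinear 𝒞 G C = record
  { ∙-cong    = C.∙-cong
  ; assoc     = λ f g h → C.assoc _ _ _
  ; identityˡ = λ f → C.identityˡ _
  ; identityʳ = λ f → C.identityʳ _
  ; distribˡ  = λ f g h → C.distribˡ _ _ _
  ; distribʳ  = λ f g h → C.distribʳ _ _ _
  }
  where module C = IsLinearCategory C

-- Exchanging adjacent blocks

-- A point beyond the first block is presented as a sum, so that the truncated subtraction in
-- `blockOf` cancels.
data Cut (m : ℕ) : ℕ → Set where
  below : ∀ {x} → x < m → Cut m x
  above : ∀ y → Cut m (m + y)

cut : ∀ m x → Cut m x
cut zero    x       = above x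
cut (suc m) zero    = below (s≤s z≤n)
cut (suc m) (suc x) with cut m x
... | below x<m = below (s≤s x<m)
... | above y   = above y

<⇒<ᵇ-true : ∀ {x m} → x < m → (x <ᵇ m) ≡ true
<⇒<ᵇ-true {x} {m} lt with x <ᵇ m in eq
... | true  = refl
... | false = contradiction (ℕ.<⇒<ᵇ lt) (subst (¬_ ∘ T) (sym eq) λ ())

+<ᵇ-false : ∀ m y → (m + y <ᵇ m) ≡ false
+<ᵇ-false zero    y = refl
+<ᵇ-false (suc m) y = +<ᵇ-false m y

blockOf-below : ∀ {m x} ms → x < m → blockOf (m ∷ ms) x ≡ 0
blockOf-below ms lt rewrite <⇒<ᵇ-true lt = refl

blockOf-above : ∀ m ms y → blockOf (m ∷ ms) (m + y) ≡ suc (blockOf ms y)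
blockOf-above m ms y rewrite +<ᵇ-false m y | ℕ.m+n∸m≡n m y = refl

blockOf-zero : ∀ {ms} → All (0 <_) ms → blockOf ms 0 ≡ 0
blockOf-zero []              = refl
blockOf-zero {m ∷ ms} (0<m ∷ _) = blockOf-below ms 0<m

blockOf-suc : ∀ {ms} → All (0 <_) ms → ∀ x →
              blockOf ms (suc x) ≡ blockOf ms x ⊎ blockOf ms (suc x) ≡ suc (blockOf ms x)
blockOf-suc [] x = inj₁ refl
blockOf-suc {m ∷ ms} (0<m ∷ pos) x with cut m x
... | above y rewrite sym (ℕ.+-suc m y) | blockOf-above m ms y | blockOf-above m ms (suc y)
  with blockOf-suc pos y
...   | inj₁ eq = inj₁ (cong suc eq)
...   | inj₂ eq = inj₂ (cong suc eq)
blockOf-suc {m ∷ ms} (0<m ∷ pos) x | below x<m rewrite blockOf-below ms x<m with ℕ.m≤n⇒m<n∨m≡n x<m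
... | inj₁ 1+x<m = inj₁ (blockOf-below ms 1+x<m)
... | inj₂ refl  = inj₂ (trans (cong (blockOf (m ∷ ms)) (sym (ℕ.+-identityʳ m)))
                     (trans (blockOf-above m ms 0) (cong suc (blockOf-zero pos))))

blockOf-< : ∀ ms {x} → x < sum ms → blockOf ms x < length ms
blockOf-< (m ∷ ms) {x} lt with cut m x
... | below x<m rewrite blockOf-below ms x<m = s≤s z≤n
... | above y   rewrite blockOf-above m ms y = s≤s (blockOf-< ms (ℕ.+-cancelˡ-< m y (sum ms) lt))

blockOf-onto : ∀ {ms} → All (0 <_) ms → ∀ {k} → k < length ms → ∃ λ x → x < sum ms × blockOf ms x ≡ k
blockOf-onto {m ∷ ms} (0<m ∷ pos) {zero}  _ = 0 , ℕ.≤-trans 0<m (ℕ.m≤m+n m (sum ms)) , blockOf-below ms 0<m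
blockOf-onto {m ∷ ms} (0<m ∷ pos) {suc k} (s≤s lt) with x , x< , eq ← blockOf-onto pos lt =
  m + x , ℕ.+-monoʳ-< m x< , trans (blockOf-above m ms x) (cong suc eq)

-- If the first parts differ, the smaller of them, taken as a point, lies in block 0 for one list
-- and outside it for the other.
blockOf-injective : ∀ {ms ms′} → All (0 <_) ms → All (0 <_) ms′ → sum ms ≡ sum ms′ →
                    (∀ {x} → x < sum ms → blockOf ms x ≡ blockOf ms′ x) → ms ≡ ms′
blockOf-injective [] [] _ _ = refl
blockOf-injective [] (0<m ∷ _) s _ = contradiction s (ℕ.<⇒≢ (ℕ.≤-trans 0<m (ℕ.m≤m+n _ _)))
blockOf-injective (0<m ∷ _) [] s _ = contradiction (sym s) (ℕ.<⇒≢ (ℕ.≤-trans 0<m (ℕ.m≤m+n _ _)))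
blockOf-injective {m ∷ ms} {m′ ∷ ms′} (_ ∷ pos) (_ ∷ pos′) s eq with ℕ.<-cmp m m′
... | tri< m<m′ _ _ = contradiction
  (trans (sym (blockOf-below ms′ m<m′)) (trans (sym (eq (subst (m <_) (sym s) (ℕ.≤-trans m<m′ (ℕ.m≤m+n m′ _)))))
    (trans (cong (blockOf (m ∷ ms)) (sym (ℕ.+-identityʳ m))) (blockOf-above m ms 0)))) λ ()
... | tri> _ _ m′<m = contradiction
  (trans (sym (blockOf-below ms m′<m)) (trans (eq (ℕ.≤-trans m′<m (ℕ.m≤m+n m _)))
    (trans (cong (blockOf (m′ ∷ ms′)) (sym (ℕ.+-identityʳ m′))) (blockOf-above m′ ms′ 0)))) λ ()
... | tri≈ _ refl _ = cong (m ∷_) (blockOf-injective pos pos′ (ℕ.+-cancelˡ-≡ m _ _ s) λ {x} lt →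
  ℕ.suc-injective (trans (sym (blockOf-above m ms x)) (trans (eq (ℕ.+-monoʳ-< m lt)) (blockOf-above m ms′ x))))

-- τ i is the transposition of i and i + 1, and μ i identifies i + 1 with i.

τ : ℕ → ℕ → ℕ
τ zero    zero          = 1
τ zero    (suc zero)    = 0
τ zero    (suc (suc k)) = suc (suc k)
τ (suc i) zero          = 0
τ (suc i) (suc k)       = suc (τ i k)

μ : ℕ → ℕ → ℕ
μ zero    zero    = 0
μ zero    (suc k) = k
μ (suc i) zero    = 0
μ (suc i) (suc k) = suc (μ i k)

τ-involutive : ∀ i k → τ i (τ i k) ≡ k
τ-involutive zero    zero          = refl
τ-involutive zero    (suc zero)    = refl
τ-involutive zero    (suc (suc k)) = refl
τ-involutive (suc i) zero          = refl
τ-involutive (suc i) (suc k)       = cong suc (τ-involutive i k)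

τ-adjoint : ∀ i {k l} → τ i k ≡ l → k ≡ τ i l
τ-adjoint i {k} eq = trans (sym (τ-involutive i k)) (cong (τ i) eq)

τ-injective : ∀ i {k l} → τ i k ≡ τ i l → k ≡ l
τ-injective i {k} {l} eq = trans (τ-adjoint i eq) (τ-involutive i l)

τ-left : ∀ i → τ i i ≡ suc i
τ-left zero    = refl
τ-left (suc i) = cong suc (τ-left i)

τ-right : ∀ i → τ i (suc i) ≡ i
τ-right zero    = refl
τ-right (suc i) = cong suc (τ-right i)

τ-below : ∀ i → τ (suc i) i ≡ i
τ-below zero    = refl
τ-below (suc i) = cong suc (τ-below i)

τ-above : ∀ i → τ i (suc (suc i)) ≡ suc (suc i)
τ-above zero    = refl
τ-above (suc i) = cong suc (τ-above i)

τ-far : ∀ i j → 1 < ∣ i - j ∣ → τ i j ≡ j × τ i (suc j) ≡ suc j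
τ-far zero    (suc (suc j)) _         = refl , refl
τ-far zero    (suc zero)    (s≤s ())
τ-far (suc zero) zero       (s≤s ())
τ-far (suc (suc i)) zero    _         = refl , refl
τ-far (suc i) (suc j)       lt with p , q ← τ-far i j lt = cong suc p , cong suc q

τ-braid : ∀ i k → τ i (τ (suc i) (τ i k)) ≡ τ (suc i) (τ i (τ (suc i) k))
τ-braid zero    zero                = refl
τ-braid zero    (suc zero)          = refl
τ-braid zero    (suc (suc zero))    = refl
τ-braid zero    (suc (suc (suc k))) = refl
τ-braid (suc i) zero                = refl
τ-braid (suc i) (suc k)             = cong suc (τ-braid i k)

τ-commute : ∀ i j → 1 < ∣ i - j ∣ → ∀ k → τ i (τ j k) ≡ τ j (τ i k)
τ-commute zero          (suc zero)    (s≤s ()) k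
τ-commute zero          (suc (suc j)) lt zero          = refl
τ-commute zero          (suc (suc j)) lt (suc zero)    = refl
τ-commute zero          (suc (suc j)) lt (suc (suc k)) = refl
τ-commute (suc zero)    zero          (s≤s ()) k
τ-commute (suc (suc i)) zero          lt zero          = refl
τ-commute (suc (suc i)) zero          lt (suc zero)    = refl
τ-commute (suc (suc i)) zero          lt (suc (suc k)) = refl
τ-commute (suc i)       (suc j)       lt zero          = refl
τ-commute (suc i)       (suc j)       lt (suc k)       = cong suc (τ-commute i j lt k)

τ-mono : ∀ i {k l} → k < l → (k ≡ i × l ≡ suc i) ⊎ τ i k < τ i l
τ-mono zero {zero}        {suc zero}    _  = inj₁ (refl , refl)
τ-mono zero {zero}        {suc (suc l)} _  = inj₂ (s≤s (s≤s z≤n))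
τ-mono zero {suc zero}    {suc (suc l)} _  = inj₂ (s≤s z≤n)
τ-mono zero {suc zero}    {suc zero}    (s≤s ())
τ-mono zero {suc (suc k)} {suc (suc l)} lt = inj₂ lt
τ-mono zero {suc (suc k)} {suc zero}    (s≤s ())
τ-mono (suc i) {zero}     {suc l}       _  = inj₂ (s≤s z≤n)
τ-mono (suc i) {suc k}    {suc l}       (s≤s lt) with τ-mono i lt
... | inj₁ (refl , refl) = inj₁ (refl , refl)
... | inj₂ lt′           = inj₂ (s≤s lt′)

μ-τ : ∀ i k → μ i (τ i k) ≡ μ i k
μ-τ zero    zero          = refl
μ-τ zero    (suc zero)    = refl
μ-τ zero    (suc (suc k)) = refl
μ-τ (suc i) zero          = refl
μ-τ (suc i) (suc k)       = cong suc (μ-τ i k)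

μ-step : ∀ i → μ i i ≡ μ i (suc i)
μ-step zero    = refl
μ-step (suc i) = cong suc (μ-step i)

μ-fibre : ∀ i {k l} → μ i k ≡ μ i l → k ≡ l ⊎ (k ≡ i × l ≡ suc i) ⊎ (k ≡ suc i × l ≡ i)
μ-fibre zero    {zero}  {zero}  eq   = inj₁ refl
μ-fibre zero    {zero}  {suc l} refl = inj₂ (inj₁ (refl , refl))
μ-fibre zero    {suc k} {zero}  refl = inj₂ (inj₂ (refl , refl))
μ-fibre zero    {suc k} {suc l} eq   = inj₁ (cong suc eq)
μ-fibre (suc i) {zero}  {zero}  eq   = inj₁ refl
μ-fibre (suc i) {suc k} {suc l} eq with μ-fibre i (ℕ.suc-injective eq)
... | inj₁ p                    = inj₁ (cong suc p)
... | inj₂ (inj₁ (p , q))       = inj₂ (inj₁ (cong suc p , cong suc q))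
... | inj₂ (inj₂ (p , q))       = inj₂ (inj₂ (cong suc p , cong suc q))

-- The inequality σ⁻¹ i < σ⁻¹ (i + 1), phrased without an inverse of `σ`.
Ascent : (ℕ → ℕ) → ℕ → Set
Ascent σ i = ∀ k l → σ k ≡ i → σ l ≡ suc i → k < l

SwapAt-sym : ∀ {i xs ys} → SwapAt i xs ys → SwapAt i ys xs
SwapAt-sym here      = here
SwapAt-sym (there s) = there (SwapAt-sym s)

SwapAt-sum : ∀ {i xs ys} → SwapAt i xs ys → sum xs ≡ sum ys
SwapAt-sum (here {a} {b} {xs}) = trans (sym (ℕ.+-assoc a b (sum xs)))
  (trans (cong (_+ sum xs) (ℕ.+-comm a b)) (ℕ.+-assoc b a (sum xs)))
SwapAt-sum (there {a = a} s)   = cong (a +_) (SwapAt-sum s)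

SwapAt-positive : ∀ {i xs ys} → SwapAt i xs ys → All (0 <_) xs → All (0 <_) ys
SwapAt-positive here      (p ∷ q ∷ ps) = q ∷ p ∷ ps
SwapAt-positive (there s) (p ∷ ps)     = p ∷ SwapAt-positive s ps

SwapAt-bound : ∀ {i xs ys} → SwapAt i xs ys → suc i < length xs
SwapAt-bound here      = s≤s (s≤s z≤n)
SwapAt-bound (there s) = s≤s (SwapAt-bound s)

SwapAt-exists : ∀ {i xs} → suc i < length xs → ∃ λ ys → SwapAt i xs ys
SwapAt-exists {zero}  {a ∷ b ∷ xs} _        = _ , here
SwapAt-exists {zero}  {a ∷ []}     (s≤s ())
SwapAt-exists {suc i} {a ∷ xs}     (s≤s lt) with ys , s ← SwapAt-exists {i} {xs} lt = _ , there s

-- Merging the two exchanged parts gives the same list on both sides, as a + b = b + a.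
blockOf-μ : ∀ {i xs ys} → SwapAt i xs ys → ∀ x → μ i (blockOf xs x) ≡ μ i (blockOf ys x)
blockOf-μ (there {a = a} {xs} {ys} s) x with cut a x
... | below lt rewrite blockOf-below xs lt | blockOf-below ys lt = refl
... | above y  rewrite blockOf-above a xs y | blockOf-above a ys y = cong suc (blockOf-μ s y)
blockOf-μ (here {a} {b} {xs}) x = trans (merged a b x) (sym (trans (merged b a x)
    (cong (λ m → blockOf (m ∷ xs) x) (ℕ.+-comm b a))))
  where
  merged : ∀ a b x → μ 0 (blockOf (a ∷ b ∷ xs) x) ≡ blockOf (a + b ∷ xs) x
  merged a b x with cut a x
  ... | below lt rewrite blockOf-below (b ∷ xs) lt | blockOf-below xs (ℕ.≤-trans lt (ℕ.m≤m+n a b)) = refl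
  ... | above y  rewrite blockOf-above a (b ∷ xs) y with cut b y
  ...   | below lt rewrite blockOf-below xs lt | blockOf-below xs (ℕ.+-monoʳ-< a lt) = refl
  ...   | above z  rewrite blockOf-above b xs z | sym (ℕ.+-assoc a b z) | blockOf-above (a + b) xs z = refl

-- The block of size `a` moves up by `b`, the block of size `b` moves down by `a`, and every other
-- point is fixed.
exchangeBlocks : ∀ {i xs ys} → SwapAt i xs ys → ℕ → ℕ
exchangeBlocks (here {a} {b})    x = if x <ᵇ a then b + x else if x ∸ a <ᵇ b then x ∸ a else x
exchangeBlocks (there {a = a} s) x = if x <ᵇ a then x else a + exchangeBlocks s (x ∸ a)

module _ {a b : ℕ} {xs : List ℕ} where

  private
    f : ℕ → ℕ
    f = exchangeBlocks (here {a} {b} {xs})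

  here-left : ∀ {x} → x < a → f x ≡ b + x
  here-left lt rewrite <⇒<ᵇ-true lt = refl

  here-right : ∀ {y} → y < b → f (a + y) ≡ y
  here-right {y} lt rewrite +<ᵇ-false a y | ℕ.m+n∸m≡n a y | <⇒<ᵇ-true lt = refl

  here-rest : ∀ z → f (a + (b + z)) ≡ a + (b + z)
  here-rest z rewrite +<ᵇ-false a (b + z) | ℕ.m+n∸m≡n a (b + z) | +<ᵇ-false b z = refl

module _ {i a : ℕ} {xs ys : List ℕ} (s : SwapAt i xs ys) where

  there-below : ∀ {x} → x < a → exchangeBlocks (there {a = a} s) x ≡ x
  there-below lt rewrite <⇒<ᵇ-true lt = refl

  there-above : ∀ y → exchangeBlocks (there {a = a} s) (a + y) ≡ a + exchangeBlocks s y
  there-above y rewrite +<ᵇ-false a y | ℕ.m+n∸m≡n a y = refl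

+-left-comm : ∀ a b c → a + (b + c) ≡ b + (a + c)
+-left-comm a b c = trans (sym (ℕ.+-assoc a b c)) (trans (cong (_+ c) (ℕ.+-comm a b)) (ℕ.+-assoc b a c))

exchangeBlocks-< : ∀ {i xs ys} (s : SwapAt i xs ys) {x} → x < sum xs → exchangeBlocks s x < sum xs
exchangeBlocks-< (here {a} {b} {xs}) {x} x< with cut a x
... | below lt rewrite here-left {a} {b} {xs} lt = subst (b + x <_) (+-left-comm b a (sum xs))
  (ℕ.+-monoʳ-< b (ℕ.≤-trans lt (ℕ.m≤m+n a (sum xs))))
... | above y with cut b y
...   | below lt rewrite here-right {a} {b} {xs} lt = ℕ.≤-trans (ℕ.≤-trans lt (ℕ.m≤m+n b (sum xs))) (ℕ.m≤n+m _ a)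
...   | above z  rewrite here-rest {a} {b} {xs} z = x<
exchangeBlocks-< (there {a = a} {xs} s) {x} x< with cut a x
... | below lt rewrite there-below {a = a} s lt = x<
... | above y  rewrite there-above {a = a} s y =
  ℕ.+-monoʳ-< a (exchangeBlocks-< s (ℕ.+-cancelˡ-< a y (sum xs) x<))

exchangeBlocks-sym : ∀ {i xs ys} (s : SwapAt i xs ys) x → exchangeBlocks (SwapAt-sym s) (exchangeBlocks s x) ≡ x
exchangeBlocks-sym (here {a} {b} {xs}) x with cut a x
... | below lt rewrite here-left {a} {b} {xs} lt = here-right {b} {a} {xs} lt
... | above y with cut b y
...   | below lt rewrite here-right {a} {b} {xs} lt = here-left {b} {a} {xs} lt
...   | above z  rewrite here-rest {a} {b} {xs} z | +-left-comm a b z = here-rest {b} {a} {xs} z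
exchangeBlocks-sym (there {a = a} s) x with cut a x
... | below lt rewrite there-below {a = a} s lt = there-below {a = a} (SwapAt-sym s) lt
... | above y  rewrite there-above {a = a} s y | there-above {a = a} (SwapAt-sym s) (exchangeBlocks s y) =
  cong (a +_) (exchangeBlocks-sym s y)

blockOf-exchangeBlocks : ∀ {i xs ys} (s : SwapAt i xs ys) x →
                         blockOf ys (exchangeBlocks s x) ≡ τ i (blockOf xs x)
blockOf-exchangeBlocks (here {a} {b} {xs}) x with cut a x
... | below lt rewrite here-left {a} {b} {xs} lt | blockOf-below (b ∷ xs) lt
                     | blockOf-above b (a ∷ xs) x | blockOf-below xs lt = refl
... | above y rewrite blockOf-above a (b ∷ xs) y with cut b y
...   | below lt rewrite here-right {a} {b} {xs} lt | blockOf-below (a ∷ xs) lt | blockOf-below xs lt = refl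
...   | above z  rewrite here-rest {a} {b} {xs} z | blockOf-above b xs z | +-left-comm a b z
                       | blockOf-above b (a ∷ xs) (a + z) | blockOf-above a xs z = refl
blockOf-exchangeBlocks (there {a = a} {xs} {ys} s) x with cut a x
... | below lt rewrite there-below {a = a} s lt | blockOf-below xs lt | blockOf-below ys lt = refl
... | above y  rewrite there-above {a = a} s y | blockOf-above a xs y | blockOf-above a ys (exchangeBlocks s y) =
  cong suc (blockOf-exchangeBlocks s y)

exchangeBlocks-mono : ∀ {i xs ys} (s : SwapAt i xs ys) {x y} → x < y → blockOf xs x ≡ blockOf xs y →
                      exchangeBlocks s x < exchangeBlocks s y
exchangeBlocks-mono (here {a} {b} {xs}) {x} {y} x<y eq with cut a x | cut a y
... | below p | below q rewrite here-left {a} {b} {xs} p | here-left {a} {b} {xs} q = ℕ.+-monoʳ-< b x<y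
... | below p | above y′ rewrite blockOf-below (b ∷ xs) p | blockOf-above a (b ∷ xs) y′ = contradiction eq λ ()
... | above x′ | below q rewrite blockOf-below (b ∷ xs) q | blockOf-above a (b ∷ xs) x′ = contradiction eq λ ()
... | above x′ | above y′ rewrite blockOf-above a (b ∷ xs) x′ | blockOf-above a (b ∷ xs) y′ with cut b x′ | cut b y′
...   | below p | below q rewrite here-right {a} {b} {xs} p | here-right {a} {b} {xs} q = ℕ.+-cancelˡ-< a _ _ x<y
...   | below p | above y″ rewrite blockOf-below xs p | blockOf-above b xs y″ = contradiction eq λ ()
...   | above x″ | below q rewrite blockOf-below xs q | blockOf-above b xs x″ = contradiction eq λ ()
...   | above x″ | above y″ rewrite here-rest {a} {b} {xs} x″ | here-rest {a} {b} {xs} y″ = x<y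
exchangeBlocks-mono (there {a = a} {xs} s) {x} {y} x<y eq with cut a x | cut a y
... | below p | below q rewrite there-below {a = a} s p | there-below {a = a} s q = x<y
... | below p | above y′ rewrite blockOf-below xs p | blockOf-above a xs y′ = contradiction eq λ ()
... | above x′ | below q rewrite blockOf-below xs q | blockOf-above a xs x′ = contradiction eq λ ()
... | above x′ | above y′ rewrite there-above {a = a} s x′ | there-above {a = a} s y′
                                | blockOf-above a xs x′ | blockOf-above a xs y′ =
  ℕ.+-monoʳ-< a (exchangeBlocks-mono s (ℕ.+-cancelˡ-< a _ _ x<y) (ℕ.suc-injective eq))

-- Compositions and subsets

composition-≡ : ∀ {n} {c d : Composition n} → parts c ≡ parts d → c ≡ d
composition-≡ {c = c} {d} refl
  with refl ← All.irrelevant ℕ.<-irrelevant (positive c) (positive d)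
     | refl ← ℕ.≡-irrelevant (sum≡n c) (sum≡n d) = refl

does-true : ∀ {p} {P : Set p} (P? : Dec P) → does P? ≡ true → P
does-true (yes p) _ = p

module _ {n : ℕ} where

  block : Composition n → Fin n → ℕ
  block c x = blockOf (parts c) (toℕ x)

  subsetOf : Composition n → Subset (pred n)
  subsetOf c = Vec.tabulate λ i → does (block c (lo {n} i) ℕ.≟ block c (hi {n} i))

  ∈-tabulate⁺ : ∀ {m} (f : Fin m → _) {i} → f i ≡ true → i ∈ Vec.tabulate f
  ∈-tabulate⁺ f {i} eq = Vec.lookup⇒[]= i (Vec.tabulate f) (trans (Vec.lookup∘tabulate f i) eq)

  ∈-tabulate⁻ : ∀ {m} (f : Fin m → _) {i} → i ∈ Vec.tabulate f → f i ≡ true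
  ∈-tabulate⁻ f {i} i∈ = trans (sym (Vec.lookup∘tabulate f i)) (Vec.[]=⇒lookup i∈)

  ∈subsetOf⁺ : ∀ c {i} → block c (lo {n} i) ≡ block c (hi {n} i) → i ∈ subsetOf c
  ∈subsetOf⁺ c {i} eq = ∈-tabulate⁺ _ (dec-true (block c (lo {n} i) ℕ.≟ block c (hi {n} i)) eq)

  ∈subsetOf⁻ : ∀ c {i} → i ∈ subsetOf c → block c (lo {n} i) ≡ block c (hi {n} i)
  ∈subsetOf⁻ c {i} i∈ = does-true (block c (lo {n} i) ℕ.≟ block c (hi {n} i)) (∈-tabulate⁻ _ i∈)

  block-hi : ∀ c i → block c (hi {n} i) ≡ block c (lo {n} i) ⊎ block c (hi {n} i) ≡ suc (block c (lo {n} i))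
  block-hi c i rewrite toℕ-hi {n} i = blockOf-suc (positive c) (toℕ (lo {n} i))

  block-onto : ∀ c {k} → k < length (parts c) → ∃ λ x → block c x ≡ k
  block-onto c lt with x , x< , eq ← blockOf-onto (positive c) lt =
    fromℕ< x<n , trans (cong (blockOf (parts c)) (Fin.toℕ-fromℕ< x<n)) eq
    where x<n = subst (x <_) (sum≡n c) x<

  block-< : ∀ c x → block c x < length (parts c)
  block-< c x = blockOf-< (parts c) (subst (toℕ x <_) (sym (sum≡n c)) (Fin.toℕ<n x))

  first-or-hi : ∀ {n} (x : Fin n) → toℕ x ≡ 0 ⊎ ∃ λ i → hi {n} i ≡ x
  first-or-hi zero    = inj₁ refl
  first-or-hi (suc i) = inj₂ (i , refl)

  lab-zero : ∀ {n} (J : Subset (pred n)) (x : Fin n) → toℕ x ≡ 0 → lab J x ≡ 0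
  lab-zero J zero _ = refl

  -- Both functions start at 0 and rise by at most one from a point to the next, at the same places.
  lab-subsetOf : ∀ c x → lab (subsetOf c) x ≡ block c x
  lab-subsetOf c x = go (toℕ x) x ℕ.≤-refl
    where
    go : ∀ k (x : Fin n) → toℕ x ≤ k → lab (subsetOf c) x ≡ block c x
    go k x x≤k with first-or-hi x
    ... | inj₁ x≡0 = trans (lab-zero (subsetOf c) x x≡0)
                       (trans (sym (blockOf-zero (positive c))) (cong (blockOf (parts c)) (sym x≡0)))
    go zero    x x≤k | inj₂ (i , refl) = contradiction (subst (_≤ 0) (toℕ-hi {n} i) x≤k) λ ()
    go (suc k) x x≤k | inj₂ (i , refl) with block-hi c i
    ... | inj₁ eq = trans (sym (lab-step {n} (subsetOf c) (∈subsetOf⁺ c (sym eq))))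
                      (trans (go k (lo {n} i) (ℕ.≤-pred (subst (_≤ suc k) (toℕ-hi {n} i) x≤k))) (sym eq))
    ... | inj₂ eq = trans (lab-gap {n} (subsetOf c) (λ i∈ → contradiction (trans (∈subsetOf⁻ c i∈) eq)
                        (ℕ.<⇒≢ ℕ.≤-refl)))
                      (trans (cong suc (go k (lo {n} i) (ℕ.≤-pred (subst (_≤ suc k) (toℕ-hi {n} i) x≤k)))) (sym eq))

  subset-≡ : (J J′ : Subset (pred n)) → (∀ x → lab {n} J x ≡ lab J′ x) → J ≡ J′
  subset-≡ J J′ eq = ⊆-antisym (λ {i} → ⊆ J J′ eq) (λ {i} → ⊆ J′ J (λ x → sym (eq x)))
    where
    ⊆ : (J J′ : Subset (pred n)) → (∀ x → lab {n} J x ≡ lab J′ x) → ∀ {i} → i ∈ J → i ∈ J′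
    ⊆ J J′ eq {i} i∈J = lab-≡⇒∈ {n} J′ (trans (sym (eq (lo {n} i))) (trans (lab-step {n} J i∈J) (eq (hi {n} i))))

  subsetOf-injective : ∀ {c d} → subsetOf c ≡ subsetOf d → c ≡ d
  subsetOf-injective {c} {d} eq = composition-≡ (blockOf-injective (positive c) (positive d)
    (trans (sum≡n c) (sym (sum≡n d))) λ {x} x< →
      let x<n = subst (x <_) (sum≡n c) x< ; y = fromℕ< x<n
          toℕ-y = Fin.toℕ-fromℕ< x<n in
      subst (λ x → blockOf (parts c) x ≡ blockOf (parts d) x) toℕ-y
        (trans (sym (lab-subsetOf c y)) (trans (cong (λ J → lab J y) eq) (lab-subsetOf d y))))

  ↔ˢ-subsetOf : ∀ c → c ↔ˢ subsetOf c
  ↔ˢ-subsetOf c w = mk⇔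
    (λ w∈ x → trans (sym (lab-subsetOf c (w ⟨$⟩ʳ x))) (trans (∈W⇒lab (subsetOf c) w w∈ x) (lab-subsetOf c x)))
    (λ w∈ → lab⇒∈W (subsetOf c) w λ x →
      trans (lab-subsetOf c (w ⟨$⟩ʳ x)) (trans (w∈ x) (sym (lab-subsetOf c x))))

-- The composition of J has parts 1 + k, ks where blocks J = (k , ks).

blocks : ∀ {m} → Subset m → ℕ × List ℕ
blocks []          = 0 , []
blocks (true  ∷ J) = suc (proj₁ (blocks J)) , proj₂ (blocks J)
blocks (false ∷ J) = 0 , suc (proj₁ (blocks J)) ∷ proj₂ (blocks J)

blocks-sum : ∀ {m} (J : Subset m) → proj₁ (blocks J) + sum (proj₂ (blocks J)) ≡ m
blocks-sum []          = refl
blocks-sum (true  ∷ J) = cong suc (blocks-sum J)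
blocks-sum (false ∷ J) = cong suc (blocks-sum J)

blocks-positive : ∀ {m} (J : Subset m) → All (0 <_) (proj₂ (blocks J))
blocks-positive []          = []
blocks-positive (true  ∷ J) = blocks-positive J
blocks-positive (false ∷ J) = s≤s z≤n ∷ blocks-positive J

label-blocks : ∀ {m} (J : Subset m) x → label J x ≡ blockOf (suc (proj₁ (blocks J)) ∷ proj₂ (blocks J)) (toℕ x)
label-blocks J           zero    = refl
label-blocks (true  ∷ J) (suc x) = label-blocks J x
label-blocks (false ∷ J) (suc x) = cong suc (label-blocks J x)

compositionOf : ∀ {n} → Subset (pred n) → Composition n
compositionOf {zero}  J = record { parts = [] ; positive = [] ; sum≡n = refl }
compositionOf {suc m} J = record
  { parts    = suc (proj₁ (blocks J)) ∷ proj₂ (blocks J)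
  ; positive = s≤s z≤n ∷ blocks-positive J
  ; sum≡n    = cong suc (blocks-sum J) }

subsetOf-compositionOf : ∀ {n} (J : Subset (pred n)) → subsetOf (compositionOf {n} J) ≡ J
subsetOf-compositionOf {n} J = subset-≡ {n} (subsetOf (compositionOf {n} J)) J λ x → trans (lab-subsetOf (compositionOf {n} J) x) (sym (labels {n} J x))
  where
  labels : ∀ {n} (J : Subset (pred n)) (x : Fin n) → lab J x ≡ block (compositionOf {n} J) x
  labels {suc m} J x = label-blocks J x

subsetOf-bijective : ∀ {n} → Bijective _≡_ _≡_ (subsetOf {n})
subsetOf-bijective {n} = subsetOf-injective , λ J → compositionOf {n} J , λ { refl → subsetOf-compositionOf {n} J }

-- Block permutations

module _ {n : ℕ} where

  module _ (c : Composition n) where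

    block⇒lab : ∀ {x y} → block c x ≡ block c y → lab (subsetOf c) x ≡ lab (subsetOf c) y
    block⇒lab {x} {y} eq = trans (lab-subsetOf c x) (trans eq (sym (lab-subsetOf c y)))

    lab⇒block : ∀ {x y} → lab (subsetOf c) x ≡ lab (subsetOf c) y → block c x ≡ block c y
    lab⇒block {x} {y} eq = trans (sym (lab-subsetOf c x)) (trans eq (lab-subsetOf c y))

    block-mono : ∀ {x y : Fin n} → x ≺ y → block c x ≤ block c y
    block-mono {x} {y} x≺y = subst₂ _≤_ (lab-subsetOf c x) (lab-subsetOf c y)
      (lab-mono (subsetOf c) (ℕ.<⇒≤ x≺y))

    block-<⇒≺ : ∀ {x y} → block c x < block c y → x ≺ y
    block-<⇒≺ {x} {y} lt = lab-<⇒≺ (subsetOf c)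
      (subst₂ _<_ (sym (lab-subsetOf c x)) (sym (lab-subsetOf c y)) lt)

    reversal : W n
    reversal = w₀ (subsetOf c)

    reversal-block : ∀ x → block c (reversal ⟨$⟩ʳ x) ≡ block c x
    reversal-block x = lab⇒block (w₀-lab (subsetOf c) x)

    reversal-decreasing : ∀ {x y} → x ≺ y → block c x ≡ block c y → reversal ⟨$⟩ʳ y ≺ reversal ⟨$⟩ʳ x
    reversal-decreasing x≺y eq = w₀-decreasing (subsetOf c) x≺y (block⇒lab eq)

  -- Being increasing on blocks selects one representative of the double coset. `reflects` expresses
  -- injectivity of `σ` on the indices of actual blocks, the only ones on which `σ` is constrained.
  record BlockPermutation (c d : Composition n) (σ : ℕ → ℕ) (b : W n) : Set where
    field
      blocks-to  : ∀ x → block d (b ⟨$⟩ʳ x) ≡ σ (block c x)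
      reflects   : ∀ {x y} → block d (b ⟨$⟩ʳ x) ≡ block d (b ⟨$⟩ʳ y) → block c x ≡ block c y
      increasing : ∀ {x y} → x ≺ y → block c x ≡ block c y → b ⟨$⟩ʳ x ≺ b ⟨$⟩ʳ y

  open BlockPermutation public

  blockCoset : (c d : Composition n) → W n → Coset n (subsetOf d) (subsetOf c)
  blockCoset c d b = ⟪ b ⟫

  ε-blockPermutation : ∀ {c} → BlockPermutation c c (λ k → k) ε
  ε-blockPermutation = record
    { blocks-to = λ _ → refl ; reflects = λ eq → eq ; increasing = λ x≺y _ → x≺y }

  ·-blockPermutation : ∀ {c d e σ ρ a b} → BlockPermutation d e ρ a → BlockPermutation c d σ b →
                       BlockPermutation c e (ρ ∘ σ) (a · b)
  ·-blockPermutation {σ = σ} {ρ} A B = record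
    { blocks-to  = λ x → trans (blocks-to A _) (cong ρ (blocks-to B x))
    ; reflects   = λ eq → reflects B (reflects A eq)
    ; increasing = λ x≺y eq → increasing A (increasing B x≺y eq)
        (trans (blocks-to B _) (trans (cong σ eq) (sym (blocks-to B _)))) }

  blockPermutation-unique : ∀ {c d σ ρ a b} → BlockPermutation c d σ a → BlockPermutation c d ρ b →
                            (∀ x → σ (block c x) ≡ ρ (block c x)) → a ≈ b
  blockPermutation-unique {c} {d} {σ} {ρ} {a} {b} A B eq x =
    trans (sym (increasing⇒ε (subsetOf d) (b · a ⁻¹)
      (lab⇒∈W (subsetOf d) (b · a ⁻¹) (λ x → block⇒lab d (same x)))
      inc (a ⟨$⟩ʳ x)))
      (cong (b ⟨$⟩ʳ_) (Perm.inverseˡ a))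
    where
    same : ∀ x → block d (b ⟨$⟩ʳ (a ⟨$⟩ˡ x)) ≡ block d x
    same x = trans (blocks-to B _) (trans (sym (eq _)) (trans (sym (blocks-to A _)) (cong (block d) (Perm.inverseʳ a))))
    a⁻¹-same : ∀ {x y} → block d x ≡ block d y → block c (a ⟨$⟩ˡ x) ≡ block c (a ⟨$⟩ˡ y)
    a⁻¹-same p = reflects A (trans (cong (block d) (Perm.inverseʳ a)) (trans p (cong (block d) (sym (Perm.inverseʳ a)))))
    inc : Increasing (subsetOf d) (b · a ⁻¹)
    inc {x} {y} x≺y p = increasing B (≺-by-contradiction
      (λ q → contradiction x≺y (Fin.<-irrefl {n} (injective (a ⁻¹) q)))
      (λ gt → contradiction x≺y (Fin.<-asym {n} (subst₂ _≺_ (Perm.inverseʳ a) (Perm.inverseʳ a)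
        (increasing A gt (sym (a⁻¹-same (lab⇒block d p))))))))
      (a⁻¹-same (lab⇒block d p))

  -- The outer factors from the parabolic subgroups preserve block indices, so the permutation of
  -- the blocks is an invariant of the double coset.
  blockCoset-injective : ∀ {c d σ ρ a b} → BlockPermutation c d σ a → BlockPermutation c d ρ b →
                         blockCoset c d a ≈ᶜ blockCoset c d b → ∀ x → σ (block c x) ≡ ρ (block c x)
  blockCoset-injective {c} {d} {σ} {ρ} {a} {b} A B (l , r , l∈ , r∈ , eq) x =
    trans (sym (blocks-to A x)) (trans (cong (block d) (eq x))
      (trans (lab⇒block d (∈W⇒lab (subsetOf d) l l∈ _))
        (trans (blocks-to B _) (cong ρ (lab⇒block c (∈W⇒lab (subsetOf c) r r∈ x))))))

  -- Since `b` matches the blocks of `c` with those of `d`, reversing the blocks once produces the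
  -- full descents on both sides.
  max-blockCoset : ∀ {c d σ b} → BlockPermutation c d σ b → max (blockCoset c d b) ≈ b · reversal c
  max-blockCoset {c} {d} {σ} {b} B = max-unique (blockCoset c d b) (b · reversal c)
    ((λ x≺y eq → decreasing x≺y (lab⇒block c eq)) , inverse-decreasing)
    (ε , reversal c , ∈W-ε , w₀∈W (subsetOf c) , λ _ → refl)
    where
    m : W n
    m = b · reversal c
    decreasing : ∀ {x y} → x ≺ y → block c x ≡ block c y → m ⟨$⟩ʳ y ≺ m ⟨$⟩ʳ x
    decreasing {x} {y} x≺y eq = increasing B (reversal-decreasing c x≺y eq)
      (trans (reversal-block c y) (trans (sym eq) (sym (reversal-block c x))))
    m-reflects : ∀ {x y} → block d (m ⟨$⟩ʳ x) ≡ block d (m ⟨$⟩ʳ y) → block c x ≡ block c y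
    m-reflects {x} {y} eq = trans (sym (reversal-block c x)) (trans (reflects B eq) (reversal-block c y))
    inverse-decreasing : Decreasing (subsetOf d) (m ⁻¹)
    inverse-decreasing {x} {y} x≺y eq = ≺-by-contradiction
      (λ q → contradiction x≺y (Fin.<-irrefl {n} (sym (injective (m ⁻¹) q))))
      (λ lt → contradiction x≺y (Fin.<-asym {n} (subst₂ _≺_ (Perm.inverseʳ m) (Perm.inverseʳ m)
        (decreasing lt (m-reflects (trans (cong (block d) (Perm.inverseʳ m))
          (trans (lab⇒block d eq) (cong (block d) (sym (Perm.inverseʳ m))))))))))

  module _ {c d e : Composition n} {σ : ℕ → ℕ} {i : ℕ} {a b : W n}
           (A : BlockPermutation d e (τ i) a) (B : BlockPermutation c d σ b) where

    private
      p : Coset n (subsetOf e) (subsetOf d)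
      p = blockCoset d e a
      q : Coset n (subsetOf d) (subsetOf c)
      q = blockCoset c d b
      m : W n
      m = b · reversal c

      ⊙≈ : p ⊙ q ≈ a · m
      ⊙≈ x = trans (max-blockCoset A _) (cong (a ⟨$⟩ʳ_)
        (trans (Perm.inverseʳ (reversal d)) (max-blockCoset B x)))

      a-length : ℓ a + ℓ (reversal d) ≡ ℓ (max p)
      a-length = trans (cong (_+ ℓ (reversal d))
          (ℓ-cong a (max p · reversal d ⁻¹) λ x → sym (trans (max-blockCoset A _)
            (cong (a ⟨$⟩ʳ_) (Perm.inverseʳ (reversal d))))))
        (ℓ-·w₀ (subsetOf d) (max p) (proj₁ (max-full p)))

      m-block : ∀ x → block d (m ⟨$⟩ʳ x) ≡ σ (block c x)
      m-block x = trans (blocks-to B _) (cong σ (reversal-block c x))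

      rearrange : ∀ x y z → x + y + z ≡ x + z + y
      rearrange x y z = trans (ℕ.+-assoc x y z) (trans (cong (x +_) (ℕ.+-comm y z)) (sym (ℕ.+-assoc x z y)))

    -- The factor `a` is increasing on blocks and reverses only the order of blocks `i` and `i + 1`.
    -- By the ascent no pair inverted by `m` arrives there in that order, so nothing is restored.
    blockCoset-∘ : Ascent σ i → ∂ p ∘ᴰ ∂ q ≈ᴰ ∂ (blockCoset c e (a · b))
    blockCoset-∘ asc = ≈-trans (∂∘∂-additive p q additive)
      (∂-cong (ε , reversal c , ∈W-ε , w₀∈W (subsetOf c) , ⊙≈))
      where
      noCancellation : NoCancellation a m
      noCancellation {x} {y} x≺y inv with ℕ.m≤n⇒m<n∨m≡n (block-mono d inv)
      ... | inj₂ eq = increasing A inv eq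
      ... | inj₁ lt with τ-mono i lt
      ...   | inj₂ lt′ = block-<⇒≺ e (subst₂ _<_ (sym (blocks-to A _)) (sym (blocks-to A _)) lt′)
      ...   | inj₁ (eq , eq′) = contradiction x≺y (Fin.<-asym {n} (block-<⇒≺ c
                (asc (block c y) (block c x) (trans (sym (m-block y)) eq) (trans (sym (m-block x)) eq′))))
      additive : Additive p q
      additive = trans
        (cong (_+ ℓ (reversal d)) (trans (ℓ-cong (p ⊙ q) (a · m) ⊙≈) (ℓ-additive a m noCancellation)))
        (trans (rearrange (ℓ a) (ℓ m) (ℓ (reversal d)))
          (cong₂ _+_ a-length (sym (ℓ-cong (max q) m (max-blockCoset B)))))

    blockCoset-∘-zero : ∀ x y → σ (block c x) ≡ i → σ (block c y) ≡ suc i → block c y < block c x →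
                        ∂ p ∘ᴰ ∂ q ≈ᴰ 𝟘
    blockCoset-∘-zero x y eq eq′ lt = ∂∘∂-zero p q λ add →
      let add′ = ℕ.+-cancelʳ-≡ (ℓ (reversal d)) (ℓ (a · m)) (ℓ a + ℓ m)
            (trans (cong (_+ ℓ (reversal d)) (sym (ℓ-cong (p ⊙ q) (a · m) ⊙≈)))
              (trans add (trans (cong₂ _+_ (sym a-length) (ℓ-cong (max q) m (max-blockCoset B)))
                (rearrange (ℓ a) (ℓ (reversal d)) (ℓ m)))))
      in contradiction
        (ℓ-additive⁻¹ a m add′ (block-<⇒≺ c lt) (block-<⇒≺ d
          (subst₂ _<_ (sym (trans (m-block x) eq)) (sym (trans (m-block y) eq′)) ℕ.≤-refl)))
        (Fin.<-asym {n} (block-<⇒≺ e (subst₂ _<_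
          (sym (trans (blocks-to A _) (trans (cong (τ i) (trans (m-block y) eq′)) (τ-right i))))
          (sym (trans (blocks-to A _) (trans (cong (τ i) (trans (m-block x) eq)) (τ-left i)))) ℕ.≤-refl)))

  module _ {c d : Composition n} {i : ℕ} (s : SwapAt i (parts c) (parts d)) where

    private
      to-< : ∀ (x : Fin n) → exchangeBlocks s (toℕ x) < n
      to-< x = subst (exchangeBlocks s (toℕ x) <_) (sum≡n c)
        (exchangeBlocks-< s (subst (toℕ x <_) (sym (sum≡n c)) (Fin.toℕ<n x)))
      from-< : ∀ (x : Fin n) → exchangeBlocks (SwapAt-sym s) (toℕ x) < n
      from-< x = subst (exchangeBlocks (SwapAt-sym s) (toℕ x) <_) (sum≡n d)
        (exchangeBlocks-< (SwapAt-sym s) (subst (toℕ x <_) (sym (sum≡n d)) (Fin.toℕ<n x)))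

    swapPermutation : W n
    swapPermutation = Perm.permutation (λ x → fromℕ< (to-< x)) (λ x → fromℕ< (from-< x))
      (λ x → Fin.toℕ-injective (trans (Fin.toℕ-fromℕ< _) (trans
        (cong (exchangeBlocks s) (Fin.toℕ-fromℕ< _)) (sym-sym s (toℕ x)))))
      (λ x → Fin.toℕ-injective (trans (Fin.toℕ-fromℕ< _) (trans
        (cong (exchangeBlocks (SwapAt-sym s)) (Fin.toℕ-fromℕ< _)) (exchangeBlocks-sym s (toℕ x)))))
      where
      SwapAt-sym-sym : ∀ {i xs ys} (s : SwapAt i xs ys) → SwapAt-sym (SwapAt-sym s) ≡ s
      SwapAt-sym-sym here      = refl
      SwapAt-sym-sym (there s) = cong there (SwapAt-sym-sym s)
      sym-sym : ∀ {i xs ys} (s : SwapAt i xs ys) x → exchangeBlocks s (exchangeBlocks (SwapAt-sym s) x) ≡ x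
      sym-sym s x = trans (cong (λ t → exchangeBlocks t (exchangeBlocks (SwapAt-sym s) x)) (sym (SwapAt-sym-sym s)))
                          (exchangeBlocks-sym (SwapAt-sym s) x)

    swap-blockPermutation : BlockPermutation c d (τ i) swapPermutation
    swap-blockPermutation = record
      { blocks-to  = to
      ; reflects   = λ {x} {y} eq → τ-injective i (trans (sym (to x)) (trans eq (to y)))
      ; increasing = λ x≺y eq → subst₂ _<_ (sym (Fin.toℕ-fromℕ< _)) (sym (Fin.toℕ-fromℕ< _))
                       (exchangeBlocks-mono s x≺y eq) }
      where
      to : ∀ x → block d (swapPermutation ⟨$⟩ʳ x) ≡ τ i (block c x)
      to x = trans (cong (blockOf (parts d)) (Fin.toℕ-fromℕ< _)) (blockOf-exchangeBlocks s (toℕ x))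

-- Atomic cosets

-- A relational lookup: it can be inverted through `map` without moving an index along an equality
-- of lengths.
data At {A : Set} : ℕ → List A → A → Set where
  here  : ∀ {x xs} → At 0 (x ∷ xs) x
  there : ∀ {i x y xs} → At i xs y → At (suc i) (x ∷ xs) y

at-lookup : ∀ {A : Set} (xs : List A) i → At (toℕ i) xs (lookup xs i)
at-lookup (x ∷ xs) zero    = here
at-lookup (x ∷ xs) (suc i) = there (at-lookup xs i)

at-map : ∀ {A B : Set} (f : A → B) {i} xs {y} → At i (map f xs) y → ∃ λ x → At i xs x × y ≡ f x
at-map f (x ∷ xs) here      = x , here , refl
at-map f (x ∷ xs) (there p) with z , q , eq ← at-map f xs p = z , there q , eq

gaps′ : ∀ {m} → Subset m → List (Fin m)
gaps′ {m} J = filter (λ s → ¬? (s ∈? J)) (allFin m)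

filter-map-suc : ∀ {m b} (J : Subset m) xs →
                 filter (λ s → ¬? (s ∈? (b ∷ J))) (map suc xs) ≡ map suc (filter (λ s → ¬? (s ∈? J)) xs)
filter-map-suc {b = b} J []       = refl
filter-map-suc {b = b} J (x ∷ xs) with x ∈? J
... | yes _ = filter-map-suc J xs
... | no  _ = cong (suc x ∷_) (filter-map-suc J xs)

-- `label` counts the gaps already passed, and before the gap of 0-based index `i` there are `i` of
-- them. This ties the numbering of the d_i to that of the blocks.
gap-rank : ∀ {m} (J : Subset m) {i s} → At i (gaps′ J) s → label J (inject₁ s) ≡ i
gap-rank {suc m} (true ∷ J) {i} {s} p
  with s′ , q , refl ← at-map suc (gaps′ J) (subst (λ xs → At i xs s)
         (trans (cong (filter _) (sym (List.map-tabulate (λ x → x) suc))) (filter-map-suc J (allFin m))) p)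
  = gap-rank J q
gap-rank {suc m} (false ∷ J) {zero}  here = refl
gap-rank {suc m} (false ∷ J) {suc i} {s} (there p)
  with s′ , q , refl ← at-map suc (gaps′ J) (subst (λ xs → At i xs s)
         (trans (cong (filter _) (sym (List.map-tabulate (λ x → x) suc))) (filter-map-suc J (allFin m))) p)
  = cong suc (gap-rank J q)

lab-⊆ : ∀ {n} (J M : Subset (pred n)) → J ⊆ M → ∀ {x y : Fin n} → lab J x ≡ lab J y → lab M x ≡ lab M y
lab-⊆ {n} J M J⊆M {x} {y} eq with Fin.<-cmp x y
... | tri< x≺y _ _  = block-induction J (λ x y → lab M x ≡ lab M y) trans (λ i∈J → lab-step {n} M (J⊆M i∈J)) x≺y eq
... | tri≈ _ refl _ = refl
... | tri> _ _ y≺x  = sym (block-induction J (λ x y → lab M x ≡ lab M y) trans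
                        (λ i∈J → lab-step {n} M (J⊆M i∈J)) y≺x (sym eq))

module _ {n : ℕ} (c : Composition n) where

  private
    J : Subset (pred n)
    J = subsetOf c

  gap-block : (j : Fin (length (gaps {n} J))) → block c (lo {n} (lookup (gaps {n} J) j)) ≡ toℕ j
  gap-block j = trans (sym (lab-subsetOf c _)) (rank n J j)
    where
    rank : ∀ n (J : Subset (pred n)) (j : Fin (length (gaps {n} J))) →
           lab J (lo {n} (lookup (gaps {n} J) j)) ≡ toℕ j
    rank (suc m) J j = gap-rank J (at-lookup (gaps′ J) j)

  gap∉ : (j : Fin (length (gaps {n} J))) → lookup (gaps {n} J) j ∉ J
  gap∉ j = proj₂ (∈-filter⁻ (λ s → ¬? (s ∈? J)) {xs = allFin (pred n)} (∈-lookup j))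

  gap-block-hi : (j : Fin (length (gaps {n} J))) → block c (hi {n} (lookup (gaps {n} J) j)) ≡ suc (toℕ j)
  gap-block-hi j = trans (sym (lab-subsetOf c _)) (trans (lab-gap {n} J (gap∉ j))
    (cong suc (trans (lab-subsetOf c _) (gap-block j))))

  ∉⇒gap : ∀ {s} → s ∉ J → ∃ λ j → lookup (gaps {n} J) j ≡ s
  ∉⇒gap {s} s∉ = Any.index s∈gaps , sym (lookup-index s∈gaps)
    where
    s∈gaps : Any (s ≡_) (gaps {n} J)
    s∈gaps = ∈-filter⁺ (λ s → ¬? (s ∈? J)) (∈-allFin s) s∉

  -- Walking down from a point of block `i + 1`, the index drops by at most one per step; `s` is the
  -- place of the first drop.
  block-end : ∀ {i} → suc i < length (parts c) → ∃ λ (s : S n) → block c (lo {n} s) ≡ i × block c (hi {n} s) ≡ suc i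
  block-end {i} lt with x , eq ← block-onto c lt = go (toℕ x) x ℕ.≤-refl eq
    where
    go : ∀ k (x : Fin n) → toℕ x ≤ k → block c x ≡ suc i →
         ∃ λ (s : S n) → block c (lo {n} s) ≡ i × block c (hi {n} s) ≡ suc i
    go k x x≤k eq with first-or-hi {n} x
    ... | inj₁ x≡0 = contradiction (trans (sym eq) (trans (sym (lab-subsetOf c x)) (lab-zero {n} J x x≡0))) λ ()
    go zero    x x≤k eq | inj₂ (s , refl) = contradiction (subst (_≤ 0) (toℕ-hi {n} s) x≤k) λ ()
    go (suc k) x x≤k eq | inj₂ (s , refl) with block-hi c s
    ... | inj₁ same = go k (lo {n} s) (ℕ.≤-pred (subst (_≤ suc k) (toℕ-hi {n} s) x≤k)) (trans (sym same) eq)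
    ... | inj₂ step = s , ℕ.suc-injective (trans (sym step) eq) , eq

  gap-exists : ∀ {i} → suc i < length (parts c) → ∃ λ (j : Fin (length (gaps {n} J))) → toℕ j ≡ i
  gap-exists lt with s , eq , eq′ ← block-end lt
    with j , refl ← ∉⇒gap (λ s∈J → contradiction (trans (sym (∈subsetOf⁻ c s∈J)) eq)
                       (λ p → ℕ.<⇒≢ ℕ.≤-refl (trans (sym p) eq′)))
    = j , trans (sym (gap-block j)) eq

  gap-bound : (j : Fin (length (gaps {n} J))) → suc (toℕ j) < length (parts c)
  gap-bound j = subst (_< length (parts c)) (gap-block-hi j) (block-< c _)

module Atomic {n : ℕ} (c d : Composition n) (j : Fin (length (gaps {n} (subsetOf c))))
              (σ : SwapAt (toℕ j) (parts c) (parts d)) where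

  private
    J M : Subset (pred n)
    J = subsetOf c
    M = atomicM {n} J j
    s : S n
    s = lookup (gaps {n} J) j
    i : ℕ
    i = toℕ j
    w b : W n
    w = w₀ M
    b = swapPermutation {c = c} {d} σ
    B : BlockPermutation c d (τ i) b
    B = swap-blockPermutation σ

    lo-s : block c (lo {n} s) ≡ i
    lo-s = gap-block c j
    hi-s : block c (hi {n} s) ≡ suc i
    hi-s = gap-block-hi c j

    J⊆M : J ⊆ M
    J⊆M = p⊆p∪q ⁅ s ⁆
    s∈M : s ∈ M
    s∈M = q⊆p∪q J ⁅ s ⁆ (x∈⁅x⁆ s)

    block⇒labM : ∀ {x y} → block c x ≡ block c y → lab M x ≡ lab M y
    block⇒labM eq = lab-⊆ {n} J M J⊆M (block⇒lab c eq)

    merged⇒labM : ∀ {x y} → block c x ≡ i → block c y ≡ suc i → lab M x ≡ lab M y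
    merged⇒labM p q = trans (block⇒labM (trans p (sym lo-s)))
      (trans (lab-step {n} M s∈M) (block⇒labM (trans hi-s (sym q))))

    -- Adjoining `s` to J joins the blocks `i` and `i + 1` and no others, so the blocks of M are the
    -- fibres of `μ i` composed with `block c`.
    μ⇒labM : ∀ {x y} → μ i (block c x) ≡ μ i (block c y) → lab M x ≡ lab M y
    μ⇒labM eq with μ-fibre i eq
    ... | inj₁ p              = block⇒labM p
    ... | inj₂ (inj₁ (p , q)) = merged⇒labM p q
    ... | inj₂ (inj₂ (p , q)) = sym (merged⇒labM q p)

    labM⇒μ : ∀ {x y} → x ≺ y → lab M x ≡ lab M y → μ i (block c x) ≡ μ i (block c y)
    labM⇒μ = block-induction M (λ x y → μ i (block c x) ≡ μ i (block c y)) trans step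
      where
      step : ∀ {r} → r ∈ M → μ i (block c (lo {n} r)) ≡ μ i (block c (hi {n} r))
      step {r} r∈M with x∈p∪q⁻ J ⁅ s ⁆ r∈M
      ... | inj₁ r∈J = cong (μ i) (∈subsetOf⁻ c r∈J)
      ... | inj₂ r∈s with refl ← x∈⁅y⁆⇒x≡y s r∈s = trans (cong (μ i) lo-s) (trans (μ-step i) (cong (μ i) (sym hi-s)))

    labM-≺ : ∀ {x y} → x ≺ y → lab M x ≡ lab M y → block c x ≡ block c y ⊎ (block c x ≡ i × block c y ≡ suc i)
    labM-≺ x≺y eq with μ-fibre i (labM⇒μ x≺y eq)
    ... | inj₁ p              = inj₁ p
    ... | inj₂ (inj₁ pq)      = inj₂ pq
    ... | inj₂ (inj₂ (p , q)) = contradiction (subst₂ _≤_ p q (block-mono c x≺y)) (ℕ.<⇒≱ ℕ.≤-refl)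

    m : W n
    m = b · reversal c

    m∈W : m ∈W M
    m∈W = lab⇒∈W M m λ x → trans (μ⇒labM (trans (blockOf-μ σ (toℕ (b ⟨$⟩ʳ (reversal c ⟨$⟩ʳ x))))
        (trans (cong (μ i) (blocks-to B _)) (μ-τ i _))))
      (block⇒labM (reversal-block c x))

    m-decreasing : Decreasing M m
    m-decreasing {x} {y} x≺y eq with labM-≺ x≺y eq
    ... | inj₁ p       = increasing B (reversal-decreasing c x≺y p)
      (trans (reversal-block c y) (trans (sym p) (sym (reversal-block c x))))
    ... | inj₂ (p , q) = block-<⇒≺ d (subst₂ _<_
      (sym (trans (blocks-to B _) (trans (cong (τ i) (trans (reversal-block c y) q)) (τ-right i))))
      (sym (trans (blocks-to B _) (trans (cong (τ i) (trans (reversal-block c x) p)) (τ-left i)))) ℕ.≤-refl)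

  -- The right-hand side lies in W_M and is decreasing on M-blocks: it reverses each block of `c`
  -- and puts block `i + 1` before block `i`. Its quotient by `w₀ M` is then increasing on M-blocks,
  -- hence trivial.
  w≈ : w₀ M ≈ swapPermutation {c = c} {d} σ · reversal c
  w≈ x = trans (sym (increasing⇒ε M (m · w ⁻¹) (∈W-· m (w ⁻¹) m∈W (∈W-⁻¹ w (w₀∈W M)))
      (·w₀-increasing M m m-decreasing) (w ⟨$⟩ʳ x)))
    (cong (m ⟨$⟩ʳ_) (Perm.inverseˡ w))

  private
    w-block : ∀ x → block d (w ⟨$⟩ʳ x) ≡ τ i (block c x)
    w-block x = trans (cong (block d) (w≈ x)) (trans (blocks-to B _) (cong (τ i) (reversal-block c x)))

    block-w : ∀ x → block d x ≡ τ i (block c (w ⟨$⟩ʳ x))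
    block-w x = trans (cong (block d) (sym (w₀-involutive M x))) (w-block _)

    t : W n
    t = atomicT {n} J j

    t≈ : t ≈ transpose (w ⟨$⟩ʳ lo s) (w ⟨$⟩ʳ hi s)
    t≈ x = trans (cong (w ⟨$⟩ʳ_) (simple-transpose {n} s _))
      (trans (·-transpose w (lo s) (hi s) (w ⟨$⟩ʳ x))
        (cong (transpose (w ⟨$⟩ʳ lo s) (w ⟨$⟩ʳ hi s) ⟨$⟩ʳ_) (w₀-involutive M x)))

    d⇒M : ∀ {r} → r ∈ subsetOf d → r ∈ M
    d⇒M {r} r∈ = lab-≡⇒∈ {n} M (μ⇒labM (trans (blockOf-μ σ (toℕ (lo {n} r)))
      (trans (cong (μ i) (∈subsetOf⁻ d r∈)) (sym (blockOf-μ σ (toℕ (hi {n} r)))))))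

    w-lo-s : block d (w ⟨$⟩ʳ lo s) ≡ suc i
    w-lo-s = trans (w-block _) (trans (cong (τ i) lo-s) (τ-left i))
    w-hi-s : block d (w ⟨$⟩ʳ hi s) ≡ i
    w-hi-s = trans (w-block _) (trans (cong (τ i) hi-s) (τ-right i))

    -- `t` carries a point of the d-block `i` into the d-block `i + 1`, whereas W_d preserves
    -- d-blocks.
    d⇒≉t : ∀ {r} → r ∈ subsetOf d → ¬ simple {n} r ≈ t
    d⇒≉t {r} r∈ eq = ℕ.<⇒≢ (ℕ.≤-refl {suc i}) (trans (sym w-hi-s)
      (trans (sym (lab⇒block d (∈W⇒lab (subsetOf d) (simple r) (simple∈W (subsetOf d) r∈) (w ⟨$⟩ʳ hi s))))
        (trans (cong (block d) moved) w-lo-s)))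
      where
      moved : simple {n} r ⟨$⟩ʳ (w ⟨$⟩ʳ hi s) ≡ w ⟨$⟩ʳ lo s
      moved = trans (eq _) (trans (t≈ _) (transpose-right (w ⟨$⟩ʳ lo s) (w ⟨$⟩ʳ hi s)))

    module _ {r : S n} (r∈M : r ∈ M) where

      p q : Fin n
      p = w ⟨$⟩ʳ hi {n} r
      q = w ⟨$⟩ʳ lo {n} r

      wp : w ⟨$⟩ʳ p ≡ hi {n} r
      wp = w₀-involutive M (hi {n} r)
      wq : w ⟨$⟩ʳ q ≡ lo {n} r
      wq = w₀-involutive M (lo {n} r)

      p≺q : p ≺ q
      p≺q = w₀-decreasing M (lo≺hi {n} r) (lab-step {n} M r∈M)

      p~q : lab M p ≡ lab M q
      p~q = trans (w₀-lab {n} M _) (trans (sym (lab-step {n} M r∈M)) (sym (w₀-lab {n} M _)))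

      -- w p and w q are neighbours and w reverses the order of its blocks, so
      -- nothing lies between p and q.
      nothing-between : ∀ {z} → p ≺ z → z ≺ q → lab M p ≡ lab M z → lab M z ≡ lab M q → ⊥
      nothing-between {z} p≺z z≺q p~z z~q = ℕ.<⇒≱
        (subst (_≺ w ⟨$⟩ʳ z) wq (w₀-decreasing M z≺q z~q))
        (ℕ.≤-pred (subst (toℕ (w ⟨$⟩ʳ z) <_) (toℕ-hi {n} r)
          (subst (w ⟨$⟩ʳ z ≺_) wp (w₀-decreasing M p≺z p~z))))

      module _ (p-block : block c p ≡ i) (q-block : block c q ≡ suc i) where

        -- `lo s` is the last point of block `i`: a `p` before it would leave `lo s` strictly
        -- between `p` and `q`, and a `p` after it would be in a later block.
        p≡lo : p ≡ lo {n} s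
        p≡lo with Fin.<-cmp p (lo {n} s)
        ... | tri≈ _ eq _ = eq
        ... | tri< lt _ _ = ⊥-elim (nothing-between lt
                (block-<⇒≺ c (subst₂ _<_ (sym lo-s) (sym q-block) ℕ.≤-refl))
                (block⇒labM (trans p-block (sym lo-s))) (merged⇒labM lo-s q-block))
        ... | tri> _ _ gt = contradiction (subst₂ _≤_ hi-s p-block (subst₂ _≤_ (lab-subsetOf c _) (lab-subsetOf c _)
                (lab-mono J (subst (_≤ toℕ p) (sym (toℕ-hi {n} s)) gt)))) (ℕ.<⇒≱ ℕ.≤-refl)

        q≡hi : q ≡ hi {n} s
        q≡hi with Fin.<-cmp q (hi {n} s)
        ... | tri≈ _ eq _ = eq
        ... | tri> _ _ gt = ⊥-elim (nothing-between
                (block-<⇒≺ c (subst₂ _<_ (sym p-block) (sym hi-s) ℕ.≤-refl)) gt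
                (merged⇒labM p-block hi-s) (block⇒labM (trans hi-s (sym q-block))))
        ... | tri< lt _ _ = contradiction (subst₂ _≤_ q-block lo-s (subst₂ _≤_ (lab-subsetOf c _) (lab-subsetOf c _)
                (lab-mono J (ℕ.≤-pred (subst (toℕ q <_) (toℕ-hi {n} s) lt))))) (ℕ.<⇒≱ ℕ.≤-refl)

        simple≈t : simple {n} r ≈ t
        simple≈t x = trans (simple-transpose {n} r x) (trans
          (cong₂ (λ x′ y′ → transpose x′ y′ ⟨$⟩ʳ x)
            (trans (sym wq) (cong (w ⟨$⟩ʳ_) q≡hi)) (trans (sym wp) (cong (w ⟨$⟩ʳ_) p≡lo)))
          (trans (transpose-comm (w ⟨$⟩ʳ hi s) (w ⟨$⟩ʳ lo s) x) (sym (t≈ x))))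

      -- Within one block of M, `p` and `q` either share a block of `c`, so that `lo r` and `hi r`
      -- share a block of `d`, or straddle the junction of blocks `i` and `i + 1`, which forces
      -- `simple r` to be `t`.
      ≉t⇒d : ¬ simple {n} r ≈ t → r ∈ subsetOf d
      ≉t⇒d ≉t with labM-≺ p≺q p~q
      ... | inj₁ eq           = ∈subsetOf⁺ d (trans (block-w _) (trans (cong (τ i) (sym eq)) (sym (block-w _))))
      ... | inj₂ (p-i , q-i′) = contradiction (simple≈t p-i q-i′) ≉t

  subsetOf-target : subsetOf d ≡ atomicTarget {n} J j
  subsetOf-target = ⊆-antisym
    (λ {r} r∈ → ∈-tabulate⁺ {n} _ (cong₂ (λ x y → x ∧ not y) (Vec.[]=⇒lookup (d⇒M r∈))
      (dec-false (simple {n} r ≈? t) (d⇒≉t r∈))))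
    (λ {r} r∈ → let x , y = ∧-true (∈-tabulate⁻ {n} _ r∈) in ≉t⇒d (Vec.lookup⇒[]= r M x) (not-does y))
    where
    ∧-true : ∀ {x y} → x ∧ y ≡ true → x ≡ true × y ≡ true
    ∧-true {true} {true} _ = refl , refl
    not-does : ∀ {r} → not (does (simple {n} r ≈? t)) ≡ true → ¬ simple {n} r ≈ t
    not-does {r} eq p = contradiction (trans (sym eq) (cong not (dec-true (simple {n} r ≈? t) p))) λ ()

  atomicCoset≈ : _≈ᶜ_ {I = atomicTarget {n} J j} {J} (atomicCoset {n} J j) ⟪ swapPermutation {c = c} {d} σ ⟫
  atomicCoset≈ = ε , reversal c , ∈W-ε , w₀∈W J , w≈

  -- `IsAtomic` fixes the target as `atomicTarget`. With the target a variable, matching on the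
  -- equation carries the atomic coset to the object `subsetOf d`.
  atomic-representative : (I : Subset (pred n)) → I ≡ atomicTarget {n} J j →
    Σ[ p ∈ Coset n I J ] IsAtomic J i p × p ≈ᶜ ⟪ swapPermutation {c = c} {d} σ ⟫
  atomic-representative _ refl =
    atomicCoset {n} J j , atomic j , atomicCoset≈

module _ {n : ℕ} {c d : Composition n} where

  atomic-swap : ∀ {i} (σ : SwapAt i (parts c) (parts d)) →
                Σ[ p ∈ Coset n (subsetOf d) (subsetOf c) ]
                  IsAtomic (subsetOf c) i p × p ≈ᶜ blockCoset c d (swapPermutation {c = c} {d} σ)
  atomic-swap σ with j , refl ← gap-exists c (SwapAt-bound σ) =
    Atomic.atomic-representative c d j σ (subsetOf d) (Atomic.subsetOf-target c d j σ)

-- Paths and normal forms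

infixr 5 _∷_ _⧺_

-- The head acts last, as in a composite. Bare lists are used because `shift` adjoins a part and so
-- changes the sum.
data Path : List ℕ → List ℕ → Set where
  []  : ∀ {xs} → Path xs xs
  _∷_ : ∀ {i xs ys zs} → SwapAt i ys zs → Path xs ys → Path xs zs

_⧺_ : ∀ {xs ys zs} → Path ys zs → Path xs ys → Path xs zs
[]      ⧺ v = v
(s ∷ u) ⧺ v = s ∷ (u ⧺ v)

⧺-assoc : ∀ {ws xs ys zs} (u : Path ys zs) (v : Path xs ys) (w : Path ws xs) → (u ⧺ v) ⧺ w ≡ u ⧺ (v ⧺ w)
⧺-assoc []      v w = refl
⧺-assoc (s ∷ u) v w = cong (s ∷_) (⧺-assoc u v w)

shift : ∀ {x xs ys} → Path xs ys → Path (x ∷ xs) (x ∷ ys)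
shift []      = []
shift (s ∷ u) = there s ∷ shift u

shift-⧺ : ∀ {x xs ys zs} (u : Path ys zs) (v : Path xs ys) → shift {x} (u ⧺ v) ≡ shift u ⧺ shift v
shift-⧺ []      v = refl
shift-⧺ (s ∷ u) v = cong (there s ∷_) (shift-⧺ u v)

infix 4 _~_

data _~_ : ∀ {xs ys} → Path xs ys → Path xs ys → Set where
  braid   : ∀ {i xs ys a b c d e} {w : Path xs ys}
            (σ₁ : SwapAt i ys a) (σ₂ : SwapAt (suc i) a b) (σ₃ : SwapAt i b e)
            (τ₁ : SwapAt (suc i) ys c) (τ₂ : SwapAt i c d) (τ₃ : SwapAt (suc i) d e) →
            σ₃ ∷ σ₂ ∷ σ₁ ∷ w ~ τ₃ ∷ τ₂ ∷ τ₁ ∷ w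
  distant : ∀ {i j xs ys a b c} {w : Path xs ys} → 1 < ∣ i - j ∣ →
            (σ₁ : SwapAt j ys a) (σ₂ : SwapAt i a c) (τ₁ : SwapAt i ys b) (τ₂ : SwapAt j b c) →
            σ₂ ∷ σ₁ ∷ w ~ τ₂ ∷ τ₁ ∷ w
  ~-refl  : ∀ {xs ys} {u : Path xs ys} → u ~ u
  ~-sym   : ∀ {xs ys} {u v : Path xs ys} → u ~ v → v ~ u
  ~-trans : ∀ {xs ys} {u v w : Path xs ys} → u ~ v → v ~ w → u ~ w
  ~-cons  : ∀ {i xs ys zs} {u v : Path xs ys} (s : SwapAt i ys zs) → u ~ v → s ∷ u ~ s ∷ v

data Vanishing : ∀ {xs ys} → Path xs ys → Set where
  square : ∀ {i xs ys zs} {w : Path xs ys} (s : SwapAt i ys zs) (t : SwapAt i zs ys) → Vanishing (t ∷ s ∷ w)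
  cons   : ∀ {i xs ys zs} {w : Path xs ys} (s : SwapAt i ys zs) → Vanishing w → Vanishing (s ∷ w)
  resp   : ∀ {xs ys} {u v : Path xs ys} → u ~ v → Vanishing v → Vanishing u

~-reflexive : ∀ {xs ys} {u v : Path xs ys} → u ≡ v → u ~ v
~-reflexive refl = ~-refl

~-⧺ˡ : ∀ {xs ys zs} (u : Path ys zs) {v w : Path xs ys} → v ~ w → u ⧺ v ~ u ⧺ w
~-⧺ˡ []      e = e
~-⧺ˡ (s ∷ u) e = ~-cons s (~-⧺ˡ u e)

~-⧺ʳ : ∀ {xs ys zs} {u v : Path ys zs} (w : Path xs ys) → u ~ v → u ⧺ w ~ v ⧺ w
~-⧺ʳ w (braid σ₁ σ₂ σ₃ τ₁ τ₂ τ₃) = braid σ₁ σ₂ σ₃ τ₁ τ₂ τ₃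
~-⧺ʳ w (distant lt σ₁ σ₂ τ₁ τ₂)  = distant lt σ₁ σ₂ τ₁ τ₂
~-⧺ʳ w ~-refl                    = ~-refl
~-⧺ʳ w (~-sym e)                 = ~-sym (~-⧺ʳ w e)
~-⧺ʳ w (~-trans e f)             = ~-trans (~-⧺ʳ w e) (~-⧺ʳ w f)
~-⧺ʳ w (~-cons s e)              = ~-cons s (~-⧺ʳ w e)

~-shift : ∀ {x xs ys} {u v : Path xs ys} → u ~ v → shift {x} u ~ shift v
~-shift (braid σ₁ σ₂ σ₃ τ₁ τ₂ τ₃) = braid (there σ₁) (there σ₂) (there σ₃) (there τ₁) (there τ₂) (there τ₃)
~-shift (distant lt σ₁ σ₂ τ₁ τ₂)  = distant lt (there σ₁) (there σ₂) (there τ₁) (there τ₂)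
~-shift ~-refl                    = ~-refl
~-shift (~-sym e)                 = ~-sym (~-shift e)
~-shift (~-trans e f)             = ~-trans (~-shift e) (~-shift f)
~-shift (~-cons s e)              = ~-cons (there s) (~-shift e)

Vanishing-⧺ʳ : ∀ {xs ys zs} {u : Path ys zs} (w : Path xs ys) → Vanishing u → Vanishing (u ⧺ w)
Vanishing-⧺ʳ w (square s t) = square s t
Vanishing-⧺ʳ w (cons s v)   = cons s (Vanishing-⧺ʳ w v)
Vanishing-⧺ʳ w (resp e v)   = resp (~-⧺ʳ w e) (Vanishing-⧺ʳ w v)

Vanishing-⧺ˡ : ∀ {xs ys zs} (u : Path ys zs) {w : Path xs ys} → Vanishing w → Vanishing (u ⧺ w)
Vanishing-⧺ˡ []      v = v
Vanishing-⧺ˡ (s ∷ u) v = cons s (Vanishing-⧺ˡ u v)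

Vanishing-shift : ∀ {x xs ys} {u : Path xs ys} → Vanishing u → Vanishing (shift {x} u)
Vanishing-shift (square s t) = square (there s) (there t)
Vanishing-shift (cons s v)   = cons (there s) (Vanishing-shift v)
Vanishing-shift (resp e v)   = resp (~-shift e) (Vanishing-shift v)

-- The letters of a doubly shifted path have index at least 2, so s_0 commutes with all of them.
here-shift² : ∀ {a b xs ys} (u : Path xs ys) →
              here {a} {b} ∷ shift (shift u) ~ shift (shift u) ⧺ (here ∷ [])
here-shift² []      = ~-refl
here-shift² (s ∷ u) = ~-trans (distant (s≤s (s≤s z≤n)) (there (there s)) here here (there (there s)))
                              (~-cons (there (there s)) (here-shift² u))

-- An insertion of x into ys is carried out by the run s_{j-1} ⋯ s_1 s_0
-- moving x from the front to position j.

data Insertion (x : ℕ) : List ℕ → List ℕ → Set where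
  here  : ∀ {ys} → Insertion x ys (x ∷ ys)
  there : ∀ {y ys zs} → Insertion x ys zs → Insertion x (y ∷ ys) (y ∷ zs)

run : ∀ {x ys zs} → Insertion x ys zs → Path (x ∷ ys) zs
run here      = []
run (there ι) = shift (run ι) ⧺ (here ∷ [])

-- The canonical words obtained from minimal coset representatives along the chain of symmetric
-- groups: the parts after the first are arranged recursively, and the first is then inserted.
data NormalForm : List ℕ → List ℕ → Set where
  []  : NormalForm [] []
  _◁_ : ∀ {x xs ys zs} → Insertion x ys zs → NormalForm xs ys → NormalForm (x ∷ xs) zs

path : ∀ {xs ys} → NormalForm xs ys → Path xs ys
path []      = []
path (ι ◁ N) = run ι ⧺ shift (path N)

idNormalForm : ∀ xs → NormalForm xs xs
idNormalForm []       = []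
idNormalForm (x ∷ xs) = here ◁ idNormalForm xs

path-id : ∀ xs → path (idNormalForm xs) ≡ []
path-id []       = refl
path-id (x ∷ xs) = cong shift (path-id xs)

-- For s_i in front of s_{j-1} ⋯ s_0: if i > j it passes unchanged, if i < j - 1 it passes by a
-- braid move and becomes s_{i+1}, if i = j it extends the run, and if i = j - 1 the product
-- vanishes. A letter that has passed has index at least 1, so it acts on the remaining parts.
data RunStep {i x ys zs zs′} (s : SwapAt i zs zs′) (ι : Insertion x ys zs) : Set where
  pass   : ∀ {i′ ys′} (s′ : SwapAt i′ ys ys′) (ι′ : Insertion x ys′ zs′) →
           s ∷ run ι ~ run ι′ ⧺ (there s′ ∷ []) → RunStep s ι
  extend : (ι′ : Insertion x ys zs′) → s ∷ run ι ~ run ι′ → RunStep s ι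
  vanish : Vanishing (s ∷ run ι) → RunStep s ι

run-step : ∀ {i x ys zs zs′} (s : SwapAt i zs zs′) (ι : Insertion x ys zs) → RunStep s ι
run-step (there s) here = pass s here ~-refl
run-step here      here = extend (there here) ~-refl
run-step (there s) (there ι) with run-step s ι
... | extend ι′ e = extend (there ι′) (~-⧺ʳ (here ∷ []) (~-shift e))
... | vanish v    = vanish (Vanishing-⧺ʳ (here ∷ []) (Vanishing-shift v))
... | pass s′ ι′ e = pass (there s′) (there ι′) (~-trans
        (~-⧺ʳ (here ∷ []) (~-trans (~-shift e) (~-reflexive (shift-⧺ (run ι′) (there s′ ∷ [])))))
        (~-trans (~-reflexive (⧺-assoc (shift (run ι′)) (there (there s′) ∷ []) (here ∷ [])))
          (~-trans (~-⧺ˡ (shift (run ι′)) (distant (s≤s (s≤s z≤n)) here (there (there s′)) (there (there s′)) here))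
            (~-reflexive (sym (⧺-assoc (shift (run ι′)) (here ∷ []) (there (there s′) ∷ [])))))))
run-step here (there here) = vanish (square here here)
-- The run is `u` followed on the right by s_1 s_0. After s_0 commutes past `u`, the braid relation
-- turns s_0 s_1 s_0 into s_1 s_0 s_1, that is, a run of the same length preceded by s_1.
run-step here (there (there ι)) = pass here (there (there ι)) (~-trans
  (~-trans (~-cons here (~-reflexive unfolded))
    (~-trans (~-⧺ʳ (there here ∷ here ∷ []) (here-shift² (run ι)))
      (~-trans (~-reflexive (⧺-assoc u (here ∷ []) (there here ∷ here ∷ [])))
        (~-⧺ˡ u (braid here (there here) here (there here) here (there here))))))
  (~-reflexive (sym (trans (⧺-assoc (shift (shift (run ι) ⧺ (here ∷ []))) (here ∷ []) (there here ∷ []))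
    (trans (cong (_⧺ (here ∷ there here ∷ [])) (shift-⧺ (shift (run ι)) (here ∷ [])))
      (⧺-assoc u (there here ∷ []) (here ∷ there here ∷ [])))))))
  where
  u : ∀ {a b} → Path (a ∷ b ∷ _) (a ∷ b ∷ _)
  u = shift (shift (run ι))
  unfolded : ∀ {y} → run (there {y = y} (there ι)) ≡ u ⧺ (there here ∷ here ∷ [])
  unfolded = trans (cong (_⧺ (here ∷ [])) (shift-⧺ (shift (run ι)) (here ∷ [])))
                   (⧺-assoc u (there here ∷ []) (here ∷ []))

normalise : ∀ {i xs ys zs} (s : SwapAt i ys zs) (N : NormalForm xs ys) →
            (∃ λ (N′ : NormalForm xs zs) → s ∷ path N ~ path N′) ⊎ Vanishing (s ∷ path N)
normalise s (ι ◁ N) with run-step s ι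
... | vanish v     = inj₂ (Vanishing-⧺ʳ (shift (path N)) v)
... | extend ι′ e  = inj₁ (ι′ ◁ N , ~-⧺ʳ (shift (path N)) e)
... | pass s′ ι′ e with normalise s′ N
...   | inj₁ (N′ , e′) = inj₁ (ι′ ◁ N′ , ~-trans (~-⧺ʳ (shift (path N)) e)
          (~-trans (~-reflexive (⧺-assoc (run ι′) (there s′ ∷ []) (shift (path N))))
            (~-⧺ˡ (run ι′) (~-shift e′))))
...   | inj₂ v = inj₂ (resp (~-trans (~-⧺ʳ (shift (path N)) e)
          (~-reflexive (⧺-assoc (run ι′) (there s′ ∷ []) (shift (path N)))))
          (Vanishing-⧺ˡ (run ι′) (Vanishing-shift v)))

-- Permutations of blocks along paths

perm : ∀ {xs ys} → Path xs ys → ℕ → ℕ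
perm []              k = k
perm (_∷_ {i = i} s u) k = τ i (perm u k)

perm-⧺ : ∀ {xs ys zs} (u : Path ys zs) (v : Path xs ys) k → perm (u ⧺ v) k ≡ perm u (perm v k)
perm-⧺ []                v k = refl
perm-⧺ (_∷_ {i = i} s u) v k = cong (τ i) (perm-⧺ u v k)

perm-shift-zero : ∀ {x xs ys} (u : Path xs ys) → perm (shift {x} u) 0 ≡ 0
perm-shift-zero []                = refl
perm-shift-zero (_∷_ {i = i} s u) = cong (τ (suc i)) (perm-shift-zero u)

perm-shift-suc : ∀ {x xs ys} (u : Path xs ys) k → perm (shift {x} u) (suc k) ≡ suc (perm u k)
perm-shift-suc []                k = refl
perm-shift-suc (_∷_ {i = i} s u) k = cong (τ (suc i)) (perm-shift-suc u k)

perm-injective : ∀ {xs ys} (u : Path xs ys) {k l} → perm u k ≡ perm u l → k ≡ l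
perm-injective []                eq = eq
perm-injective (_∷_ {i = i} s u) eq = perm-injective u (τ-injective i eq)

-- Reducedness tested letter by letter: exactly the condition under which every composition of atoms
-- along the path is governed by `blockCoset-∘`.
data Ascending : ∀ {xs ys} → Path xs ys → Set where
  []  : ∀ {xs} → Ascending ([] {xs})
  _∷_ : ∀ {i xs ys zs} {s : SwapAt i ys zs} {u : Path xs ys} → Ascent (perm u) i → Ascending u → Ascending (s ∷ u)

Ascending-shift : ∀ {x xs ys} {u : Path xs ys} → Ascending u → Ascending (shift {x} u)
Ascending-shift [] = []
Ascending-shift {x} (_∷_ {i = i} {u = u} asc r) = asc′ ∷ Ascending-shift r
  where
  asc′ : Ascent (perm (shift {x} u)) (suc i)
  asc′ zero    l       eq eq′ = contradiction (trans (sym (perm-shift-zero u)) eq) λ ()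
  asc′ (suc k) zero    eq eq′ = contradiction (trans (sym (perm-shift-zero u)) eq′) λ ()
  asc′ (suc k) (suc l) eq eq′ = s≤s (asc k l
    (ℕ.suc-injective (trans (sym (perm-shift-suc u k)) eq))
    (ℕ.suc-injective (trans (sym (perm-shift-suc u l)) eq′)))

-- The letters of a climb from k to j are k, k + 1, …, j - 1, in the order
-- in which they act.

data Climb (k : ℕ) : ∀ {xs ys} → ℕ → Path xs ys → Set where
  []  : ∀ {xs} → Climb k k ([] {xs})
  _∷_ : ∀ {j xs ys zs} {u : Path xs ys} (s : SwapAt j ys zs) → Climb k j u → Climb k (suc j) (s ∷ u)

Climb-shift : ∀ {k j x xs ys} {u : Path xs ys} → Climb k j u → Climb (suc k) (suc j) (shift {x} u)
Climb-shift []      = []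
Climb-shift (s ∷ r) = there s ∷ Climb-shift r

Climb-⧺ : ∀ {i j k xs ys zs} {u : Path ys zs} {v : Path xs ys} → Climb j k u → Climb i j v → Climb i k (u ⧺ v)
Climb-⧺ []      r = r
Climb-⧺ (s ∷ r) r′ = s ∷ Climb-⧺ r r′

place : ∀ {x ys zs} → Insertion x ys zs → ℕ
place here      = 0
place (there ι) = suc (place ι)

Climb-run : ∀ {x ys zs} (ι : Insertion x ys zs) → Climb 0 (place ι) (run ι)
Climb-run here      = []
Climb-run (there ι) = Climb-⧺ (Climb-shift (Climb-run ι)) (here ∷ [])

-- The climbing block has index 0 at the source, the least possible, so whichever block it overtakes
-- has a larger index and the step is an ascent.
Climb-ascending : ∀ {k j xs ys zs} {u : Path ys zs} {w : Path xs ys} → Climb k j u → Ascending w → perm w 0 ≡ k →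
                  Ascending (u ⧺ w) × perm (u ⧺ w) 0 ≡ j
Climb-ascending []               r eq = r , eq
Climb-ascending {w = w} (_∷_ {j} {u = u} s c) r eq with r′ , eq′ ← Climb-ascending c r eq =
  (asc ∷ r′) , trans (cong (τ j) eq′) (τ-left j)
  where
  asc : Ascent (perm (u ⧺ w)) j
  asc (suc k) l       p q = contradiction (perm-injective (u ⧺ w) (trans p (sym eq′))) λ ()
  asc zero    (suc l) p q = s≤s z≤n
  asc zero    zero    p q = contradiction (trans (sym p) q) (ℕ.<⇒≢ ℕ.≤-refl)

path-ascending : ∀ {xs ys} (N : NormalForm xs ys) → Ascending (path N)
path-ascending []      = []
path-ascending (ι ◁ N) = proj₁ (Climb-ascending (Climb-run ι) (Ascending-shift (path-ascending N))
  (perm-shift-zero (path N)))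

path-place : ∀ {x xs ys zs} (ι : Insertion x ys zs) (N : NormalForm xs ys) → perm (path (ι ◁ N)) 0 ≡ place ι
path-place ι N = proj₂ (Climb-ascending (Climb-run ι) (Ascending-shift (path-ascending N))
  (perm-shift-zero (path N)))

place-injective : ∀ {x ys ys′ zs} (ι : Insertion x ys zs) (ι′ : Insertion x ys′ zs) → place ι ≡ place ι′ →
                  _≡_ {A = ∃ λ ys → Insertion x ys zs} (ys , ι) (ys′ , ι′)
place-injective here      here       _  = refl
place-injective (there ι) (there ι′) eq with refl ← place-injective ι ι′ (ℕ.suc-injective eq) = refl

-- The image of 0 is the place of the outermost insertion, which determines both the run and the
-- list before it. The run can then be cancelled because `perm` is injective.
normalForm-unique : ∀ {xs zs} (N N′ : NormalForm xs zs) →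
                    (∀ {k} → k < length xs → perm (path N) k ≡ perm (path N′) k) → N ≡ N′
normalForm-unique []      []        _  = refl
normalForm-unique (ι ◁ N) (ι′ ◁ N′) eq
  with refl ← place-injective ι ι′
         (trans (sym (path-place ι N)) (trans (eq (s≤s z≤n)) (path-place ι′ N′)))
  = cong (ι ◁_) (normalForm-unique N N′ λ {k} lt →
      ℕ.suc-injective (perm-injective (run ι) (trans (sym (unfold N k)) (trans (eq (s≤s lt)) (unfold N′ k)))))
  where
  unfold : ∀ N k → perm (path (ι ◁ N)) (suc k) ≡ perm (run ι) (suc (perm (path N) k))
  unfold N k = trans (perm-⧺ (run ι) (shift (path N)) (suc k)) (cong (perm (run ι)) (perm-shift-suc (path N) k))

anyInsertion? : ∀ {x zs} {P : ∀ {ys} → Insertion x ys zs → Set} → (∀ {ys} (ι : Insertion x ys zs) → Dec (P ι)) →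
                Dec (∃₂ λ ys (ι : Insertion x ys zs) → P ι)
anyInsertion? {zs = []} P? = no λ ()
anyInsertion? {x} {z ∷ zs} {P} P? with anyInsertion? (P? ∘ there) | x ℕ.≟ z
... | yes (_ , ι , p) | _ = yes (_ , there ι , p)
... | no ¬there | no x≢z  = no λ { (_ , here , _) → x≢z refl ; (_ , there ι , p) → ¬there (_ , ι , p) }
... | no ¬there | yes refl with P? here
...   | yes p = yes (_ , here , p)
...   | no ¬p = no λ { (_ , here , p) → ¬p p ; (_ , there ι , p) → ¬there (_ , ι , p) }

anyNormalForm? : ∀ {xs zs} {P : NormalForm xs zs → Set} → (∀ N → Dec (P N)) → Dec (∃ P)
anyNormalForm? {[]}     {[]}    P? with P? []
... | yes p = yes ([] , p)
... | no ¬p = no λ { ([] , p) → ¬p p }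
anyNormalForm? {[]}     {_ ∷ _} P? = no λ { (() , _) }
anyNormalForm? {x ∷ xs}         P? with anyInsertion? (λ ι → anyNormalForm? (λ N → P? (ι ◁ N)))
... | yes (_ , ι , N , p) = yes (ι ◁ N , p)
... | no ¬p = no λ { (ι ◁ N , p) → ¬p (_ , ι , N , p) }

-- The isomorphism

module _ {n : ℕ} where

  Represents : (c d : Composition n) → (ℕ → ℕ) → Homᴰ {n} (subsetOf c) (subsetOf d) → Set
  Represents c d ρ f = ∃ λ b → BlockPermutation c d ρ b × f ≈ᴰ ∂ (blockCoset c d b)

  -- Increasing block permutations are determined by their action on block indices; this turns the
  -- braid and commutation relations into identities between the maps `τ`.
  represents-unique : ∀ {c d ρ ρ′ f g} → (∀ k → ρ k ≡ ρ′ k) → Represents c d ρ f → Represents c d ρ′ g → f ≈ᴰ g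
  represents-unique {c} {d} eq (a , A , f≈) (b , B , g≈) = ≈-trans f≈ (≈-trans
    (∂-cong (≈⇒≈ᶜ (blockCoset c d a) (blockCoset c d b) (blockPermutation-unique A B (λ x → eq _)))) (≈-sym g≈))

  one-represents : ∀ c → Represents c c (λ k → k) (∂ ⟪ ε ⟫)
  one-represents c = ε , ε-blockPermutation , ≈-refl

  atom : ∀ {c d i} → SwapAt i (parts c) (parts d) → Homᴰ {n} (subsetOf c) (subsetOf d)
  atom {c} {d} σ = ∂ (proj₁ (atomic-swap {c = c} {d} σ))

  atom≈ : ∀ {c d i} (σ : SwapAt i (parts c) (parts d)) →
          atom {c} {d} σ ≈ᴰ ∂ (blockCoset c d (swapPermutation {c = c} {d} σ))
  atom≈ {c} {d} σ = ∂-cong (proj₂ (proj₂ (atomic-swap {c = c} {d} σ)))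

  atom-represents : ∀ {c d i} (σ : SwapAt i (parts c) (parts d)) → Represents c d (τ i) (atom {c} {d} σ)
  atom-represents {c} {d} σ = swapPermutation {c = c} {d} σ , swap-blockPermutation {c = c} {d} σ , atom≈ {c} {d} σ

  atom-∘ : ∀ {c d e i ρ f} (σ : SwapAt i (parts d) (parts e)) → Represents c d ρ f → Ascent ρ i →
           Represents c e (τ i ∘ ρ) (atom {d} {e} σ ∘ᴰ f)
  atom-∘ {c} {d} {e} {f = f} σ (b , B , f≈) asc =
    swapPermutation {c = d} {e} σ · b , ·-blockPermutation (swap-blockPermutation {c = d} {e} σ) B ,
    ≈-trans (∘ᴰ-congˡ {n} {h = f} (atom≈ {d} {e} σ)) (≈-trans (∘ᴰ-congʳ {n} (∂ (blockCoset d e _)) f≈)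
      (blockCoset-∘ (swap-blockPermutation {c = d} {e} σ) B asc))

  atom-∘-zero : ∀ {c d e i ρ f} (σ : SwapAt i (parts d) (parts e)) → Represents c d ρ f →
                ∀ {k l} → k < length (parts c) → ρ k ≡ i → ρ l ≡ suc i → l < k → atom {d} {e} σ ∘ᴰ f ≈ᴰ 𝟘
  atom-∘-zero {c} {d} {e} {ρ = ρ} {f} σ (b , B , f≈) {k} {l} k< p q l<k
    -- Blocks are nonempty, so the indices `k` and `l` are realised by points, which form the
    -- cancelling pair.
    with x , refl ← block-onto c k< | y , refl ← block-onto c (ℕ.<-trans l<k k<) =
    ≈-trans (∘ᴰ-congˡ {n} {h = f} (atom≈ {d} {e} σ)) (≈-trans (∘ᴰ-congʳ {n} (∂ (blockCoset d e _)) f≈)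
      (blockCoset-∘-zero (swap-blockPermutation {c = d} {e} σ) B x y p q l<k))

  eval : ∀ {c d : Composition n} → Homᴸ c d → Homᴰ {n} (subsetOf c) (subsetOf d)
  eval {c} {d} (∂ i σ) = atom {c} {d} (swapAt σ)
  eval idᴸ      = ∂ ⟪ ε ⟫
  eval (f ∘ᴸ g) = eval f ∘ᴰ eval g
  eval 𝟘        = 𝟘
  eval (f ⊞ g)  = eval f ⊞ eval g
  eval (⊟ f)    = ⊟ eval f

  eval-generated : ∀ {c d : Composition n} (f : Homᴸ c d) → Generated (𝒟 n) (AtomicGenerator {n}) (eval f)
  eval-generated {c} {d} (∂ i σ) with atomic-swap {c = c} {d} (swapAt σ)
  ... | p , p-atomic , _ = generator (i , p , p-atomic , refl)
  eval-generated idᴸ      = one-closed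
  eval-generated (f ∘ᴸ g) = ∙-closed (eval-generated f) (eval-generated g)
  eval-generated 𝟘        = 0-closed
  eval-generated (f ⊞ g)  = ⊕-closed (eval-generated f) (eval-generated g)
  eval-generated (⊟ f)    = neg-closed (eval-generated f)

  ascent-τ : ∀ i k l {ρ} → (∀ m → ρ m ≡ i → m ≡ k) → (∀ m → ρ m ≡ suc i → m ≡ l) → k < l → Ascent ρ i
  ascent-τ i k l from-i from-1+i k<l m m′ p q = subst₂ _<_ (sym (from-i m p)) (sym (from-1+i m′ q)) k<l

  -- Both sides of `braid` and of `distant` are composed through ascents only, so each is a basis
  -- element given by its permutation of blocks. The preimages required for these ascents are
  -- computed with `τ-adjoint`.
  eval-cong : ∀ {c d : Composition n} {f g : Homᴸ c d} → f ≈ᴸ g → eval f ≈ᴰ eval g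
  eval-cong (braid {i} {c} {d₁} {d₂} {e₁} {e₂} {f} σ₁ σ₂ σ₃ τ₁ τ₂ τ₃) =
    represents-unique {c} {f} (τ-braid i)
      (atom-∘ {c} {d₂} {f} (swapAt σ₃) (atom-∘ {c} {d₁} {d₂} (swapAt σ₂) (atom-represents {c} {d₁} (swapAt σ₁))
        (ascent-τ (suc i) i (suc (suc i))
          (λ m p → trans (τ-adjoint i p) (τ-right i)) (λ m p → trans (τ-adjoint i p) (τ-above i)) (ℕ.n≤1+n _)))
        (ascent-τ i (suc i) (suc (suc i))
          (λ m p → trans (τ-adjoint i (trans (τ-adjoint (suc i) p) (τ-below i))) (τ-left i))
          (λ m p → trans (τ-adjoint i (trans (τ-adjoint (suc i) p) (τ-left (suc i)))) (τ-above i)) ℕ.≤-refl))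
      (atom-∘ {c} {e₂} {f} (swapAt τ₃) (atom-∘ {c} {e₁} {e₂} (swapAt τ₂) (atom-represents {c} {e₁} (swapAt τ₁))
        (ascent-τ i i (suc (suc i))
          (λ m p → trans (τ-adjoint (suc i) p) (τ-below i)) (λ m p → trans (τ-adjoint (suc i) p) (τ-left (suc i))) (ℕ.n≤1+n _)))
        (ascent-τ (suc i) i (suc i)
          (λ m p → trans (τ-adjoint (suc i) (trans (τ-adjoint i p) (τ-right i))) (τ-below i))
          (λ m p → trans (τ-adjoint (suc i) (trans (τ-adjoint i p) (τ-above i))) (τ-right (suc i))) ℕ.≤-refl))
  eval-cong (distant {i} {j} {c} {d} {e} {f} lt σ₁ σ₂ τ₁ τ₂) =
    represents-unique {c} {f} (τ-commute i j lt)
      (atom-∘ {c} {d} {f} (swapAt σ₂) (atom-represents {c} {d} (swapAt σ₁))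
        (ascent-τ i i (suc i)
          (λ m p → trans (τ-adjoint j p) (proj₁ (τ-far j i lt′)))
          (λ m p → trans (τ-adjoint j p) (proj₂ (τ-far j i lt′))) ℕ.≤-refl))
      (atom-∘ {c} {e} {f} (swapAt τ₂) (atom-represents {c} {e} (swapAt τ₁))
        (ascent-τ j j (suc j)
          (λ m p → trans (τ-adjoint i p) (proj₁ (τ-far i j lt)))
          (λ m p → trans (τ-adjoint i p) (proj₂ (τ-far i j lt))) ℕ.≤-refl))
    where
    lt′ : 1 < ∣ j - i ∣
    lt′ = subst (1 <_) (ℕ.∣-∣-comm i j) lt
  eval-cong (square {i} {c} {d} σ σ′) =
    -- After the first exchange, `i` comes from block `i + 1` and `i + 1` from block `i`, the order
    -- in which the second exchange cancels.
    atom-∘-zero {c} {d} {c} (swapAt σ′) (atom-represents {c} {d} (swapAt σ))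
      (SwapAt-bound (swapAt σ)) (τ-right i) (τ-left i) ℕ.≤-refl
  eval-cong ≈-refl             = ≈-refl
  eval-cong (≈-sym e)          = ≈-sym (eval-cong e)
  eval-cong (≈-trans e e′)     = ≈-trans (eval-cong e) (eval-cong e′)
  eval-cong (⊞-cong e e′)      = ⊞-cong (eval-cong e) (eval-cong e′)
  eval-cong (⊟-cong e)         = ⊟-cong (eval-cong e)
  eval-cong (⊞-assoc f g h)    = ⊞-assoc _ _ _
  eval-cong (⊞-comm f g)       = ⊞-comm _ _
  eval-cong (⊞-identity f)     = ⊞-identity _
  eval-cong (⊞-inverse f)      = ⊞-inverse _
  eval-cong (∘-cong {f′ = f′} {g} e e′) = ≈-trans (∘ᴰ-congˡ {n} {h = eval g} (eval-cong e)) (∘ᴰ-congʳ {n} (eval f′) (eval-cong e′))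
  eval-cong (∘-assoc f g h)    = ∘ᴰ-assoc {n} (eval f) (eval g) (eval h)
  eval-cong (∘-identityˡ f)    = ∘ᴰ-identityˡ {n} (eval f)
  eval-cong (∘-identityʳ f)    = ∘ᴰ-identityʳ {n} (eval f)
  eval-cong (∘-distribˡ f g h) = ∘ᴰ-distribˡ {n} (eval f) (eval g) (eval h)
  eval-cong (∘-distribʳ f g h) = ≈-refl

  -- Interpretation of paths and spanning by normal forms

  Valid : List ℕ → Set
  Valid xs = All (0 <_) xs × sum xs ≡ n

  comp : (xs : List ℕ) → Valid xs → Composition n
  comp xs v = record { parts = xs ; positive = proj₁ v ; sum≡n = proj₂ v }

  valid : (c : Composition n) → Valid (parts c)
  valid c = positive c , sum≡n c

  valid-irrelevant : ∀ {xs} (v v′ : Valid xs) → v ≡ v′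
  valid-irrelevant (p , q) (p′ , q′) = cong₂ _,_ (All.irrelevant ℕ.<-irrelevant p p′) (ℕ.≡-irrelevant q q′)

  SwapAt-valid : ∀ {i xs ys} → SwapAt i xs ys → Valid xs → Valid ys
  SwapAt-valid s (p , q) = SwapAt-positive s p , trans (sym (SwapAt-sum s)) q

  path-valid : ∀ {xs ys} → Path xs ys → Valid xs → Valid ys
  path-valid []      v = v
  path-valid (s ∷ u) v = SwapAt-valid s (path-valid u v)

  -- Validity is a proposition, so the proof at the far end may be prescribed; a path can thus end
  -- at a given composition instead of at the one that `path-valid` computes.
  ⟦_⟧ : ∀ {xs ys} → Path xs ys → (v : Valid xs) (v′ : Valid ys) → Homᴸ (comp xs v) (comp ys v′)
  ⟦ [] ⟧ v v′ with refl ← valid-irrelevant v v′ = idᴸ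
  ⟦ _∷_ {i = i} s u ⟧ v v′ = ∂ i (swap s) ∘ᴸ ⟦ u ⟧ v (path-valid u v)

  ⟦∷⟧ : ∀ {i xs ys zs} (s : SwapAt i ys zs) (u : Path xs ys) v v′ v″ →
        ⟦ s ∷ u ⟧ v v″ ≡ ∂ i (swap s) ∘ᴸ ⟦ u ⟧ v v′
  ⟦∷⟧ s u v v′ v″ with refl ← valid-irrelevant v′ (path-valid u v) = refl

  ⟦[]⟧ : ∀ {xs} (v : Valid xs) → ⟦ [] ⟧ v v ≡ idᴸ
  ⟦[]⟧ v with valid-irrelevant v v
  ... | refl = refl

  ≈ᴸ-reflexive : ∀ {c d : Composition n} {f g : Homᴸ c d} → f ≡ g → f ≈ᴸ g
  ≈ᴸ-reflexive refl = ≈-refl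

  ~-sound : ∀ {xs ys} {u u′ : Path xs ys} → u ~ u′ → ∀ v v′ → ⟦ u ⟧ v v′ ≈ᴸ ⟦ u′ ⟧ v v′
  ~-sound (braid {w = w} σ₁ σ₂ σ₃ τ₁ τ₂ τ₃) v v′ = ≈-trans (≈-sym (assoc₃ _ _ _ (⟦ w ⟧ v _)))
    (≈-trans (∘-cong (braid (swap σ₁) (swap σ₂) (swap σ₃) (swap τ₁) (swap τ₂) (swap τ₃)) ≈-refl)
      (assoc₃ _ _ _ (⟦ w ⟧ v _)))
    where
    assoc₃ : ∀ {a b c d e : Composition n} (f : Homᴸ d e) (g : Homᴸ c d) (h : Homᴸ b c) (k : Homᴸ a b) →
             (f ∘ᴸ g ∘ᴸ h) ∘ᴸ k ≈ᴸ f ∘ᴸ g ∘ᴸ h ∘ᴸ k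
    assoc₃ f g h k = ≈-trans (∘-assoc f (g ∘ᴸ h) k) (∘-cong ≈-refl (∘-assoc g h k))
  ~-sound (distant {w = w} lt σ₁ σ₂ τ₁ τ₂) v v′ = ≈-trans (≈-sym (∘-assoc _ _ (⟦ w ⟧ v _)))
    (≈-trans (∘-cong (distant lt (swap σ₁) (swap σ₂) (swap τ₁) (swap τ₂)) ≈-refl) (∘-assoc _ _ (⟦ w ⟧ v _)))
  ~-sound ~-refl        v v′ = ≈-refl
  ~-sound (~-sym e)     v v′ = ≈-sym (~-sound e v v′)
  ~-sound (~-trans e f) v v′ = ≈-trans (~-sound e v v′) (~-sound f v v′)
  ~-sound (~-cons {u = u} {u′} s e) v v′ = ≈-trans (∘-cong ≈-refl (~-sound e v (path-valid u v)))
    (≈ᴸ-reflexive (sym (⟦∷⟧ s u′ v (path-valid u v) v′)))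

  ∘-zeroˡ : ∀ {b c d : Composition n} (h : Homᴸ b c) → 𝟘 {d = d} ∘ᴸ h ≈ᴸ 𝟘
  ∘-zeroˡ {b} {d = d} h = identityʳ-unique (𝟘 ∘ᴸ h) (𝟘 ∘ᴸ h)
    (≈-trans (≈-sym (∘-distribʳ 𝟘 𝟘 h)) (∘-cong (⊞-identity 𝟘) ≈-refl))
    where open AbelianGroupProperties (RawLinearCategory.Hom (LNC n) b d) using (identityʳ-unique)

  ∘-zeroʳ : ∀ {b c d : Composition n} (h : Homᴸ c d) → h ∘ᴸ 𝟘 {c = b} ≈ᴸ 𝟘
  ∘-zeroʳ {b} {d = d} h = identityʳ-unique (h ∘ᴸ 𝟘) (h ∘ᴸ 𝟘)
    (≈-trans (≈-sym (∘-distribˡ h 𝟘 𝟘)) (∘-cong ≈-refl (⊞-identity 𝟘)))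
    where open AbelianGroupProperties (RawLinearCategory.Hom (LNC n) b d) using (identityʳ-unique)

  ∘-⊟ʳ : ∀ {b c d : Composition n} (h : Homᴸ c d) (f : Homᴸ b c) → h ∘ᴸ (⊟ f) ≈ᴸ ⊟ (h ∘ᴸ f)
  ∘-⊟ʳ {b} {d = d} h f = inverseˡ-unique (h ∘ᴸ (⊟ f)) (h ∘ᴸ f)
    (≈-trans (≈-sym (∘-distribˡ h (⊟ f) f)) (≈-trans (∘-cong ≈-refl (⊞-inverse f)) (∘-zeroʳ h)))
    where open AbelianGroupProperties (RawLinearCategory.Hom (LNC n) b d) using (inverseˡ-unique)

  ∘-⊟ˡ : ∀ {b c d : Composition n} (h : Homᴸ c d) (f : Homᴸ b c) → (⊟ h) ∘ᴸ f ≈ᴸ ⊟ (h ∘ᴸ f)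
  ∘-⊟ˡ {b} {d = d} h f = inverseˡ-unique ((⊟ h) ∘ᴸ f) (h ∘ᴸ f)
    (≈-trans (≈-sym (∘-distribʳ (⊟ h) h f)) (≈-trans (∘-cong (⊞-inverse h) ≈-refl) (∘-zeroˡ f)))
    where open AbelianGroupProperties (RawLinearCategory.Hom (LNC n) b d) using (inverseˡ-unique)

  Vanishing-sound : ∀ {xs ys} {u : Path xs ys} → Vanishing u → ∀ v v′ → ⟦ u ⟧ v v′ ≈ᴸ 𝟘
  Vanishing-sound (square {w = w} s t) v v′ = ≈-trans (∘-cong ≈-refl (≈ᴸ-reflexive (⟦∷⟧ s w v v′ _)))
    (≈-trans (≈-sym (∘-assoc _ _ (⟦ w ⟧ v v′))) (≈-trans (∘-cong (square (swap s) (swap t)) ≈-refl) (∘-zeroˡ (⟦ w ⟧ v v′))))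
  Vanishing-sound (cons {w = w} s e) v v′ = ≈-trans (∘-cong ≈-refl (Vanishing-sound e v (path-valid w v))) (∘-zeroʳ _)
  Vanishing-sound (resp e e′) v v′ = ≈-trans (~-sound e v v′) (Vanishing-sound e′ v v′)

  data Span {c d : Composition n} : Homᴸ c d → Set where
    normal : (N : NormalForm (parts c) (parts d)) → Span (⟦ path N ⟧ (valid c) (valid d))
    zero   : Span 𝟘
    plus   : ∀ {f g} → Span f → Span g → Span (f ⊞ g)
    neg    : ∀ {f} → Span f → Span (⊟ f)
    resp   : ∀ {f g} → f ≈ᴸ g → Span g → Span f

  -- The right factor is reduced to a single normal form before `f` is decomposed, so only a
  -- generator on a normal form remains, which `normalise` settles.
  span-∘ : ∀ {b c d} (f : Homᴸ c d) {g : Homᴸ b c} → Span g → Span (f ∘ᴸ g)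
  span-∘ f zero         = resp (∘-zeroʳ f) zero
  span-∘ f (plus p q)   = resp (∘-distribˡ f _ _) (plus (span-∘ f p) (span-∘ f q))
  span-∘ f (neg p)      = resp (∘-⊟ʳ f _) (neg (span-∘ f p))
  span-∘ f (resp e p)   = resp (∘-cong ≈-refl e) (span-∘ f p)
  span-∘ idᴸ p@(normal N) = resp (∘-identityˡ _) p
  span-∘ (f ∘ᴸ g) p@(normal N) = resp (∘-assoc f g _) (span-∘ f (span-∘ g p))
  span-∘ 𝟘 (normal N)   = resp (∘-zeroˡ _) zero
  span-∘ (f ⊞ g) p@(normal N) = resp (∘-distribʳ f g _) (plus (span-∘ f p) (span-∘ g p))
  span-∘ (⊟ f) p@(normal N) = resp (∘-⊟ˡ f _) (neg (span-∘ f p))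
  span-∘ {b} {c} {d} (∂ i σ) (normal N) with normalise (swapAt σ) N
  ... | inj₁ (N′ , e) = resp (≈-trans (≈ᴸ-reflexive (sym (⟦∷⟧ (swapAt σ) (path N) (valid b) (valid c) (valid d))))
                                     (~-sound e (valid b) (valid d))) (normal N′)
  ... | inj₂ e        = resp (≈-trans (≈ᴸ-reflexive (sym (⟦∷⟧ (swapAt σ) (path N) (valid b) (valid c) (valid d))))
                                     (Vanishing-sound e (valid b) (valid d))) zero

  -- `f` is applied to the identity, itself a normal form in which every insertion is at the front.
  span : ∀ {c d} (f : Homᴸ c d) → Span f
  span {c} f = resp (≈-sym (∘-identityʳ f)) (span-∘ f (resp (≈ᴸ-reflexive (sym (trans
    (cong (λ u → ⟦ u ⟧ (valid c) (valid c)) (path-id (parts c))) (⟦[]⟧ (valid c))))) (normal (idNormalForm (parts c)))))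

  path-represents : ∀ {xs ys} {u : Path xs ys} → Ascending u → ∀ v v′ →
                    Represents (comp xs v) (comp ys v′) (perm u) (eval (⟦ u ⟧ v v′))
  path-represents {xs} [] v v′ with valid-irrelevant v v′
  ... | refl = one-represents (comp xs v)
  path-represents {xs} (_∷_ {ys = ys} {zs} {s} {u} asc r) v v′ =
    atom-∘ {comp xs v} {comp ys (path-valid u v)} {comp zs v′} s (path-represents r v (path-valid u v)) asc

  -- The left inverse of evaluation

  module _ {c d : Composition n} where

    private
      normalForm-represents : (N : NormalForm (parts c) (parts d)) →
        Represents c d (perm (path N)) (eval (⟦ path N ⟧ (valid c) (valid d)))
      normalForm-represents N = path-represents (path-ascending N) (valid c) (valid d)

    cosetOf : NormalForm (parts c) (parts d) → Coset n (subsetOf d) (subsetOf c)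
    cosetOf N = blockCoset c d (proj₁ (normalForm-represents N))

    cosetOf-injective : ∀ N N′ → cosetOf N ≈ᶜ cosetOf N′ → N ≡ N′
    cosetOf-injective N N′ eq = normalForm-unique N N′ same
      where
      same : ∀ {k} → k < length (parts c) → perm (path N) k ≡ perm (path N′) k
      same k< with x , refl ← block-onto c k< =
        blockCoset-injective (proj₁ (proj₂ (normalForm-represents N)))
                             (proj₁ (proj₂ (normalForm-represents N′))) eq x

    eval-normalForm : ∀ N → eval (⟦ path N ⟧ (valid c) (valid d)) ≈ᴰ ∂ (cosetOf N)
    eval-normalForm N = proj₂ (proj₂ (normalForm-represents N))

    findNormalForm : (p : Coset n (subsetOf d) (subsetOf c)) → Dec (∃ λ N → p ≈ᶜ cosetOf N)
    findNormalForm p = anyNormalForm? (λ N → rep p ∈ᶜ? cosetOf N)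

    -- The outcome of the search is an argument, so that well-definedness on cosets can be proved by
    -- comparing two outcomes.
    lift : (p : Coset n (subsetOf d) (subsetOf c)) → Dec (∃ λ N → p ≈ᶜ cosetOf N) → Homᴸ c d
    lift p (yes (N , _)) = ⟦ path N ⟧ (valid c) (valid d)
    lift p (no _)        = 𝟘

    lift-cong : ∀ p q → p ≈ᶜ q → (p? : Dec (∃ λ N → p ≈ᶜ cosetOf N)) (q? : Dec (∃ λ N → q ≈ᶜ cosetOf N)) →
                lift p p? ≈ᴸ lift q q?
    lift-cong p q p≈q (yes (N , p≈)) (yes (N′ , q≈)) = ≈ᴸ-reflexive (cong (λ N → ⟦ path N ⟧ (valid c) (valid d))
      (cosetOf-injective N N′ (∈ᶜ-trans q (cosetOf N′) (rep (cosetOf N))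
        (∈ᶜ-trans p q (rep (cosetOf N)) (≈ᶜ-sym p (cosetOf N) p≈) p≈q) q≈)))
    lift-cong p q p≈q (yes (N , p≈)) (no ¬q) = contradiction
      (N , ∈ᶜ-trans p (cosetOf N) (rep q) (≈ᶜ-sym p q p≈q) p≈) ¬q
    lift-cong p q p≈q (no ¬p) (yes (N , q≈)) = contradiction (N , ∈ᶜ-trans q (cosetOf N) (rep p) p≈q q≈) ¬p
    lift-cong p q p≈q (no _) (no _) = ≈-refl

    retract : Homᴰ {n} (subsetOf c) (subsetOf d) → Homᴸ c d
    retract (∂ p)   = lift p (findNormalForm p)
    retract 𝟘       = 𝟘
    retract (f ⊞ g) = retract f ⊞ retract g
    retract (⊟ f)   = ⊟ retract f

    retract-cong : ∀ {f g} → f ≈ᴰ g → retract f ≈ᴸ retract g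
    retract-cong (∂-cong {p} {q} p≈q) = lift-cong p q p≈q (findNormalForm p) (findNormalForm q)
    retract-cong ≈-refl           = ≈-refl
    retract-cong (≈-sym e)        = ≈-sym (retract-cong e)
    retract-cong (≈-trans e e′)   = ≈-trans (retract-cong e) (retract-cong e′)
    retract-cong (⊞-cong e e′)    = ⊞-cong (retract-cong e) (retract-cong e′)
    retract-cong (⊟-cong e)       = ⊟-cong (retract-cong e)
    retract-cong (⊞-assoc f g h)  = ⊞-assoc _ _ _
    retract-cong (⊞-comm f g)     = ⊞-comm _ _
    retract-cong (⊞-identity f)   = ⊞-identity _
    retract-cong (⊞-inverse f)    = ⊞-inverse _

    retract-eval : ∀ {f} → Span f → retract (eval f) ≈ᴸ f
    retract-eval (normal N) = ≈-trans (retract-cong (eval-normalForm N)) (found (findNormalForm (cosetOf N)))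
      where
      found : (p? : Dec (∃ λ N′ → cosetOf N ≈ᶜ cosetOf N′)) → lift (cosetOf N) p? ≈ᴸ ⟦ path N ⟧ (valid c) (valid d)
      found (yes (N′ , eq)) = ≈ᴸ-reflexive (cong (λ N → ⟦ path N ⟧ (valid c) (valid d)) (sym (cosetOf-injective N N′ eq)))
      found (no ¬p)         = contradiction (N , ≈ᶜ-refl (cosetOf N)) ¬p
    retract-eval zero       = ≈-refl
    retract-eval (plus p q) = ⊞-cong (retract-eval p) (retract-eval q)
    retract-eval (neg p)    = ⊟-cong (retract-eval p)
    retract-eval (resp e p) = ≈-trans (retract-cong (eval-cong e)) (≈-trans (retract-eval p) (≈-sym e))

    eval-injective : (f g : Homᴸ c d) → eval f ≈ᴰ eval g → f ≈ᴸ g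
    eval-injective f g eq = ≈-trans (≈-sym (retract-eval (span f))) (≈-trans (retract-cong eq) (retract-eval (span g)))

  -- Surjectivity onto the atomic subcategory

  atom-subst : ∀ {I I′ J : Subset (pred n)} (eq : I ≡ I′) (p : Coset n I J) (q : Coset n I′ J) (b : W n) →
               p ≈ᶜ ⟪ b ⟫ → q ≈ᶜ ⟪ b ⟫ → subst (Homᴰ J) eq (∂ p) ≈ᴰ ∂ q
  atom-subst refl p q b p≈ q≈ = ∂-cong (∈ᶜ-trans ⟪ b ⟫ q (rep p) p≈ (≈ᶜ-sym q ⟪ b ⟫ q≈))

  -- Induction over `Generated` meets arbitrary subsets, in particular `atomicTarget`, that are not
  -- literally of the form `subsetOf c`; quantifying over compositions with equations keeps the
  -- induction possible.
  Image : ∀ {I J} → Homᴰ {n} J I → Set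
  Image {I} {J} f = ∀ c d (p : subsetOf c ≡ J) (q : subsetOf d ≡ I) →
                    ∃ λ (x : Homᴸ c d) → subst₂ (Homᴰ {n}) p q (eval x) ≈ᴰ f

  generated⇒image : ∀ {I J} {f : Homᴰ J I} → Generated (𝒟 n) (AtomicGenerator {n}) f → Image f
  generated⇒image (generator (_ , _ , atomic j , refl)) c d refl q
    -- Exchanging the parts `j` and `j + 1` of `c` gives a composition whose subset is the atomic
    -- target, so injectivity of `subsetOf` identifies it with `d`.
    with d′ , σ ← SwapAt-exists (gap-bound c j)
    with refl ← subsetOf-injective {n} {d} {comp d′ (SwapAt-valid σ (valid c))}
           (trans q (sym (Atomic.subsetOf-target c (comp d′ (SwapAt-valid σ (valid c))) j σ)))
    = let p , _ , p≈ = atomic-swap {c = c} {d} σ in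
      ∂ (toℕ j) (swap σ) ,
      ≈-trans (≡⇒≈ (subst₂-subst q (∂ p)))
        (atom-subst q p (atomicCoset {n} (subsetOf c) j) (swapPermutation {c = c} {d} σ)
          p≈ (Atomic.atomicCoset≈ c d j σ))
    where
    ≡⇒≈ : ∀ {I J} {f g : Homᴰ {n} J I} → f ≡ g → f ≈ᴰ g
    ≡⇒≈ refl = ≈-refl
    subst₂-subst : ∀ {I I′ J : Subset (pred n)} (eq : I ≡ I′) (f : Homᴰ J I) → subst₂ (Homᴰ {n}) refl eq f ≡ subst (Homᴰ J) eq f
    subst₂-subst refl f = refl
  generated⇒image (one-closed {A}) c d refl q with refl ← subsetOf-injective {n} {d} {c} q with refl ← q = idᴸ , ≈-refl
  -- The intermediate subset B comes without a composition; surjectivity of `subsetOf` supplies one.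
  generated⇒image (∙-closed {A} {B} {C} {f} {g} gf gg) c d refl refl =
    via (compositionOf {n} B) (subsetOf-compositionOf {n} B)
    where
    via : ∀ e → subsetOf e ≡ B → ∃ λ (x : Homᴸ c d) → eval x ≈ᴰ f ∘ᴰ g
    via e refl with x , x≈ ← generated⇒image gf e d refl refl | y , y≈ ← generated⇒image gg c e refl refl =
      x ∘ᴸ y , ≈-trans (∘ᴰ-congˡ {n} {h = eval y} x≈) (∘ᴰ-congʳ {n} f y≈)
  generated⇒image 0-closed c d refl refl = 𝟘 , ≈-refl
  generated⇒image (⊕-closed gf gg) c d refl refl
    with x , x≈ ← generated⇒image gf c d refl refl | y , y≈ ← generated⇒image gg c d refl refl = x ⊞ y , ⊞-cong x≈ y≈
  generated⇒image (neg-closed gf) c d refl refl with x , x≈ ← generated⇒image gf c d refl refl = ⊟ x , ⊟-cong x≈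
  generated⇒image (≋-closed e gf) c d p q with x , x≈ ← generated⇒image gf c d p q = x , ≈-trans x≈ e

LNC-isLinear : ∀ n → IsLinearCategory (LNC n)
LNC-isLinear n = record
  { ∙-cong    = ∘-cong
  ; assoc     = ∘-assoc
  ; identityˡ = ∘-identityˡ
  ; identityʳ = ∘-identityʳ
  ; distribˡ  = ∘-distribˡ
  ; distribʳ  = ∘-distribʳ
  }

ψ : ∀ n → LinearIsomorphism (LNC n) (𝒜𝒟 n)
ψ n = record
  { source-isLinear = LNC-isLinear n
  ; target-isLinear = subcategory-isLinear (𝒟 n) (AtomicGenerator {n}) (𝒟-isLinear n)
  ; F₀              = subsetOf
  ; F₁              = λ f → eval f , eval-generated f
  ; F₀-bijective    = subsetOf-bijective
  ; F₁-isomorphism  = λ {c} {d} → record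
    { isGroupMonomorphism = record
      { isGroupHomomorphism = record
        { isMonoidHomomorphism = record
          { isMagmaHomomorphism = record
            { isRelHomomorphism = record { cong = eval-cong }
            ; homo              = λ _ _ → ≈-refl }
          ; ε-homo = ≈-refl }
        ; ⁻¹-homo = λ _ → ≈-refl }
      ; injective = λ {f} {g} → eval-injective f g }
    ; surjective = λ (g , g∈) → let x , x≈g = generated⇒image g∈ c d refl refl in
        x , λ z≈x → ≈-trans (eval-cong z≈x) x≈g }
  ; F₁-one          = ≈-refl
  ; F₁-∙            = λ _ _ → ≈-refl
  }

proposition3p19 : (n : ℕ) →
    Σ[ ψ ∈ LinearIsomorphism (LNC n) (𝒜𝒟 n) ]
    (let open LinearIsomorphism ψ in
    ((c : Composition n) → c ↔ˢ F₀ c)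
    × (∀ {c d} i (σ : Swap i c d) →
    Σ[ p ∈ Coset n (F₀ d) (F₀ c) ]
    (IsAtomic (F₀ c) i p × proj₁ (F₁ (∂ i σ)) ≈ᴰ ∂ p)))
proposition3p19 n = ψ n , ↔ˢ-subsetOf , λ {c} {d} i σ →
  let p , p-atomic , _ = atomic-swap {c = c} {d} (swapAt σ) in p , p-atomic , ≈-refl
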